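{- Let $c>1$ be a constant, and let $c_1$ be the supremum of all real numbers $a$ with $0<a\le c/2$ for which there is a constant $\delta>0$ such that $\binom{c\log n}{a\log n}=\tilde O(n^{1-\delta})$. Then for every constant $\epsilon$ with $0<\epsilon<\min(c_1,c-1)$ there is a data structure for OV indexing on $n$ input vectors of length $c\log n$ that has truly sublinear query time and uses $$O\!\left(n^{\,c-\frac{c_1-\epsilon}{c}(c-1-\epsilon)}\right)$$ space.
   Context: Orthogonal Vectors Indexing (OV indexing): given a set $S$ of $n$ boolean vectors of length $d$, preprocess $S$ into a data structure that answers queries of the form: given $v\in\{0,1\}^d$, is there a vector in $S$ orthogonal to $v$? Vectors $u,v\in\{0,1\}^d$ are orthogonal if there is no coordinate $i$ with $u_i=v_i=1$. Here $d=c\log n$ for a constant $c>1$; $\log$ is base 2 and quantities such as $c\log n$ and $a\log n$ are rounded to integers. The model is the standard word RAM with words of $\Theta(\log n)$ bits; space is the size of the data structure produced by preprocessing. "Truly sublinear" means $O(n^{1-\delta'})$ for some constant $\delta'>0$ (independent of $n$). The notation $\tilde O(f)$ suppresses all factors that are smaller than $n^{\eta}$ for every constant $\eta>0$. Constants hidden in $O(\cdot)$ may depend on $c$ and $\epsilon$. -}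

module Defs where

open import Data.Bool.Base using (Bool; true; false; T; _∧_; _∨_; _xor_; if_then_else_)
open import Data.Fin.Base using (Fin; toℕ)
open import Data.Integer.Base using (+_; -[1+_])
open import Data.List.Base using (List; []; _∷_; _++_; length)
open import Data.Maybe.Base using (Maybe; just; nothing)
open import Data.Nat.Base as ℕ using (ℕ; zero; suc; _≡ᵇ_; _<ᵇ_)
open import Data.Nat.Combinatorics using (_C_)
open import Data.Nat.DivMod using (_mod_)
open import Data.Nat.Logarithm using (⌊log₂_⌋)
import Data.Nat.Properties as ℕₚ
open import Data.Product.Base using (Σ-syntax; ∃-syntax; _×_; _,_)
open import Data.Rational.Base as ℚ using (ℚ; 0ℚ; 1ℚ; ½; ↥_; ↧ₙ_)
import Data.Rational.Properties as ℚₚ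
open import Data.Rational.Solver using (module +-*-Solver)
open import Data.Vec.Base as Vec using (Vec)
open import Data.Vec.Functional using (Vector; updateAt)
open import Data.Vec.Relation.Unary.Any using (Any)
open import Data.Vec.Relation.Unary.Unique.Propositional using (Unique)
open import Function.Base using (const)
open import Function.Bundles using (_⇔_)
open import Relation.Binary.PropositionalEquality
open import Relation.Nullary using (¬_)

------------------------------------------------------------------------
-- Real numbers as Cauchy sequences of rationals

Cauchy : (ℕ → ℚ) → Set
Cauchy x = ∀ ε → 0ℚ ℚ.< ε → ∃[ N ] ∀ m n → N ℕ.≤ m → N ℕ.≤ n →
           ℚ.∣ x m ℚ.- x n ∣ ℚ.≤ ε

record ℝ : Set where
  constructor mkℝ
  field
    seq    : ℕ → ℚ
    cauchy : Cauchy seq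

open ℝ public

infix 4 _<_ _≤_

_<_ : ℝ → ℝ → Set
x < y = ∃[ q ] 0ℚ ℚ.< q × ∃[ N ] ∀ n → N ℕ.≤ n → seq x n ℚ.+ q ℚ.≤ seq y n

_≤_ : ℝ → ℝ → Set
x ≤ y = ∀ q → 0ℚ ℚ.< q → ∃[ N ] ∀ n → N ℕ.≤ n → seq x n ℚ.≤ seq y n ℚ.+ q

private
  halve : ∀ {ε} → 0ℚ ℚ.< ε → ∃[ ε′ ] 0ℚ ℚ.< ε′ × ε′ ℚ.+ ε′ ≡ ε
  halve {ε} ε>0 = ½ ℚ.* ε ,
    subst (ℚ._< ½ ℚ.* ε) (ℚₚ.*-zeroʳ ½) (ℚₚ.*-monoʳ-<-pos ½ ε>0) ,
    trans (sym (ℚₚ.*-distribʳ-+ ε ½ ½)) (ℚₚ.*-identityˡ ε)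

  ⊔≤ˡ : ∀ {a b m} → a ℕ.⊔ b ℕ.≤ m → a ℕ.≤ m
  ⊔≤ˡ {a} {b} = ℕₚ.≤-trans (ℕₚ.m≤m⊔n a b)

  ⊔≤ʳ : ∀ {a b m} → a ℕ.⊔ b ℕ.≤ m → b ℕ.≤ m
  ⊔≤ʳ {a} {b} = ℕₚ.≤-trans (ℕₚ.m≤n⊔m a b)

  const-cauchy : ∀ q → Cauchy (const q)
  const-cauchy q ε ε>0 = 0 , λ _ _ _ _ →
    subst (λ z → ℚ.∣ z ∣ ℚ.≤ ε) (sym (ℚₚ.+-inverseʳ q)) (ℚₚ.<⇒≤ ε>0)

  +-cauchy : ∀ x y → Cauchy x → Cauchy y → Cauchy (λ n → x n ℚ.+ y n)
  +-cauchy x y cx cy ε ε>0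
    with ε′ , ε′>0 , ε′+ε′ ← halve ε>0
    with N₁ , h₁ ← cx ε′ ε′>0
       | N₂ , h₂ ← cy ε′ ε′>0
    = N₁ ℕ.⊔ N₂ , λ m n N≤m N≤n → begin
      ℚ.∣ (x m ℚ.+ y m) ℚ.- (x n ℚ.+ y n) ∣
        ≡⟨ cong ℚ.∣_∣ (eq (x m) (y m) (x n) (y n)) ⟩
      ℚ.∣ (x m ℚ.- x n) ℚ.+ (y m ℚ.- y n) ∣
        ≤⟨ ℚₚ.∣p+q∣≤∣p∣+∣q∣ (x m ℚ.- x n) (y m ℚ.- y n) ⟩
      ℚ.∣ x m ℚ.- x n ∣ ℚ.+ ℚ.∣ y m ℚ.- y n ∣
        ≤⟨ ℚₚ.+-mono-≤ (h₁ m n (⊔≤ˡ N≤m) (⊔≤ˡ N≤n))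
                       (h₂ m n (⊔≤ʳ {N₁} N≤m) (⊔≤ʳ {N₁} N≤n)) ⟩
      ε′ ℚ.+ ε′ ≡⟨ ε′+ε′ ⟩
      ε ∎
    where
    open ℚₚ.≤-Reasoning
    eq : ∀ a b c d → (a ℚ.+ b) ℚ.- (c ℚ.+ d) ≡ (a ℚ.- c) ℚ.+ (b ℚ.- d)
    eq = solve 4 (λ a b c d → (a :+ b) :- (c :+ d) := (a :- c) :+ (b :- d)) refl
      where open +-*-Solver

  neg-cauchy : ∀ x → Cauchy x → Cauchy (λ n → ℚ.- x n)
  neg-cauchy x cx ε ε>0 with N , h ← cx ε ε>0 = N , λ m n N≤m N≤n →
    subst (ℚ._≤ ε)
      (trans (sym (ℚₚ.∣-p∣≡∣p∣ (x m ℚ.- x n)))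
             (cong ℚ.∣_∣ (ℚₚ.neg-distrib-+ (x m) (ℚ.- x n))))
      (h m n N≤m N≤n)

  bounded : ∀ x → Cauchy x →
            ∃[ B ] ℚ.Positive B × ∃[ N ] ∀ n → N ℕ.≤ n → ℚ.∣ x n ∣ ℚ.≤ B
  bounded x cx with N , h ← cx 1ℚ (ℚₚ.positive⁻¹ 1ℚ) =
    ℚ.∣ x N ∣ ℚ.+ 1ℚ ,
    ℚₚ.nonNeg+pos⇒pos ℚ.∣ x N ∣ {{ℚₚ.∣-∣-nonNeg (x N)}} 1ℚ ,
    N , λ n N≤n → begin
      ℚ.∣ x n ∣                         ≡⟨ cong ℚ.∣_∣ (eq (x N) (x n)) ⟩
      ℚ.∣ x N ℚ.+ (x n ℚ.- x N) ∣       ≤⟨ ℚₚ.∣p+q∣≤∣p∣+∣q∣ (x N) (x n ℚ.- x N) ⟩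
      ℚ.∣ x N ∣ ℚ.+ ℚ.∣ x n ℚ.- x N ∣   ≤⟨ ℚₚ.+-monoʳ-≤ ℚ.∣ x N ∣ (h n N N≤n ℕₚ.≤-refl) ⟩
      ℚ.∣ x N ∣ ℚ.+ 1ℚ                  ∎
    where
    open ℚₚ.≤-Reasoning
    eq : ∀ a b → b ≡ a ℚ.+ (b ℚ.- a)
    eq = solve 2 (λ a b → b := a :+ (b :- a)) refl
      where open +-*-Solver

  shrink : ∀ B → ℚ.Positive B → ∀ ε → 0ℚ ℚ.< ε →
           ∃[ δ ] 0ℚ ℚ.< δ × B ℚ.* δ ≡ ε
  shrink B B>0 ε ε>0 = (ℚ.1/ B) ℚ.* ε , δ>0 ,
    trans (sym (ℚₚ.*-assoc B (ℚ.1/ B) ε))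
      (trans (cong (ℚ._* ε) (ℚₚ.*-inverseʳ B)) (ℚₚ.*-identityˡ ε))
    where
    instance
      _ = B>0
      _ = ℚₚ.pos⇒nonZero B
    δ>0 : 0ℚ ℚ.< (ℚ.1/ B) ℚ.* ε
    δ>0 = subst (ℚ._< (ℚ.1/ B) ℚ.* ε) (ℚₚ.*-zeroʳ (ℚ.1/ B))
            (ℚₚ.*-monoʳ-<-pos (ℚ.1/ B) {{ℚₚ.1/pos⇒pos B}} ε>0)

  *-mono-∣∣ : ∀ {a b P q} → ℚ.Positive P → ℚ.∣ a ∣ ℚ.≤ P → ℚ.∣ b ∣ ℚ.≤ q →
              ℚ.∣ a ℚ.* b ∣ ℚ.≤ P ℚ.* q
  *-mono-∣∣ {a} {b} {P} {q} P>0 a≤P b≤q = begin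
    ℚ.∣ a ℚ.* b ∣          ≡⟨ ℚₚ.∣p*q∣≡∣p∣*∣q∣ a b ⟩
    ℚ.∣ a ∣ ℚ.* ℚ.∣ b ∣    ≤⟨ ℚₚ.*-monoʳ-≤-nonNeg ℚ.∣ b ∣ {{ℚₚ.∣-∣-nonNeg b}} a≤P ⟩
    P ℚ.* ℚ.∣ b ∣          ≤⟨ ℚₚ.*-monoˡ-≤-nonNeg P {{ℚₚ.pos⇒nonNeg P {{P>0}}}} b≤q ⟩
    P ℚ.* q                ∎
    where open ℚₚ.≤-Reasoning

  product-close : ∀ {a b c d A B α β} → ℚ.Positive A → ℚ.Positive B →
    ℚ.∣ a ∣ ℚ.≤ A → ℚ.∣ d ∣ ℚ.≤ B → ℚ.∣ b ℚ.- d ∣ ℚ.≤ α → ℚ.∣ a ℚ.- c ∣ ℚ.≤ β →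
    ℚ.∣ a ℚ.* b ℚ.- c ℚ.* d ∣ ℚ.≤ A ℚ.* α ℚ.+ B ℚ.* β
  product-close {a} {b} {c} {d} {A} {B} {α} {β} A>0 B>0 a≤A d≤B b-d≤α a-c≤β = begin
    ℚ.∣ a ℚ.* b ℚ.- c ℚ.* d ∣
      ≡⟨ cong ℚ.∣_∣ eq ⟩
    ℚ.∣ a ℚ.* (b ℚ.- d) ℚ.+ d ℚ.* (a ℚ.- c) ∣
      ≤⟨ ℚₚ.∣p+q∣≤∣p∣+∣q∣ (a ℚ.* (b ℚ.- d)) (d ℚ.* (a ℚ.- c)) ⟩
    ℚ.∣ a ℚ.* (b ℚ.- d) ∣ ℚ.+ ℚ.∣ d ℚ.* (a ℚ.- c) ∣
      ≤⟨ ℚₚ.+-mono-≤ (*-mono-∣∣ {a} {b ℚ.- d} A>0 a≤A b-d≤α)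
                     (*-mono-∣∣ {d} {a ℚ.- c} B>0 d≤B a-c≤β) ⟩
    A ℚ.* α ℚ.+ B ℚ.* β ∎
    where
    open ℚₚ.≤-Reasoning
    eq : a ℚ.* b ℚ.- c ℚ.* d ≡ a ℚ.* (b ℚ.- d) ℚ.+ d ℚ.* (a ℚ.- c)
    eq = solve 4 (λ a b c d → a :* b :- c :* d := a :* (b :- d) :+ d :* (a :- c)) refl a b c d
      where open +-*-Solver

  *-cauchy : ∀ x y → Cauchy x → Cauchy y → Cauchy (λ n → x n ℚ.* y n)
  *-cauchy x y cx cy ε ε>0 =
    let
      A , A>0 , Na , hA = bounded x cx
      B , B>0 , Nb , hB = bounded y cy
      ε′ , ε′>0 , ε′+ε′ = halve ε>0
      α , α>0 , Aα = shrink A A>0 ε′ ε′>0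
      β , β>0 , Bβ = shrink B B>0 ε′ ε′>0
      N₁ , h₁ = cx β β>0
      N₂ , h₂ = cy α α>0
      bounds = λ m N≤m →
        ⊔≤ˡ {Na} {Nb} (⊔≤ˡ {Na ℕ.⊔ Nb} {N₁ ℕ.⊔ N₂} {m} N≤m) ,
        ⊔≤ʳ {Na} {Nb} (⊔≤ˡ {Na ℕ.⊔ Nb} {N₁ ℕ.⊔ N₂} {m} N≤m) ,
        ⊔≤ˡ {N₁} {N₂} (⊔≤ʳ {Na ℕ.⊔ Nb} {N₁ ℕ.⊔ N₂} {m} N≤m) ,
        ⊔≤ʳ {N₁} {N₂} (⊔≤ʳ {Na ℕ.⊔ Nb} {N₁ ℕ.⊔ N₂} {m} N≤m)
    in (Na ℕ.⊔ Nb) ℕ.⊔ (N₁ ℕ.⊔ N₂) , λ m n N≤m N≤n →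
      let
        a≤m , _ , 1≤m , 2≤m = bounds m N≤m
        _ , b≤n , 1≤n , 2≤n = bounds n N≤n
      in subst (ℚ.∣ x m ℚ.* y m ℚ.- x n ℚ.* y n ∣ ℚ.≤_)
           (trans (cong₂ ℚ._+_ Aα Bβ) ε′+ε′)
           (product-close {x m} {y m} {x n} {y n} {A} {B} {α} {β} A>0 B>0
             (hA m a≤m) (hB n b≤n) (h₂ m n 2≤m 2≤n) (h₁ m n 1≤m 1≤n))

  ⊔-pos : ∀ {q} → 0ℚ ℚ.< q → ∀ p → ℚ.Positive (q ℚ.⊔ p)
  ⊔-pos {q} q>0 p = ℚ.positive (ℚₚ.<-≤-trans q>0 (ℚₚ.p≤p⊔q q p))

  recip : ∀ {q} → 0ℚ ℚ.< q → ℚ → ℚ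
  recip {q} q>0 p = (ℚ.1/ (q ℚ.⊔ p)) {{ℚₚ.pos⇒nonZero (q ℚ.⊔ p) {{⊔-pos q>0 p}}}}

  recip-pos : ∀ {q} (q>0 : 0ℚ ℚ.< q) p → ℚ.Positive (recip q>0 p)
  recip-pos {q} q>0 p = ℚₚ.1/pos⇒pos (q ℚ.⊔ p) {{⊔-pos q>0 p}}

  recip-nonNeg : ∀ {q} (q>0 : 0ℚ ℚ.< q) p → ℚ.NonNegative (recip q>0 p)
  recip-nonNeg q>0 p = ℚₚ.pos⇒nonNeg (recip q>0 p) {{recip-pos q>0 p}}

  recip²-pos : ∀ {q} (q>0 : 0ℚ ℚ.< q) p → ℚ.Positive (recip q>0 p ℚ.* recip q>0 p)
  recip²-pos q>0 p =
    ℚₚ.pos*pos⇒pos (recip q>0 p) {{recip-pos q>0 p}} (recip q>0 p) {{recip-pos q>0 p}}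

  *-recip : ∀ {q} (q>0 : 0ℚ ℚ.< q) p → q ℚ.≤ p → p ℚ.* recip q>0 p ≡ 1ℚ
  *-recip {q} q>0 p q≤p =
    trans (cong (ℚ._* recip q>0 p) (sym (ℚₚ.p≤q⇒p⊔q≡q q≤p)))
          (ℚₚ.*-inverseʳ (q ℚ.⊔ p) {{ℚₚ.pos⇒nonZero (q ℚ.⊔ p) {{⊔-pos q>0 p}}}})

  recip-≤ : ∀ {q} (q>0 : 0ℚ ℚ.< q) p → q ℚ.≤ p → recip q>0 p ℚ.≤ recip q>0 q
  recip-≤ {q} q>0 p q≤p = ℚₚ.*-cancelˡ-≤-pos q {{ℚ.positive q>0}} (begin
    q ℚ.* recip q>0 p
      ≤⟨ ℚₚ.*-monoʳ-≤-nonNeg (recip q>0 p) {{recip-nonNeg q>0 p}} q≤p ⟩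
    p ℚ.* recip q>0 p  ≡⟨ *-recip q>0 p q≤p ⟩
    1ℚ                 ≡⟨ *-recip q>0 q ℚₚ.≤-refl ⟨
    q ℚ.* recip q>0 q  ∎)
    where open ℚₚ.≤-Reasoning

  reciprocal-close : ∀ {u v r a b δ} →
    ℚ.NonNegative u → ℚ.NonNegative v → ℚ.NonNegative r →
    u ℚ.≤ r → v ℚ.≤ r → a ℚ.* u ≡ 1ℚ → b ℚ.* v ≡ 1ℚ → ℚ.∣ b ℚ.- a ∣ ℚ.≤ δ →
    ℚ.∣ u ℚ.- v ∣ ℚ.≤ (r ℚ.* r) ℚ.* δ
  reciprocal-close {u} {v} {r} {a} {b} {δ} u≥0 v≥0 r≥0 u≤r v≤r au bv b-a≤δ = begin
    ℚ.∣ u ℚ.- v ∣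
      ≡⟨ cong ℚ.∣_∣ eq ⟩
    ℚ.∣ (u ℚ.* v) ℚ.* (b ℚ.- a) ∣
      ≡⟨ ℚₚ.∣p*q∣≡∣p∣*∣q∣ (u ℚ.* v) (b ℚ.- a) ⟩
    ℚ.∣ u ℚ.* v ∣ ℚ.* ℚ.∣ b ℚ.- a ∣
      ≡⟨ cong (ℚ._* ℚ.∣ b ℚ.- a ∣) (ℚₚ.0≤p⇒∣p∣≡p (ℚₚ.nonNegative⁻¹ (u ℚ.* v) {{uv≥0}})) ⟩
    (u ℚ.* v) ℚ.* ℚ.∣ b ℚ.- a ∣
      ≤⟨ ℚₚ.*-monoʳ-≤-nonNeg ℚ.∣ b ℚ.- a ∣ {{ℚₚ.∣-∣-nonNeg (b ℚ.- a)}}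
           (ℚₚ.≤-trans (ℚₚ.*-monoʳ-≤-nonNeg v {{v≥0}} u≤r)
                       (ℚₚ.*-monoˡ-≤-nonNeg r {{r≥0}} v≤r)) ⟩
    (r ℚ.* r) ℚ.* ℚ.∣ b ℚ.- a ∣
      ≤⟨ ℚₚ.*-monoˡ-≤-nonNeg (r ℚ.* r) {{rr≥0}} b-a≤δ ⟩
    (r ℚ.* r) ℚ.* δ ∎
    where
    open ℚₚ.≤-Reasoning
    uv≥0 = ℚₚ.nonNeg*nonNeg⇒nonNeg u {{u≥0}} v {{v≥0}}
    rr≥0 = ℚₚ.nonNeg*nonNeg⇒nonNeg r {{r≥0}} r {{r≥0}}
    eq : u ℚ.- v ≡ (u ℚ.* v) ℚ.* (b ℚ.- a)
    eq = sym (trans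
      (solve 4 (λ u v a b → (u :* v) :* (b :- a) := u :* (b :* v) :- v :* (a :* u)) refl u v a b)
      (cong₂ ℚ._-_ (trans (cong (u ℚ.*_) bv) (ℚₚ.*-identityʳ u))
                   (trans (cong (v ℚ.*_) au) (ℚₚ.*-identityʳ v))))
      where open +-*-Solver

  recip-cauchy : ∀ x {q N} (q>0 : 0ℚ ℚ.< q) → (∀ n → N ℕ.≤ n → q ℚ.≤ x n) →
                 Cauchy x → Cauchy (λ n → recip q>0 (x n))
  recip-cauchy x {q} {N} q>0 q≤x cx ε ε>0 =
    let
      r = recip q>0 q
      δ , δ>0 , δε = shrink (r ℚ.* r) (recip²-pos q>0 q) ε ε>0
      N′ , h = cx δ δ>0
    in N ℕ.⊔ N′ , λ m n N≤m N≤n →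
      let
        q≤xm = q≤x m (⊔≤ˡ {N} {N′} {m} N≤m)
        q≤xn = q≤x n (⊔≤ˡ {N} {N′} {n} N≤n)
      in subst (ℚ.∣ recip q>0 (x m) ℚ.- recip q>0 (x n) ∣ ℚ.≤_) δε
           (reciprocal-close
             {recip q>0 (x m)} {recip q>0 (x n)} {r} {x m} {x n} {δ}
             (recip-nonNeg q>0 (x m)) (recip-nonNeg q>0 (x n)) (recip-nonNeg q>0 q)
             (recip-≤ q>0 (x m) q≤xm) (recip-≤ q>0 (x n) q≤xn)
             (*-recip q>0 (x m) q≤xm) (*-recip q>0 (x n) q≤xn)
             (h n m (⊔≤ʳ {N} {N′} {n} N≤n) (⊔≤ʳ {N} {N′} {m} N≤m)))

infixl 6 _+_ _-_
infixl 7 _*_ _/_[_]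

fromℚ : ℚ → ℝ
fromℚ q = mkℝ (const q) (const-cauchy q)

0ℝ 1ℝ ½ℝ : ℝ
0ℝ = fromℚ 0ℚ
1ℝ = fromℚ 1ℚ
½ℝ = fromℚ ½

_+_ _-_ _*_ : ℝ → ℝ → ℝ
x + y = mkℝ (λ n → seq x n ℚ.+ seq y n) (+-cauchy (seq x) (seq y) (cauchy x) (cauchy y))
x - y = mkℝ (λ n → seq x n ℚ.- seq y n)
  (+-cauchy (seq x) (λ n → ℚ.- seq y n) (cauchy x) (neg-cauchy (seq y) (cauchy y)))
x * y = mkℝ (λ n → seq x n ℚ.* seq y n) (*-cauchy (seq x) (seq y) (cauchy x) (cauchy y))

-- Only finitely many terms y n can lie below the rational lower bound q
-- extracted from 0 < y, so replacing y n by q ⊔ y n (which `recip` does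
-- before inverting) leaves the limit unchanged.
_/_[_] : ∀ x y → 0ℝ < y → ℝ
x / y [ q , q>0 , N , q≤y ] =
  x * mkℝ (λ n → recip q>0 (seq y n)) (recip-cauchy (seq y) q>0 q≤y′ (cauchy y))
  where
  q≤y′ : ∀ n → N ℕ.≤ n → q ℚ.≤ seq y n
  q≤y′ n N≤n = subst (ℚ._≤ seq y n) (ℚₚ.+-identityˡ q) (q≤y n N≤n)

1<⇒0< : ∀ x → 1ℝ < x → 0ℝ < x
1<⇒0< _ (q , q>0 , N , h) = q , q>0 , N , λ n N≤n →
  ℚₚ.≤-trans (ℚₚ.+-monoˡ-≤ q (ℚₚ.nonNegative⁻¹ 1ℚ)) (h n N≤n)

IsSupremum : (ℝ → Set) → ℝ → Set
IsSupremum P s = (∀ x → P x → x ≤ s) × (∀ y → y < s → ∃[ x ] P x × y < x)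

------------------------------------------------------------------------
-- Comparing natural numbers with b · n ^ x

-- For q = (q⁺ - q⁻) / k, compare a ^ k · n ^ q⁻ with b ^ k · n ^ q⁺.

q⁺ q⁻ : ℚ → ℕ
q⁺ q with ↥ q
... | + m      = m
... | -[1+ _ ] = 0
q⁻ q with ↥ q
... | + _      = 0
... | -[1+ m ] = suc m

infix 4 _≤_·_^ℚ_ _<_·_^ℚ_ _·_^ℚ_<_ _≤_·_^_

_≤_·_^ℚ_ _<_·_^ℚ_ : ℕ → ℕ → ℕ → ℚ → Set
a ≤ b · n ^ℚ q = a ℕ.^ ↧ₙ q ℕ.* n ℕ.^ q⁻ q ℕ.≤ b ℕ.^ ↧ₙ q ℕ.* n ℕ.^ q⁺ q
a < b · n ^ℚ q = a ℕ.^ ↧ₙ q ℕ.* n ℕ.^ q⁻ q ℕ.< b ℕ.^ ↧ₙ q ℕ.* n ℕ.^ q⁺ q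

_·_^ℚ_<_ : ℕ → ℕ → ℚ → ℕ → Set
b · n ^ℚ q < a = b ℕ.^ ↧ₙ q ℕ.* n ℕ.^ q⁺ q ℕ.< a ℕ.^ ↧ₙ q ℕ.* n ℕ.^ q⁻ q

-- n ^ x is the infimum of n ^ q over the rationals q > x (for n ≥ 1).
_≤_·_^_ : ℕ → ℕ → ℕ → ℝ → Set
a ≤ b · n ^ x = ∀ q → x < fromℚ q → a ≤ b · n ^ℚ q

-- d is ⌊ x log₂ n ⌋ or ⌈ x log₂ n ⌉, i.e. d - 1 < x log₂ n < d + 1,
-- i.e. 2 ^ d < 2 · n ^ x and n ^ x < 2 ^ (d + 1).  By continuity of the
-- exponential a strict inequality involving n ^ x already holds with a
-- rational exponent on the appropriate side of x.
_Rounds_·log_ : ℕ → ℝ → ℕ → Set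
d Rounds x ·log n =
  (∃[ q ] fromℚ q < x × (2 ℕ.^ d < 2 · n ^ℚ q)) ×
  (∃[ q ] x < fromℚ q × (1 · n ^ℚ q < 2 ℕ.^ suc d))

-- f n i = O(n ^ x), uniformly in i.
_is-O[n^_] : {I : ℕ → Set} → (∀ n → I n → ℕ) → ℝ → Set
f is-O[n^ x ] = ∃[ C ] ∃[ N ] ∀ n → N ℕ.≤ n → ∀ i → f n i ≤ C · n ^ x

_is-Õ[n^_] : {I : ℕ → Set} → (∀ n → I n → ℕ) → ℝ → Set
f is-Õ[n^ x ] = ∀ η → 0ℝ < η → f is-O[n^ x + η ]

TrulySublinear : {I : ℕ → Set} → (∀ n → I n → ℕ) → Set
TrulySublinear f = ∃[ δ ] 0ℝ < δ × f is-O[n^ 1ℝ - δ ]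

Roundings : ℝ → ℝ → ℕ → Set
Roundings c a n = Σ[ (d , k) ∈ ℕ × ℕ ] d Rounds c ·log n × k Rounds a ·log n

binomial : ∀ c a n → Roundings c a n → ℕ
binomial c a n ((d , k) , _) = d C k

Admissible : ℝ → ℝ → Set
Admissible c a = 0ℝ < a × a ≤ c * ½ℝ ×
  (∃[ δ ] 0ℝ < δ × binomial c a is-Õ[n^ 1ℝ - δ ])

------------------------------------------------------------------------
-- Word RAM with r registers, w-bit words and 2 ^ w memory cells

data Op : Set where
  add sub mul div mod and or xor shl shr eq lt : Op

-- set x k       : R[x] := k
-- op o x y z    : R[x] := R[y] o R[z]
-- load x y      : R[x] := M[R[y]]
-- store x y     : M[R[x]] := R[y]
-- jump ℓ        : go to instruction ℓ
-- jumpZero x ℓ  : go to instruction ℓ if R[x] = 0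
-- halt b        : stop with answer b
data Instr (r : ℕ) : Set where
  set      : (x : Fin r) (k : ℕ) → Instr r
  op       : (o : Op) (x y z : Fin r) → Instr r
  load     : (x y : Fin r) → Instr r
  store    : (x y : Fin r) → Instr r
  jump     : (ℓ : ℕ) → Instr r
  jumpZero : (x : Fin r) (ℓ : ℕ) → Instr r
  halt     : (b : Bool) → Instr r

Program : ℕ → Set
Program r = List (Instr r)

fetch : ∀ {A : Set} → List A → ℕ → Maybe A
fetch []       _       = nothing
fetch (x ∷ _)  zero    = just x
fetch (_ ∷ xs) (suc i) = fetch xs i

bitwise : (Bool → Bool → Bool) → (w x y : ℕ) → ℕ
bitwise f zero    x y = 0
bitwise f (suc w) x y =
  (if f (x ℕ.% 2 ≡ᵇ 1) (y ℕ.% 2 ≡ᵇ 1) then 1 else 0) ℕ.+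
  2 ℕ.* bitwise f w (x ℕ./ 2) (y ℕ./ 2)

module RAM (w : ℕ) where

  Word : Set
  Word = Fin (2 ℕ.^ w)

  wrap : ℕ → Word
  wrap x = _mod_ x (2 ℕ.^ w) {{ℕₚ.m^n≢0 2 w}}

  -- Results are reduced modulo 2 ^ w; division and remainder by zero
  -- give zero.
  compute : Op → ℕ → ℕ → ℕ
  compute add a b       = a ℕ.+ b
  compute sub a b       = (2 ℕ.^ w ℕ.+ a) ℕ.∸ b
  compute mul a b       = a ℕ.* b
  compute div a zero    = 0
  compute div a (suc b) = a ℕ./ suc b
  compute mod a zero    = 0
  compute mod a (suc b) = a ℕ.% suc b
  compute and a b       = bitwise _∧_ w a b
  compute or  a b       = bitwise _∨_ w a b
  compute xor a b       = bitwise _xor_ w a b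
  compute shl a b       = a ℕ.* 2 ℕ.^ b
  compute shr a b       = ℕ._/_ a (2 ℕ.^ b) {{ℕₚ.m^n≢0 2 b}}
  compute eq  a b       = if a ≡ᵇ b then 1 else 0
  compute lt  a b       = if a <ᵇ b then 1 else 0

  ⟦_⟧ : Op → Word → Word → Word
  ⟦ o ⟧ x y = wrap (compute o (toℕ x) (toℕ y))

  record State (r : ℕ) : Set where
    constructor ⟨_,_,_⟩
    field
      pc   : ℕ
      regs : Vector Word r
      mem  : Vector Word (2 ℕ.^ w)

  _[_]≔_ : ∀ {m} → Vector Word m → Fin m → Word → Vector Word m
  xs [ i ]≔ x = updateAt xs i (const x)

  -- run P t s is the answer of P when started in s, if P halts within t
  -- unit-cost steps; leaving the program text is not halting.
  run  : ∀ {r} → Program r → ℕ → State r → Maybe Bool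
  exec : ∀ {r} → Program r → ℕ → State r → Maybe (Instr r) → Maybe Bool

  run P zero    s = nothing
  run P (suc t) s = exec P t s (fetch P (State.pc s))

  exec P t _             nothing               = nothing
  exec P t ⟨ i , R , M ⟩ (just (set x k))      = run P t ⟨ suc i , R [ x ]≔ wrap k , M ⟩
  exec P t ⟨ i , R , M ⟩ (just (op o x y z))   = run P t ⟨ suc i , R [ x ]≔ ⟦ o ⟧ (R y) (R z) , M ⟩
  exec P t ⟨ i , R , M ⟩ (just (load x y))     = run P t ⟨ suc i , R [ x ]≔ M (R y) , M ⟩
  exec P t ⟨ i , R , M ⟩ (just (store x y))    = run P t ⟨ suc i , R , M [ R x ]≔ R y ⟩
  exec P t ⟨ i , R , M ⟩ (just (jump ℓ))       = run P t ⟨ ℓ , R , M ⟩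
  exec P t ⟨ i , R , M ⟩ (just (jumpZero x ℓ)) =
    run P t ⟨ (if toℕ (R x) ≡ᵇ 0 then ℓ else suc i) , R , M ⟩
  exec P t ⟨ i , R , M ⟩ (just (halt b))       = just b

  contents : List Word → ℕ → Word
  contents []       _       = wrap 0
  contents (x ∷ _)  zero    = x
  contents (_ ∷ xs) (suc i) = contents xs i

  -- Memory holds the given words from address 0 on, and zeros elsewhere.
  initial : ∀ {r} → List Word → State r
  initial xs = ⟨ 0 , (λ _ → wrap 0) , (λ a → contents xs (toℕ a)) ⟩

------------------------------------------------------------------------
-- OV indexing

Orthogonal : ∀ {d} → Vec Bool d → Vec Bool d → Set
Orthogonal {d} u v = ∀ (i : Fin d) → ¬ (Vec.lookup u i ≡ true × Vec.lookup v i ≡ true)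

record Instance (c : ℝ) (n : ℕ) : Set where
  field
    dim      : ℕ
    rounds   : dim Rounds c ·log n
    vectors  : Vec (Vec Bool dim) n
    distinct : Unique vectors

open Instance public

Query : (c : ℝ) → ℕ → Set
Query c n = Σ[ S ∈ Instance c n ] Vec Bool (dim S)

encode : ∀ w {d} → Vec Bool d → List (RAM.Word w)
encode w v = Vec.toList (Vec.map (λ b → RAM.wrap w (if b then 1 else 0)) v)

answer : ∀ w {r d} → Program r → List (RAM.Word w) → Vec Bool d → ℕ → Maybe Bool
answer w P D v t = RAM.run w P t (RAM.initial w (D ++ encode w v))

-- A query program finds the data structure at address 0, followed by the
-- coordinates of the query vector, one per word.  Working memory beyond
-- the data structure is not charged as space.
record OVDataStructure (c : ℝ) : Set where
  field
    wordSize    : ℕ → ℕ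
    wordSize-Θ  : ∃[ A ] ∃[ B ] ∀ n → 2 ℕ.≤ n →
                  ⌊log₂ n ⌋ ℕ.≤ A ℕ.* wordSize n × wordSize n ℕ.≤ B ℕ.* ⌊log₂ n ⌋
    registers   : ℕ
    program     : Program registers
    preprocess  : ∀ {n} → Instance c n → List (RAM.Word (wordSize n))
    addressable : ∀ {n} → 2 ℕ.≤ n → (S : Instance c n) →
                  length (preprocess S) ℕ.+ dim S ℕ.≤ 2 ℕ.^ wordSize n
    time        : ∀ n → Query c n → ℕ
    correct     : ∀ {n} → 2 ℕ.≤ n → (S : Instance c n) (v : Vec Bool (dim S)) →
                  ∃[ b ] answer (wordSize n) program (preprocess S) v (time n (S , v)) ≡ just b ×
                       (T b ⇔ Any (Orthogonal v) (vectors S))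

  space : ∀ n → Instance c n → ℕ
  space n S = length (preprocess S)

module Submission where

-- The coordinates are arranged in d cyclic orders, each starting with a window
-- of about (c - 1 - ε) log n coordinates.  By averaging, a vector with at least
-- a log n ones, a slightly above c₁ - ε, has a proportion a / c of ones in one of
-- the windows, so it is orthogonal to few of the patterns there.  For each
-- window a decision tree reads the query on the window and keeps the list of
-- vectors that are still orthogonal to it.  A list of length at most n ^ (1 - δ)
-- is scanned; counting pairs of a pattern and an orthogonal vector, only few
-- patterns have a longer list, and these can afford a complete decision tree on
-- the remaining coordinates.  The vectors with fewer ones are sublinear in number
-- because a < c₁, and are scanned as well.  The result is a branching program,
-- which a fixed RAM program interprets.

-- The exponent comes from one balance. Let a window have m coordinates and let its heavy vectors
-- have h ones there. There are at most n 2^(m-h) pairs of a pattern and an orthogonal heavy vector,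
-- so fewer than n 2^(m-h) / τ patterns keep more than τ vectors, and each of these pays 2^(d-m) for
-- its table. The window length cancels: n 2^(d-h) / τ is left. Since τ is almost n, this is about
-- n^c / 2^h with h = m a / c, so long windows are good. Their length is limited by the scanned
-- lists, whose total length is up to n 2^(m-h): the tables dominate only while τ ≤ 2^(d-m), and
-- this costs the 1 in c - 1 - ε. The obstacle is the bookkeeping of real exponents, n / τ and
-- powers of log n. Everything is therefore measured in powers of v, a power of two close to
-- n^(1/D). The two uses of ε raise both factors of m a by about Λ/D, and the product of the raises,
-- Λ² in units of 1/D², has to exceed rounding losses of order C, where C / D is close to c. As C
-- grows only linearly in Λ, a large Λ suffices.

module Fragments where
  open import Data.Bool.Base using (Bool; true; false; not; _∧_; _∨_; if_then_else_; T)
  open import Data.Bool.ListAction using (all; any)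
  open import Data.Bool.Properties using (∧-identityʳ; ∨-assoc; ∧-zeroʳ)
  open import Data.Fin.Base using (Fin)
  open import Data.List.Base using (List; []; _∷_; _++_; length; filterᵇ; take; drop)
  open import Data.List.Properties using (length-take; length-drop; length-++; take++drop≡id)
  open import Data.List.Relation.Unary.All using (All; []; _∷_)
  open import Data.Nat.Base
  open import Data.Nat.Properties
  open import Data.Nat.Tactic.RingSolver using (solve-∀)
  open import Data.Vec.Base using (Vec; lookup)
  open import Function.Base using (_∘_)
  open import Relation.Binary.PropositionalEquality hiding (J)
  open ≤-Reasoning

  -- Branching programs for the query, and their construction from the vectors

  infixr 5 _orElse_

  -- The second alternative of `orElse` will be shared by all rejecting leaves of the first, so
  -- sizes add instead of multiplying. Leaves become mere pointers, which is why `size` counts tests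
  -- only.
  data Frag (d : ℕ) : Set where
    accept reject : Frag d
    test          : (i : Fin d) (f₀ f₁ : Frag d) → Frag d
    _orElse_      : (f g : Frag d) → Frag d

  private variable
    d : ℕ
    A : Set

  eval : Frag d → Vec Bool d → Bool
  eval accept       v = true
  eval reject       v = false
  eval (test i f g) v = if lookup v i then eval g v else eval f v
  eval (f orElse g) v = eval f v ∨ eval g v

  size depth : Frag d → ℕ
  size accept       = 0
  size reject       = 0
  size (test i f g) = suc (size f + size g)
  size (f orElse g) = size f + size g
  depth accept       = 0
  depth reject       = 0
  depth (test i f g) = suc (depth f ⊔ depth g)
  depth (f orElse g) = depth f + depth g

  orth : List (Fin d) → Vec Bool d → Vec Bool d → Bool
  orth X v s = all (λ i → not (lookup s i ∧ lookup v i)) X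

  avoiding : Fin d → List (Vec Bool d) → List (Vec Bool d)
  avoiding i = filterᵇ (λ s → not (lookup s i))

  check : List (Fin d) → Vec Bool d → Frag d
  check []      s = accept
  check (i ∷ X) s = if lookup s i then test i (check X s) reject else check X s

  scan : List (Fin d) → List (Vec Bool d) → Frag d
  scan X []      = reject
  scan X (s ∷ L) = check X s orElse scan X L

  table : List (Fin d) → List (Vec Bool d) → Frag d
  table []      []      = reject
  table []      (_ ∷ _) = accept
  table (i ∷ J) L       = test i (table J L) (table J (avoiding i L))

  tree : (I J : List (Fin d)) (τ : ℕ) → List (Vec Bool d) → Frag d
  tree []      J τ L = if length L ≤ᵇ τ then scan J L else table J L
  tree (i ∷ I) J τ L = if length L ≤ᵇ τ then scan (i ∷ I ++ J) L
                       else test i (tree I J τ L) (tree I J τ (avoiding i L))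

  weight : List (Fin d) → Vec Bool d → ℕ
  weight []      s = 0
  weight (i ∷ I) s = (if lookup s i then 1 else 0) + weight I s

  module _ {d : ℕ} (τ h m : ℕ) where

    heavy : List (Fin d) → Vec Bool d → Bool
    heavy y s = h ≤ᵇ weight (take m y) s

    -- A vector is filed under the first order whose window makes it heavy. Whatever survives all
    -- the filters is light in every window; this is the list that `remainder` names and the
    -- averaging argument bounds.
    build : List (Fin d) → List (List (Fin d)) → List (Vec Bool d) → Frag d
    build X []       L = scan X L
    build X (y ∷ ys) L = tree (take m y) (drop m y) τ (filterᵇ (heavy y) L)
                         orElse build X ys (filterᵇ (not ∘ heavy y) L)

    remainder : List (List (Fin d)) → List (Vec Bool d) → List (Vec Bool d)
    remainder []       L = L
    remainder (y ∷ ys) L = remainder ys (filterᵇ (not ∘ heavy y) L)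

  -- Correctness of the fragments

  any-cong : ∀ {p q : A → Bool} → (∀ x → p x ≡ q x) → ∀ L → any p L ≡ any q L
  any-cong p≗q []      = refl
  any-cong p≗q (x ∷ L) = cong₂ _∨_ (p≗q x) (any-cong p≗q L)

  any-filterᵇ : ∀ (p q : A → Bool) L → any p (filterᵇ q L) ≡ any (λ x → q x ∧ p x) L
  any-filterᵇ p q []      = refl
  any-filterᵇ p q (x ∷ L) with q x
  ... | true  = cong (p x ∨_) (any-filterᵇ p q L)
  ... | false = any-filterᵇ p q L

  any-split : ∀ (p q : A → Bool) L →
              any p L ≡ any p (filterᵇ q L) ∨ any p (filterᵇ (not ∘ q) L)
  any-split p q []      = refl
  any-split p q (x ∷ L) with q x | any-split p q L
  ... | true  | eq = trans (cong (p x ∨_) eq) (sym (∨-assoc (p x) _ _))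
  ... | false | eq = trans (cong (p x ∨_) eq) (rearrange (p x) (any p (filterᵇ q L)) _)
    where
    rearrange : ∀ a b c → a ∨ (b ∨ c) ≡ b ∨ (a ∨ c)
    rearrange true  true  c = refl
    rearrange true  false c = refl
    rearrange false b     c = refl

  length-filterᵇ : ∀ (q : A → Bool) L → length (filterᵇ q L) ≤ length L
  length-filterᵇ q []      = z≤n
  length-filterᵇ q (x ∷ L) with q x
  ... | true  = s≤s (length-filterᵇ q L)
  ... | false = m≤n⇒m≤1+n (length-filterᵇ q L)

  eval-check : ∀ X (s v : Vec Bool d) → eval (check X s) v ≡ orth X v s
  eval-check []      s v = refl
  eval-check (i ∷ X) s v with lookup s i
  ... | false = eval-check X s v
  ... | true with lookup v i
  ...   | false = eval-check X s v
  ...   | true  = refl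

  eval-scan : ∀ X L (v : Vec Bool d) → eval (scan X L) v ≡ any (orth X v) L
  eval-scan X []      v = refl
  eval-scan X (s ∷ L) v = cong₂ _∨_ (eval-check X s v) (eval-scan X L v)

  -- A query bit 0 excludes no vector, a query bit 1 excludes exactly the vectors with a one at `i`.
  eval-branch : ∀ i J L (v : Vec Bool d) →
    (if lookup v i then any (orth J v) (avoiding i L) else any (orth J v) L)
      ≡ any (orth (i ∷ J) v) L
  eval-branch i J L v with lookup v i
  ... | false = any-cong (λ s → cong (λ b → not b ∧ orth J v s) (sym (∧-zeroʳ (lookup s i)))) L
  ... | true  = trans (any-filterᵇ (orth J v) _ L)
    (any-cong (λ s → cong (λ b → not b ∧ orth J v s) (sym (∧-identityʳ (lookup s i)))) L)

  eval-table : ∀ J L (v : Vec Bool d) → eval (table J L) v ≡ any (orth J v) L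
  eval-table []      []      v = refl
  eval-table []      (_ ∷ _) v = refl
  eval-table (i ∷ J) L       v = trans
    (cong₂ (if lookup v i then_else_) (eval-table J (avoiding i L) v) (eval-table J L v))
    (eval-branch i J L v)

  eval-tree : ∀ I J τ L (v : Vec Bool d) → eval (tree I J τ L) v ≡ any (orth (I ++ J) v) L
  eval-tree [] J τ L v with length L ≤ᵇ τ
  ... | true  = eval-scan J L v
  ... | false = eval-table J L v
  eval-tree (i ∷ I) J τ L v with length L ≤ᵇ τ
  ... | true  = eval-scan (i ∷ I ++ J) L v
  ... | false = trans
    (cong₂ (if lookup v i then_else_) (eval-tree I J τ (avoiding i L) v) (eval-tree I J τ L v))
    (eval-branch i (I ++ J) L v)

  -- The orders will be rotations of `X`; all that matters here is that orthogonality is the same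
  -- whichever order the coordinates are read in.
  eval-build : ∀ τ h m (X : List (Fin d)) {ys} v →
    All (λ y → ∀ s → orth y v s ≡ orth X v s) ys →
    ∀ L → eval (build τ h m X ys L) v ≡ any (orth X v) L
  eval-build τ h m X v [] L = eval-scan X L v
  eval-build τ h m X {y ∷ ys} v (y≈X ∷ ys≈X) L = trans
    (cong₂ _∨_
      (trans (eval-tree (take m y) (drop m y) τ _ v)
        (trans (cong (λ z → any (orth z v) (filterᵇ (heavy τ h m y) L)) (take++drop≡id m y))
          (any-cong y≈X (filterᵇ (heavy τ h m y) L))))
      (eval-build τ h m X v ys≈X _))
    (sym (any-split (orth X v) (heavy τ h m y) L))

  -- Size and depth of the fragments

  size-check : ∀ X (s : Vec Bool d) → size (check X s) ≤ length X
  size-check []      s = z≤n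
  size-check (i ∷ X) s with lookup s i
  ... | true  = s≤s (≤-trans (≤-reflexive (+-identityʳ _)) (size-check X s))
  ... | false = m≤n⇒m≤1+n (size-check X s)

  depth≤size : (f : Frag d) → depth f ≤ size f
  depth≤size accept       = z≤n
  depth≤size reject       = z≤n
  depth≤size (test i f g) =
    s≤s (≤-trans (m⊔n≤m+n (depth f) (depth g)) (+-mono-≤ (depth≤size f) (depth≤size g)))
  depth≤size (f orElse g) = +-mono-≤ (depth≤size f) (depth≤size g)

  size-scan : ∀ X (L : List (Vec Bool d)) → size (scan X L) ≤ length L * length X
  size-scan X []      = z≤n
  size-scan X (s ∷ L) = +-mono-≤ (size-check X s) (size-scan X L)

  depth-scan : ∀ X (L : List (Vec Bool d)) → depth (scan X L) ≤ length L * length X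
  depth-scan X L = ≤-trans (depth≤size (scan X L)) (size-scan X L)

  size-table : ∀ J (L : List (Vec Bool d)) → size (table J L) < 2 ^ length J
  size-table []      []      = s≤s z≤n
  size-table []      (_ ∷ _) = s≤s z≤n
  size-table (i ∷ J) L = begin
    suc (suc (size (table J L) + size (table J (avoiding i L))))
      ≡⟨ cong suc (+-suc _ _) ⟨
    suc (size (table J L)) + suc (size (table J (avoiding i L)))
      ≤⟨ +-mono-≤ (size-table J L) (size-table J (avoiding i L)) ⟩
    2 ^ length J + 2 ^ length J
      ≡⟨ cong (2 ^ length J +_) (+-identityʳ _) ⟨
    2 ^ suc (length J) ∎

  depth-table : ∀ J (L : List (Vec Bool d)) → depth (table J L) ≤ length J
  depth-table []      []      = z≤n
  depth-table []      (_ ∷ _) = z≤n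
  depth-table (i ∷ J) L = s≤s (⊔-lub (depth-table J L) (depth-table J (avoiding i L)))

  ≤ᵇ-true : ∀ m n → (m ≤ᵇ n) ≡ true → m ≤ n
  ≤ᵇ-true m n eq = ≤ᵇ⇒≤ m n (subst T (sym eq) _)

  ≤ᵇ-false : ∀ m n → (m ≤ᵇ n) ≡ false → n < m
  ≤ᵇ-false m n eq = ≰⇒> (λ m≤n → subst T eq (≤⇒≤ᵇ m≤n))

  -- A scanned list has at most `τ` vectors. The additional one in `suc τ` pays for the tests on the
  -- way down and for the depth of a table.
  depth-tree : ∀ I J τ (L : List (Vec Bool d)) →
               depth (tree I J τ L) ≤ suc τ * (length I + length J)
  depth-tree [] J τ L with length L ≤ᵇ τ in eq
  ... | true  = ≤-trans (depth-scan J L) (*-monoˡ-≤ (length J) (m≤n⇒m≤1+n (≤ᵇ-true (length L) τ eq)))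
  ... | false = ≤-trans (depth-table J L) (m≤m+n (length J) _)
  depth-tree (i ∷ I) J τ L with length L ≤ᵇ τ in eq
  ... | true  = ≤-trans (depth-scan (i ∷ I ++ J) L)
    (*-mono-≤ (m≤n⇒m≤1+n (≤ᵇ-true (length L) τ eq)) (≤-reflexive (cong suc (length-++ I {J}))))
  ... | false = ≤-trans (s≤s (⊔-lub (depth-tree I J τ L) (depth-tree I J τ (avoiding i L))))
    (≤-trans (+-monoˡ-≤ _ (s≤s (z≤n {τ}))) (≤-reflexive (sym (*-suc (suc τ) _))))

  -- The number of vectors on the coordinates I that are orthogonal to s.
  companions : List (Fin d) → Vec Bool d → ℕ
  companions []      s = 1
  companions (i ∷ I) s = if lookup s i then companions I s else 2 * companions I s

  -- The number of pairs of a pattern on `I` and a vector of `L` orthogonal to it. Equivalently, the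
  -- total length of the lists at the leaves of the complete decision tree on `I`.
  Φ : List (Fin d) → List (Vec Bool d) → ℕ
  Φ I []      = 0
  Φ I (s ∷ L) = companions I s + Φ I L

  companions>0 : ∀ I (s : Vec Bool d) → 1 ≤ companions I s
  companions>0 []      s = s≤s z≤n
  companions>0 (i ∷ I) s with lookup s i
  ... | true  = companions>0 I s
  ... | false = ≤-trans (companions>0 I s) (m≤m+n _ _)

  companions-weight : ∀ I (s : Vec Bool d) → companions I s * 2 ^ weight I s ≡ 2 ^ length I
  companions-weight []      s = refl
  companions-weight (i ∷ I) s with lookup s i
  ... | true  = trans (swap (companions I s) (2 ^ weight I s)) (cong (2 *_) (companions-weight I s))
    where
    swap : ∀ a b → a * (2 * b) ≡ 2 * (a * b)
    swap = solve-∀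
  ... | false = trans (*-assoc 2 (companions I s) _) (cong (2 *_) (companions-weight I s))

  length≤Φ : ∀ I (L : List (Vec Bool d)) → length L ≤ Φ I L
  length≤Φ I []      = z≤n
  length≤Φ I (s ∷ L) = +-mono-≤ (companions>0 I s) (length≤Φ I L)

  Φ-branch : ∀ i I (L : List (Vec Bool d)) → Φ (i ∷ I) L ≡ Φ I L + Φ I (avoiding i L)
  Φ-branch i I []      = refl
  Φ-branch i I (s ∷ L) with lookup s i | Φ-branch i I L
  ... | true  | eq = trans (cong (companions I s +_) eq) (sym (+-assoc (companions I s) _ _))
  ... | false | eq = trans (cong (2 * companions I s +_) eq)
    (swap (companions I s) (Φ I L) (Φ I (avoiding i L)))
    where
    swap : ∀ a b c → 2 * a + (b + c) ≡ a + b + (a + c)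
    swap = solve-∀

  -- Each one of a vector forces a zero in an orthogonal pattern, so a heavy vector meets at most a
  -- 2^(-h) fraction of the patterns. The inequality is multiplied out to avoid division.
  Φ-heavy : ∀ τ h m y (L : List (Vec Bool d)) →
            Φ (take m y) (filterᵇ (heavy τ h m y) L) * 2 ^ h ≤ length L * 2 ^ length (take m y)
  Φ-heavy τ h m y []      = z≤n
  Φ-heavy τ h m y (s ∷ L) with h ≤ᵇ weight (take m y) s in eq
  ... | false = ≤-trans (Φ-heavy τ h m y L) (m≤n+m _ _)
  ... | true  = begin
    (companions I s + Φ I L′) * 2 ^ h
      ≡⟨ *-distribʳ-+ (2 ^ h) (companions I s) (Φ I L′) ⟩
    companions I s * 2 ^ h + Φ I L′ * 2 ^ h
      ≤⟨ +-mono-≤ (≤-trans (*-monoʳ-≤ (companions I s) (^-monoʳ-≤ 2 (≤ᵇ-true h _ eq)))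
                           (≤-reflexive (companions-weight I s)))
                  (Φ-heavy τ h m y L) ⟩
    2 ^ length I + length L * 2 ^ length I ∎
    where
    I = take m y
    L′ = filterᵇ (heavy τ h m y) L

  -- `Φ` is additive over the two branches, so the cost can be charged to pairs. A scan costs at
  -- most `N` per pair. A table is built only when more than `τ` pairs share it, whence 2^|J| / τ
  -- per pair. A test inside the window is charged to the pairs below it, which adds one per pair
  -- and level, hence the summand `length I`. All is multiplied by `τ`.
  size-tree : ∀ I J τ N (L : List (Vec Bool d)) → length I + length J ≤ N →
    size (tree I J τ L) * τ ≤ Φ I L * (τ * (length I + N) + 2 ^ length J)
  size-tree [] J τ N L |J|≤N with length L ≤ᵇ τ in eq
  ... | true  = begin
    size (scan J L) * τ      ≤⟨ *-monoˡ-≤ τ (size-scan J L) ⟩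
    length L * length J * τ  ≤⟨ *-monoˡ-≤ τ (*-mono-≤ (length≤Φ [] L) |J|≤N) ⟩
    Φ [] L * N * τ           ≡⟨ *-assoc (Φ [] L) N τ ⟩
    Φ [] L * (N * τ)         ≡⟨ cong (Φ [] L *_) (*-comm N τ) ⟩
    Φ [] L * (τ * N)         ≤⟨ *-monoʳ-≤ (Φ [] L) (m≤m+n (τ * N) _) ⟩
    Φ [] L * (τ * N + 2 ^ length J) ∎
  ... | false = begin
    size (table J L) * τ     ≤⟨ *-mono-≤ (<⇒≤ (size-table J L)) (≤-trans (<⇒≤ (≤ᵇ-false (length L) τ eq)) (length≤Φ [] L)) ⟩
    2 ^ length J * Φ [] L    ≡⟨ *-comm (2 ^ length J) (Φ [] L) ⟩
    Φ [] L * 2 ^ length J    ≤⟨ *-monoʳ-≤ (Φ [] L) (m≤n+m (2 ^ length J) (τ * N)) ⟩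
    Φ [] L * (τ * N + 2 ^ length J) ∎
  size-tree (i ∷ I) J τ N L |I|+|J|≤N with length L ≤ᵇ τ in eq
  ... | true  = begin
    size (scan (i ∷ I ++ J) L) * τ        ≤⟨ *-monoˡ-≤ τ (size-scan (i ∷ I ++ J) L) ⟩
    length L * suc (length (I ++ J)) * τ
      ≤⟨ *-monoˡ-≤ τ (*-mono-≤ (length≤Φ (i ∷ I) L)
           (≤-trans (≤-reflexive (cong suc (length-++ I {J}))) |I|+|J|≤N)) ⟩
    P * N * τ                             ≡⟨ *-assoc P N τ ⟩
    P * (N * τ)                           ≡⟨ cong (P *_) (*-comm N τ) ⟩
    P * (τ * N)
      ≤⟨ *-monoʳ-≤ P (≤-trans (*-monoʳ-≤ τ (m≤n+m N (suc (length I)))) (m≤m+n _ _)) ⟩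
    P * (τ * (suc (length I) + N) + 2 ^ length J) ∎
    where P = Φ (i ∷ I) L
  ... | false = begin
    τ + (size t₀ + size t₁) * τ
      ≡⟨ cong (τ +_) (*-distribʳ-+ τ (size t₀) (size t₁)) ⟩
    τ + (size t₀ * τ + size t₁ * τ)
      ≤⟨ +-mono-≤ (m≤n*m τ P {{>-nonZero (≤-trans (≤-trans (s≤s z≤n) (≤ᵇ-false (length L) τ eq)) (length≤Φ (i ∷ I) L))}})
           (+-mono-≤ (size-tree I J τ N L |I|+|J|≤N′) (size-tree I J τ N (avoiding i L) |I|+|J|≤N′)) ⟩
    P * τ + (Φ I L * W + Φ I (avoiding i L) * W)
      ≡⟨ cong (P * τ +_) (*-distribʳ-+ W (Φ I L) (Φ I (avoiding i L))) ⟨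
    P * τ + (Φ I L + Φ I (avoiding i L)) * W
      ≡⟨ cong (λ z → P * τ + z * W) (Φ-branch i I L) ⟨
    P * τ + P * W
      ≡⟨ regroup P τ (length I) N (2 ^ length J) ⟩
    P * (τ * (suc (length I) + N) + 2 ^ length J) ∎
    where
    P = Φ (i ∷ I) L
    W = τ * (length I + N) + 2 ^ length J
    t₀ = tree I J τ L
    t₁ = tree I J τ (avoiding i L)
    |I|+|J|≤N′ = ≤-trans (n≤1+n _) |I|+|J|≤N
    regroup : ∀ P t l N j → P * t + P * (t * (l + N) + j) ≡ P * (t * (suc l + N) + j)
    regroup = solve-∀

  length-window : ∀ m (y : List A) → m ≤ length y → length (take m y) ≡ m
  length-window m y m≤ = trans (length-take m y) (m≤n⇒m⊓n≡m m≤)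

  size-build : ∀ τ h m {N} (X : List (Fin d)) {ys} → m ≤ N → length X ≡ N →
    All (λ y → length y ≡ N) ys → ∀ L →
    size (build τ h m X ys L) * (τ * 2 ^ h) ≤
    length L * (length ys * (2 ^ m * (τ * (N + N) + 2 ^ (N ∸ m))) + N * (τ * 2 ^ h))
  size-build τ h m {N} X m≤N |X| [] L = begin
    size (scan X L) * (τ * 2 ^ h)        ≤⟨ *-monoˡ-≤ (τ * 2 ^ h) (size-scan X L) ⟩
    length L * length X * (τ * 2 ^ h)    ≡⟨ cong (λ z → length L * z * (τ * 2 ^ h)) |X| ⟩
    length L * N * (τ * 2 ^ h)           ≡⟨ *-assoc (length L) N _ ⟩
    length L * (N * (τ * 2 ^ h))         ∎
  size-build τ h m {N} X {y ∷ ys} m≤N |X| (|y| ∷ |ys|) L = begin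
    (size t + size b) * E                ≡⟨ *-distribʳ-+ E (size t) (size b) ⟩
    size t * E + size b * E              ≤⟨ +-mono-≤ tree-part build-part ⟩
    l * G + l * (length ys * G + N * E)  ≡⟨ regroup l G (length ys) (N * E) ⟩
    l * (suc (length ys) * G + N * E)    ∎
    where
    E = τ * 2 ^ h
    G = 2 ^ m * (τ * (N + N) + 2 ^ (N ∸ m))
    l = length L
    I = take m y
    J = drop m y
    L₁ = filterᵇ (heavy τ h m y) L
    L₂ = filterᵇ (not ∘ heavy τ h m y) L
    t = tree I J τ L₁
    b = build τ h m X ys L₂
    |I| : length I ≡ m
    |I| = length-window m y (subst (m ≤_) (sym |y|) m≤N)
    |J| : length J ≡ N ∸ m
    |J| = trans (length-drop m y) (cong (_∸ m) |y|)
    regroup : ∀ l G k e → l * G + l * (k * G + e) ≡ l * (suc k * G + e)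
    regroup = solve-∀
    swap₁ : ∀ s t e → s * (t * e) ≡ s * t * e
    swap₁ = solve-∀
    swap₂ : ∀ p w e → p * w * e ≡ p * e * w
    swap₂ = solve-∀
    build-part : size b * E ≤ l * (length ys * G + N * E)
    build-part = ≤-trans (size-build τ h m X m≤N |X| |ys| L₂)
      (*-monoˡ-≤ (length ys * G + N * E) (length-filterᵇ (not ∘ heavy τ h m y) L))
    tree-part : size t * E ≤ l * G
    tree-part = begin
      size t * (τ * 2 ^ h)   ≡⟨ swap₁ (size t) τ (2 ^ h) ⟩
      size t * τ * 2 ^ h
        ≤⟨ *-monoˡ-≤ (2 ^ h) (size-tree I J τ N L₁
             (≤-reflexive (trans (cong₂ _+_ |I| |J|) (m+[n∸m]≡n m≤N)))) ⟩
      Φ I L₁ * (τ * (length I + N) + 2 ^ length J) * 2 ^ h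
        ≡⟨ swap₂ (Φ I L₁) _ (2 ^ h) ⟩
      Φ I L₁ * 2 ^ h * (τ * (length I + N) + 2 ^ length J)
        ≤⟨ *-monoˡ-≤ _ (Φ-heavy τ h m y L) ⟩
      l * 2 ^ length I * (τ * (length I + N) + 2 ^ length J)
        ≡⟨ cong₂ (λ a b → l * 2 ^ a * (τ * (a + N) + 2 ^ b)) |I| |J| ⟩
      l * 2 ^ m * (τ * (m + N) + 2 ^ (N ∸ m))
        ≤⟨ *-monoʳ-≤ (l * 2 ^ m) (+-monoˡ-≤ _ (*-monoʳ-≤ τ (+-monoˡ-≤ N m≤N))) ⟩
      l * 2 ^ m * (τ * (N + N) + 2 ^ (N ∸ m))
        ≡⟨ *-assoc l (2 ^ m) _ ⟩
      l * G ∎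

  depth-build : ∀ τ h m {N} (X : List (Fin d)) {ys} → m ≤ N → length X ≡ N →
    All (λ y → length y ≡ N) ys → ∀ L →
    depth (build τ h m X ys L) ≤ length ys * (suc τ * N) + length (remainder τ h m ys L) * N
  depth-build τ h m {N} X m≤N |X| [] L =
    ≤-trans (depth-scan X L) (≤-reflexive (cong (length L *_) |X|))
  depth-build τ h m {N} X {y ∷ ys} m≤N |X| (|y| ∷ |ys|) L = begin
    depth (tree (take m y) (drop m y) τ (filterᵇ (heavy τ h m y) L)) + depth (build τ h m X ys L₂)
      ≤⟨ +-mono-≤ (depth-tree (take m y) (drop m y) τ _) (depth-build τ h m X m≤N |X| |ys| L₂) ⟩
    suc τ * (length (take m y) + length (drop m y)) + (length ys * (suc τ * N) + r)
      ≡⟨ cong (λ z → suc τ * z + (length ys * (suc τ * N) + r)) |y|′ ⟩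
    suc τ * N + (length ys * (suc τ * N) + r)
      ≡⟨ +-assoc (suc τ * N) _ r ⟨
    suc τ * N + length ys * (suc τ * N) + r ∎
    where
    L₂ = filterᵇ (not ∘ heavy τ h m y) L
    r = length (remainder τ h m ys L₂) * N
    |y|′ : length (take m y) + length (drop m y) ≡ N
    |y|′ = trans (sym (length-++ (take m y))) (trans (cong length (take++drop≡id m y)) |y|)

-- Averaging over cyclic windows

module Windows where
  open import Data.Bool.Base using (Bool; true; false; not; _∧_; if_then_else_)
  open import Data.Bool.ListAction using (all)
  open import Data.Bool.Properties using (∧-assoc; ∧-comm; ∧-identityʳ; T?)
  open import Data.Fin.Base using (Fin; zero; suc)
  open import Data.List.Base using (List; []; _∷_; _++_; length; filterᵇ; take; allFin; tabulate; _∷ʳ_)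
  open import Data.List.Properties using (length-++; ++-assoc; ++-identityʳ)
  open import Data.List.Relation.Unary.All as All using (All; []; _∷_)
  import Data.List.Relation.Unary.All.Properties as Allₚ
  open import Data.List.Relation.Unary.AllPairs using ([]; _∷_)
  open import Data.List.Relation.Unary.Unique.Propositional using (Unique)
  import Data.List.Relation.Unary.Unique.Propositional.Properties as Uniqueₚ
  open import Data.Nat.Base
  open import Data.Nat.Combinatorics using (_C_; nCk+nC[k+1]≡[n+1]C[k+1])
  open import Data.Nat.Properties
  open import Data.Nat.Tactic.RingSolver using (solve-∀)
  open import Data.Product.Base using (_,_)
  open import Data.Sum.Base using (inj₁; inj₂)
  open import Data.Vec.Base using (Vec; []; _∷_; lookup)
  open import Function.Base using (_∘_; id)
  open import Relation.Binary.PropositionalEquality hiding (J)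
  open import Relation.Nullary.Negation using (contradiction)
  open Fragments
  open ≤-Reasoning

  private variable
    d : ℕ
    A : Set

  rotate : List A → List A
  rotate []       = []
  rotate (x ∷ xs) = xs ∷ʳ x

  rotations : ℕ → List A → List (List A)
  rotations zero    xs = []
  rotations (suc k) xs = xs ∷ rotations k (rotate xs)

  length-rotate : (xs : List A) → length (rotate xs) ≡ length xs
  length-rotate []       = refl
  length-rotate (x ∷ xs) = trans (length-++ xs) (+-comm (length xs) 1)

  length-rotations : ∀ k (xs : List A) → length (rotations k xs) ≡ k
  length-rotations zero    xs = refl
  length-rotations (suc k) xs = cong suc (length-rotations k (rotate xs))

  all-rotations : ∀ {P : List A → Set} → (∀ {xs} → P xs → P (rotate xs)) →
                  ∀ k {xs} → P xs → All P (rotations k xs)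
  all-rotations step zero    p = []
  all-rotations step (suc k) p = p ∷ all-rotations step k (step p)

  all-∷ʳ : ∀ (p : A → Bool) xs x → all p (xs ∷ʳ x) ≡ all p xs ∧ p x
  all-∷ʳ p []       x = ∧-identityʳ (p x)
  all-∷ʳ p (y ∷ xs) x = trans (cong (p y ∧_) (all-∷ʳ p xs x)) (sym (∧-assoc (p y) _ _))

  all-rotate : ∀ (p : A → Bool) xs → all p (rotate xs) ≡ all p xs
  all-rotate p []       = refl
  all-rotate p (x ∷ xs) = trans (all-∷ʳ p xs x) (∧-comm (all p xs) (p x))

  take-∷ʳ : ∀ m (xs : List A) x → m ≤ length xs → take m (xs ∷ʳ x) ≡ take m xs
  take-∷ʳ zero    xs       x _         = refl
  take-∷ʳ (suc m) (y ∷ xs) x (s≤s m≤)  = cong (y ∷_) (take-∷ʳ m xs x m≤)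

  total : (A → ℕ) → List A → ℕ
  total f []       = 0
  total f (x ∷ xs) = f x + total f xs

  total≤ : ∀ (f : A → ℕ) {b xs} → All (λ x → f x ≤ b) xs → total f xs ≤ length xs * b
  total≤ f []         = z≤n
  total≤ f (p ∷ ps) = +-mono-≤ p (total≤ f ps)

  iterate : ℕ → List A → List A
  iterate zero    xs = xs
  iterate (suc k) xs = iterate k (rotate xs)

  iterate-++ : ∀ (xs ys : List A) → iterate (length xs) (xs ++ ys) ≡ ys ++ xs
  iterate-++ []       ys = sym (++-identityʳ ys)
  iterate-++ (x ∷ xs) ys = trans (cong (iterate (length xs)) (++-assoc xs ys (x ∷ [])))
    (trans (iterate-++ xs (ys ∷ʳ x)) (++-assoc ys (x ∷ []) xs))

  -- Both sides sum over the same `k` + 1 consecutive rotations; one splits off the first of them,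
  -- the other the last.
  total-rotations-suc : ∀ (f : List A → ℕ) k xs →
    f xs + total f (rotations k (rotate xs)) ≡ total f (rotations k xs) + f (iterate k xs)
  total-rotations-suc f zero    xs = +-comm (f xs) 0
  total-rotations-suc f (suc k) xs =
    trans (cong (f xs +_) (total-rotations-suc f k (rotate xs))) (sym (+-assoc (f xs) _ _))

  total-rotations-rotate : ∀ (f : List A → ℕ) xs →
    total f (rotations (length xs) (rotate xs)) ≡ total f (rotations (length xs) xs)
  total-rotations-rotate f xs = +-cancelˡ-≡ (f xs) _ _ (trans
    (total-rotations-suc f (length xs) xs)
    (trans (cong (λ z → total f (rotations (length xs) xs) + f z) full-turn) (+-comm _ (f xs))))
    where
    full-turn : iterate (length xs) xs ≡ xs
    full-turn = trans (cong (iterate (length xs)) (sym (++-identityʳ xs))) (iterate-++ xs [])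

  -- The suffix `ys` collects the heads already counted: a rotation moves them to the far end, where
  -- they are not met again.
  total-heads : ∀ (s : Vec Bool d) xs ys →
    total (λ y → weight (take 1 y) s) (rotations (length xs) (xs ++ ys)) ≡ weight xs s
  total-heads s []       ys = refl
  total-heads s (x ∷ xs) ys = cong₂ _+_ (+-identityʳ (if lookup s x then 1 else 0))
    (trans (cong (total (λ y → weight (take 1 y) s) ∘ rotations (length xs)) (++-assoc xs ys (x ∷ [])))
      (total-heads s xs (ys ∷ʳ x)))

  weight-take-suc : ∀ (s : Vec Bool d) m xs → m < length xs →
    weight (take (suc m) xs) s ≡ weight (take 1 xs) s + weight (take m (rotate xs)) s
  weight-take-suc s m (x ∷ xs) (s≤s m≤) = cong₂ _+_
    (sym (+-identityʳ (if lookup s x then 1 else 0)))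
    (cong (λ z → weight z s) (sym (take-∷ʳ m xs x m≤)))

  total-take-suc : ∀ (s : Vec Bool d) m k xs → m < length xs →
    total (λ y → weight (take (suc m) y) s) (rotations k xs) ≡
    total (λ y → weight (take 1 y) s) (rotations k xs) +
    total (λ y → weight (take m y) s) (rotations k (rotate xs))
  total-take-suc s m zero    xs m<   = refl
  total-take-suc s m (suc k) xs m<   = trans
    (cong₂ _+_ (weight-take-suc s m xs m<)
      (total-take-suc s m k (rotate xs) (subst (m <_) (sym (length-rotate xs)) m<)))
    (swap (weight (take 1 xs) s) _ _ _)
    where
    swap : ∀ a b c e → (a + b) + (c + e) ≡ (a + c) + (b + e)
    swap = solve-∀

  -- Double counting: each position lies in exactly `m` cyclic windows. In the induction a window is
  -- its head followed by the window, one shorter, of the next rotation; the sum over all rotations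
  -- does not notice the shift.
  total-windows : ∀ (s : Vec Bool d) m xs → m ≤ length xs →
    total (λ y → weight (take m y) s) (rotations (length xs) xs) ≡ m * weight xs s
  total-windows s zero    xs _  = zeros (rotations (length xs) xs)
    where
    zeros : ∀ ys → total (λ (y : List (Fin _)) → weight (take 0 y) s) ys ≡ 0
    zeros []       = refl
    zeros (y ∷ ys) = zeros ys
  total-windows s (suc m) xs m< = trans (total-take-suc s m (length xs) xs m<)
    (cong₂ _+_
      (trans (cong (total (λ y → weight (take 1 y) s) ∘ rotations (length xs)) (sym (++-identityʳ xs)))
        (total-heads s xs []))
      (trans (total-rotations-rotate (λ y → weight (take m y) s) xs)
        (total-windows s m xs (<⇒≤ m<))))

  -- Used as the contrapositive of the averaging principle: if no window reaches `h` ones, then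
  -- neither does the average window, which holds m / d of all ones.
  light-weight : ∀ (s : Vec Bool d) m h xs → m ≤ length xs →
    All (λ y → weight (take m y) s < h) (rotations (length xs) xs) →
    m * weight xs s ≤ length xs * h
  light-weight s m h xs m≤ light = begin
    m * weight xs s
      ≡⟨ total-windows s m xs m≤ ⟨
    total (λ y → weight (take m y) s) (rotations (length xs) xs)
      ≤⟨ total≤ (λ y → weight (take m y) s) (All.map <⇒≤ light) ⟩
    length (rotations (length xs) xs) * h
      ≡⟨ cong (_* h) (length-rotations (length xs) xs) ⟩
    length xs * h ∎

  remainder-preserves : ∀ τ h m {P : List (Vec Bool d) → Set} →
    (∀ p {L} → P L → P (filterᵇ p L)) → ∀ ys {L} → P L → P (remainder τ h m ys L)
  remainder-preserves τ h m step []       p = p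
  remainder-preserves τ h m step (y ∷ ys) p =
    remainder-preserves τ h m step ys (step (not ∘ heavy τ h m y) p)

  filterᵇ-light : ∀ τ h m y (L : List (Vec Bool d)) →
    All (λ s → weight (take m y) s < h) (filterᵇ (not ∘ heavy τ h m y) L)
  filterᵇ-light τ h m y [] = []
  filterᵇ-light τ h m y (s ∷ L) with h ≤ᵇ weight (take m y) s in eq
  ... | true  = filterᵇ-light τ h m y L
  ... | false = ≤ᵇ-false h _ eq ∷ filterᵇ-light τ h m y L

  remainder-light : ∀ τ h m ys (L : List (Vec Bool d)) →
    All (λ s → All (λ y → weight (take m y) s < h) ys) (remainder τ h m ys L)
  remainder-light τ h m []       L = All.universal (λ _ → []) L
  remainder-light τ h m (y ∷ ys) L = All.zipWith (λ (p , ps) → p ∷ ps)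
    ( remainder-preserves τ h m {P = All (λ s → weight (take m y) s < h)} (λ p → Allₚ.filter⁺ (T? ∘ p)) ys
        {L = filterᵇ (not ∘ heavy τ h m y) L} (filterᵇ-light τ h m y L)
    , remainder-light τ h m ys _)

  remainder-unique : ∀ τ h m ys {L : List (Vec Bool d)} → Unique L → Unique (remainder τ h m ys L)
  remainder-unique τ h m ys = remainder-preserves τ h m {P = Unique} (λ p → Uniqueₚ.filter⁺ (T? ∘ p)) ys

  -- Counting vectors with few ones

  ones : Vec Bool d → ℕ
  ones []      = 0
  ones (b ∷ s) = (if b then 1 else 0) + ones s

  weight-allFin : (s : Vec Bool d) → weight (allFin d) s ≡ ones s
  weight-allFin s = weight-tabulate s s id (λ _ → refl)
    where
    weight-tabulate : ∀ {d e} (s : Vec Bool d) (r : Vec Bool e) (f : Fin d → Fin e) →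
      (∀ i → lookup r (f i) ≡ lookup s i) → weight (tabulate f) r ≡ ones s
    weight-tabulate []      r f eq = refl
    weight-tabulate (b ∷ s) r f eq =
      cong₂ _+_ (cong (if_then 1 else 0) (eq zero)) (weight-tabulate s r (f ∘ suc) (eq ∘ suc))

  -- ball d k counts the vectors of length d with at most k ones.
  ball : ℕ → ℕ → ℕ
  ball zero    k       = 1
  ball (suc d) zero    = ball d zero
  ball (suc d) (suc k) = ball d (suc k) + ball d k

  tails : Bool → List (Vec Bool (suc d)) → List (Vec Bool d)
  tails b     []                = []
  tails false ((false ∷ s) ∷ L) = s ∷ tails false L
  tails false ((true  ∷ s) ∷ L) = tails false L
  tails true  ((false ∷ s) ∷ L) = tails true L
  tails true  ((true  ∷ s) ∷ L) = s ∷ tails true L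

  length-tails : (L : List (Vec Bool (suc d))) → length L ≡ length (tails false L) + length (tails true L)
  length-tails []                = refl
  length-tails ((false ∷ s) ∷ L) = cong suc (length-tails L)
  length-tails ((true  ∷ s) ∷ L) = trans (cong suc (length-tails L)) (sym (+-suc _ _))

  tails-all : ∀ {P : Vec Bool (suc d) → Set} b {L} → All P L → All (λ s → P (b ∷ s)) (tails b L)
  tails-all false []                      = []
  tails-all true  []                      = []
  tails-all false {(false ∷ s) ∷ L} (p ∷ ps) = p ∷ tails-all false ps
  tails-all false {(true  ∷ s) ∷ L} (p ∷ ps) = tails-all false ps
  tails-all true  {(false ∷ s) ∷ L} (p ∷ ps) = tails-all true ps
  tails-all true  {(true  ∷ s) ∷ L} (p ∷ ps) = p ∷ tails-all true ps

  tails-unique : ∀ b {L : List (Vec Bool (suc d))} → Unique L → Unique (tails b L)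
  tails-unique false []                      = []
  tails-unique true  []                      = []
  tails-unique false {(false ∷ s) ∷ L} (p ∷ ps) = All.map (_∘ cong (false ∷_)) (tails-all false p) ∷ tails-unique false ps
  tails-unique false {(true  ∷ s) ∷ L} (p ∷ ps) = tails-unique false ps
  tails-unique true  {(false ∷ s) ∷ L} (p ∷ ps) = tails-unique true ps
  tails-unique true  {(true  ∷ s) ∷ L} (p ∷ ps) = All.map (_∘ cong (true ∷_)) (tails-all true p) ∷ tails-unique true ps

  -- The list is split by the first coordinate; `tails` keeps both distinctness and the bound on the
  -- ones, and reduces the latter by one after a leading one.
  length≤ball : ∀ {d} k {L : List (Vec Bool d)} → Unique L → All (λ s → ones s ≤ k) L →
                length L ≤ ball d k
  length≤ball {zero} k {[]}              u         p = z≤n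
  length≤ball {zero} k {[] ∷ []}         u         p = s≤s z≤n
  length≤ball {zero} k {[] ∷ [] ∷ L} ((q ∷ _) ∷ _) p = contradiction refl q
  length≤ball {suc d} zero {L} u p with tails true L | tails-all true p | length-tails L
  -- With no ones allowed, no vector can begin with a one, so the second part of the split is empty.
  ... | [] | [] | eq = begin
    length L                      ≡⟨ trans eq (+-identityʳ _) ⟩
    length (tails false L)        ≤⟨ length≤ball zero (tails-unique false u) (tails-all false p) ⟩
    ball d zero                   ∎
  length≤ball {suc d} (suc k) {L} u p = begin
    length L                                         ≡⟨ length-tails L ⟩
    length (tails false L) + length (tails true L)
      ≤⟨ +-mono-≤ (length≤ball (suc k) (tails-unique false u) (tails-all false p))
                  (length≤ball k (tails-unique true u) (All.map ≤-pred (tails-all true p))) ⟩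
    ball d (suc k) + ball d k                        ∎

  C≥1 : ∀ d k → k ≤ d → 1 ≤ d C k
  C≥1 d       zero    _         = ≤-refl
  C≥1 (suc d) (suc k) (s≤s k≤d) =
    ≤-trans (C≥1 d k k≤d) (≤-trans (m≤m+n _ _) (≤-reflexive (nCk+nC[k+1]≡[n+1]C[k+1] d k)))

  -- Pascal's rule is applied to both sides and the summands are compared crosswise.
  C-mono : ∀ d j k → j ≤ k → j + k ≤ d → d C j ≤ d C k
  C-mono d       zero    k       _         k≤d = C≥1 d k k≤d
  C-mono (suc d) (suc j) (suc k) (s≤s j≤k) (s≤s j+k<d) with m≤n⇒m<n∨m≡n j≤k
  ... | inj₂ refl = ≤-refl
  ... | inj₁ j<k  = begin
    suc d C suc j          ≡⟨ nCk+nC[k+1]≡[n+1]C[k+1] d j ⟨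
    d C j + d C suc j      ≡⟨ +-comm (d C j) _ ⟩
    d C suc j + d C j
      ≤⟨ +-mono-≤ (C-mono d (suc j) k j<k (≤-trans (≤-reflexive (sym (+-suc j k))) j+k<d))
                  (C-mono d j (suc k) (m≤n⇒m≤1+n j≤k) j+k<d) ⟩
    d C k + d C suc k      ≡⟨ nCk+nC[k+1]≡[n+1]C[k+1] d k ⟩
    suc d C suc k          ∎

  sumC : ℕ → ℕ → ℕ
  sumC d zero    = 1
  sumC d (suc k) = sumC d k + d C suc k

  sumC-pascal : ∀ d k → sumC (suc d) (suc k) ≡ sumC d (suc k) + sumC d k
  sumC-pascal d zero    = trans (cong (1 +_) (sym (nCk+nC[k+1]≡[n+1]C[k+1] d 0))) (+-comm 1 _)
  sumC-pascal d (suc k) = trans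
    (cong₂ _+_ (sumC-pascal d k) (sym (nCk+nC[k+1]≡[n+1]C[k+1] d (suc k))))
    (swap (sumC d (suc k)) (sumC d k) _ _)
    where
    swap : ∀ a b c e → (a + b) + (c + e) ≡ (a + e) + (b + c)
    swap = solve-∀

  ball≤sumC : ∀ d k → ball d k ≤ sumC d k
  ball≤sumC zero    zero    = ≤-refl
  ball≤sumC zero    (suc k) = ≤-trans (ball≤sumC zero k) (m≤m+n _ _)
  ball≤sumC (suc d) zero    = ball≤sumC d zero
  ball≤sumC (suc d) (suc k) =
    ≤-trans (+-mono-≤ (ball≤sumC d (suc k)) (ball≤sumC d k)) (≤-reflexive (sym (sumC-pascal d k)))

  -- Each of the k + 1 layers is compared with the layer `k′`, which may lie beyond the middle as
  -- long as it is no farther out than the mirror image of `k`. This matters because `a` can equal c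
  -- / 2 and its rounding can overshoot d / 2.
  ball≤C : ∀ d k k′ → k ≤ k′ → k + k′ ≤ d → ball d k ≤ suc k * (d C k′)
  ball≤C d k k′ k≤k′ k+k′≤d = ≤-trans (ball≤sumC d k) (bound k k≤k′ k+k′≤d)
    where
    bound : ∀ k → k ≤ k′ → k + k′ ≤ d → sumC d k ≤ suc k * (d C k′)
    bound zero    p q = ≤-trans (C-mono d 0 k′ z≤n q) (m≤m+n _ 0)
    bound (suc k) p q = ≤-trans
      (+-mono-≤ (bound k (<⇒≤ p) (<⇒≤ q)) (C-mono d (suc k) k′ p q)) (≤-reflexive (+-comm _ (d C k′)))

-- Compiling branching programs to the word RAM

module Machine where
  open import Data.Bool.Base using (Bool; true; false; _∨_; if_then_else_)
  open import Data.Bool.Properties using (∨-assoc; ∨-identityʳ)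
  open import Data.Fin.Base using (zero; suc; toℕ)
  open import Data.Fin.Properties using (toℕ-fromℕ<; toℕ<n)
  open import Data.List.Base using (List; []; _∷_; _++_; length; map)
  open import Data.List.Properties using (length-++; length-map)
  open import Data.List.Relation.Unary.All using (All; []; _∷_)
  import Data.List.Relation.Unary.All.Properties as Allₚ
  open import Data.Maybe.Base using (just)
  open import Data.Nat.Base
  open import Data.Nat.DivMod using (m<n⇒m%n≡m)
  open import Data.Nat.Properties
  open import Data.Nat.Tactic.RingSolver using (solve-∀)
  open import Data.Product.Base using (_×_; _,_; proj₁; proj₂)
  open import Data.Unit.Base using (⊤; tt)
  open import Data.Vec.Base as Vec using (Vec; lookup)
  open import Data.Vec.Functional using (Vector)
  open import Relation.Binary.PropositionalEquality
  open import Defs using (set; op; load; jump; jumpZero; halt; add; eq; Program; module RAM; encode; answer)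
  open Fragments

  private variable
    d : ℕ

  -- Register 0 is the current pointer, register 1 the constant 1, register 2 scratch. All registers
  -- start at zero, so the first `load` fetches the root pointer from cell 0. The loop is at 2 to
  -- 11; a pass through a node executes nine instructions. Nothing is ever stored.
  program : Program 3
  program =
    load zero zero ∷
    set (suc zero) 1 ∷
    jumpZero zero 12 ∷
    op eq (suc (suc zero)) zero (suc zero) ∷
    jumpZero (suc (suc zero)) 6 ∷
    halt true ∷
    load (suc (suc zero)) zero ∷
    load (suc (suc zero)) (suc (suc zero)) ∷
    op add zero zero (suc zero) ∷
    op add zero zero (suc (suc zero)) ∷
    load zero zero ∷
    jump 2 ∷
    halt false ∷ []

  -- A node occupies three cells: the address of the coordinate it reads and
  -- the two successors.  The pointers 0 and 1 stand for rejection and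
  -- acceptance; f is the pointer to follow when the fragment rejects.
  entry : Frag d → (f b : ℕ) → ℕ
  entry accept         f b = 1
  entry reject         f b = f
  entry (test i t₀ t₁) f b = b + 3 * (size t₀ + size t₁)
  entry (t orElse u)   f b = entry t (entry u f b) (b + 3 * size u)

  -- A test is placed behind its two subtrees. The second alternative of a disjunction is placed
  -- first and emitted once: its entry becomes the failure pointer throughout the first alternative.
  nodes : (off : ℕ) → Frag d → (f b : ℕ) → List ℕ
  nodes off accept         f b = []
  nodes off reject         f b = []
  nodes off (test i t₀ t₁) f b =
    nodes off t₀ f b ++ nodes off t₁ f (b + 3 * size t₀) ++
    off + toℕ i ∷ entry t₀ f b ∷ entry t₁ f (b + 3 * size t₀) ∷ []
  nodes off (t orElse u)   f b =
    nodes off u f b ++ nodes off t (entry u f b) (b + 3 * size u)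

  length-nodes : ∀ off (t : Frag d) f b → length (nodes off t f b) ≡ 3 * size t
  length-nodes off accept         f b = refl
  length-nodes off reject         f b = refl
  length-nodes off (test i t₀ t₁) f b = begin
    length (nodes off t₀ f b ++ nodes off t₁ f b′ ++ _)
      ≡⟨ length-++ (nodes off t₀ f b) ⟩
    length (nodes off t₀ f b) + length (nodes off t₁ f b′ ++ _)
      ≡⟨ cong (length (nodes off t₀ f b) +_) (length-++ (nodes off t₁ f b′)) ⟩
    length (nodes off t₀ f b) + (length (nodes off t₁ f b′) + 3)
      ≡⟨ cong₂ (λ x y → x + (y + 3)) (length-nodes off t₀ f b) (length-nodes off t₁ f b′) ⟩
    3 * size t₀ + (3 * size t₁ + 3)
      ≡⟨ regroup (size t₀) (size t₁) ⟩
    3 * suc (size t₀ + size t₁) ∎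
    where
    open ≡-Reasoning
    b′ = b + 3 * size t₀
    regroup : ∀ x y → 3 * x + (3 * y + 3) ≡ 3 * suc (x + y)
    regroup = solve-∀
  length-nodes off (t orElse u) f b = trans (length-++ (nodes off u f b)) (trans
    (cong₂ _+_ (length-nodes off u f b) (length-nodes off t _ _))
    (trans (+-comm (3 * size u) _) (sym (*-distribˡ-+ 3 (size t) (size u)))))

  split-test : ∀ b x y → b + 3 * x + 3 * y ≤ b + 3 * suc (x + y)
  split-test b x y = ≤-trans (≤-reflexive (regroup b x y)) (+-monoʳ-≤ b (*-monoʳ-≤ 3 (n≤1+n (x + y))))
    where
    regroup : ∀ b x y → b + 3 * x + 3 * y ≡ b + 3 * (x + y)
    regroup = solve-∀

  split-orElse : ∀ b x y → b + 3 * y + 3 * x ≡ b + 3 * (x + y)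
  split-orElse = solve-∀

  entry< : ∀ (t : Frag d) f b {W} → f < W → 1 < W → b + 3 * size t ≤ W → entry t f b < W
  entry< accept         f b f<W 1<W b≤W = 1<W
  entry< reject         f b f<W 1<W b≤W = f<W
  entry< (test i t₀ t₁) f b f<W 1<W b≤W =
    <-≤-trans (+-monoʳ-< b (*-monoʳ-< 3 (n<1+n (size t₀ + size t₁)))) b≤W
  entry< (t orElse u)   f b f<W 1<W b≤W =
    entry< t _ (b + 3 * size u)
      (entry< u f b f<W 1<W (≤-trans (m≤m+n _ (3 * size t)) b≤W′)) 1<W b≤W′
    where b≤W′ = ≤-trans (≤-reflexive (split-orElse b (size t) (size u))) b≤W

  -- Words are residues modulo 2^w, so a cell is read back correctly only if its value lies below
  -- 2^w.
  nodes< : ∀ {off} (t : Frag d) f b {W} → off + d ≤ W → f < W → 1 < W → b + 3 * size t ≤ W →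
           All (_< W) (nodes off t f b)
  nodes< accept         f b off≤W f<W 1<W b≤W = []
  nodes< reject         f b off≤W f<W 1<W b≤W = []
  nodes< {off = off} (test i t₀ t₁) f b off≤W f<W 1<W b≤W =
    Allₚ.++⁺ (nodes< t₀ f b off≤W f<W 1<W b≤₀)
      (Allₚ.++⁺ (nodes< t₁ f _ off≤W f<W 1<W b≤₁)
        (<-≤-trans (+-monoʳ-< off (toℕ<n i)) off≤W ∷
         entry< t₀ f b f<W 1<W b≤₀ ∷ entry< t₁ f _ f<W 1<W b≤₁ ∷ []))
    where
    b≤₁ = ≤-trans (split-test b (size t₀) (size t₁)) b≤W
    b≤₀ = ≤-trans (m≤m+n _ (3 * size t₁)) b≤₁
  nodes< (t orElse u)   f b off≤W f<W 1<W b≤W =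
    Allₚ.++⁺ (nodes< u f b off≤W f<W 1<W b≤u)
      (nodes< t _ _ off≤W (entry< u f b f<W 1<W b≤u) 1<W b≤t)
    where
    b≤t = ≤-trans (≤-reflexive (split-orElse b (size t) (size u))) b≤W
    b≤u = ≤-trans (m≤m+n _ (3 * size t)) b≤t

  Holds : (ℕ → ℕ) → ℕ → List ℕ → Set
  Holds mem b []       = ⊤
  Holds mem b (x ∷ xs) = mem b ≡ x × Holds mem (suc b) xs

  Holds-++ : ∀ mem b xs {ys} → Holds mem b (xs ++ ys) →
             Holds mem b xs × Holds mem (b + length xs) ys
  Holds-++ mem b []       {ys} h = tt , subst (λ z → Holds mem z ys) (sym (+-identityʳ b)) h
  Holds-++ mem b (x ∷ xs) {ys} (p , h) with Holds-++ mem (suc b) xs h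
  ... | h₁ , h₂ = (p , h₁) , subst (λ z → Holds mem z ys) (sym (+-suc b (length xs))) h₂

  Holds-suc : ∀ mem b xs → Holds (λ a → mem (suc a)) b xs → Holds mem (suc b) xs
  Holds-suc mem b []       h       = tt
  Holds-suc mem b (x ∷ xs) (p , h) = p , Holds-suc mem (suc b) xs h

  bit : Bool → ℕ
  bit b = if b then 1 else 0

  module _ (w : ℕ) where
    open RAM w

    toℕ-wrap : ∀ {x} → x < 2 ^ w → toℕ (wrap x) ≡ x
    toℕ-wrap x< = trans (toℕ-fromℕ< _) (m<n⇒m%n≡m {{m^n≢0 2 w}} x<)

    contents-++ : ∀ xs ys a → contents (xs ++ ys) (length xs + a) ≡ contents ys a
    contents-++ []       ys a = refl
    contents-++ (x ∷ xs) ys a = contents-++ xs ys a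

    contents-toList : ∀ {A : Set} (f : A → Word) {n} (v : Vec A n) i →
      contents (Vec.toList (Vec.map f v)) (toℕ i) ≡ f (lookup v i)
    contents-toList f (x Vec.∷ v) zero    = refl
    contents-toList f (x Vec.∷ v) (suc i) = contents-toList f v i

    Holds-contents : ∀ ns {ys} → All (_< 2 ^ w) ns →
      Holds (λ a → toℕ (contents (map wrap ns ++ ys) a)) 0 ns
    Holds-contents []       []       = tt
    Holds-contents (n ∷ ns) (p ∷ ps) =
      toℕ-wrap p , Holds-suc (λ a → toℕ (contents (map wrap (n ∷ ns) ++ _) a)) 0 ns (Holds-contents ns ps)

    module Execution (xs : List Word) (1<W : 1 < 2 ^ w) where

      M : Vector Word (2 ^ w)
      M a = contents xs (toℕ a)

      mem : ℕ → ℕ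
      mem a = toℕ (contents xs a)

      Answers : ℕ → Bool → ℕ → Set
      Answers p b t = ∀ (R : Vector Word 3) → toℕ (R zero) ≡ p → toℕ (R (suc zero)) ≡ 1 →
        ∀ t′ → t ≤ t′ → run program t′ ⟨ 2 , R , M ⟩ ≡ just b

      wrap0 : toℕ (wrap 0) ≡ 0
      wrap0 = toℕ-wrap (<⇒≤ 1<W)

      jumps : ∀ {t i} (R : Vector Word 3) x ℓ → toℕ (R x) ≡ 0 →
        exec program t ⟨ i , R , M ⟩ (just (jumpZero x ℓ)) ≡ run program t ⟨ ℓ , R , M ⟩
      jumps R x ℓ e rewrite e = refl

      stays : ∀ {t i k} (R : Vector Word 3) x ℓ → toℕ (R x) ≡ suc k →
        exec program t ⟨ i , R , M ⟩ (just (jumpZero x ℓ)) ≡ run program t ⟨ suc i , R , M ⟩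
      stays R x ℓ e rewrite e = refl

      toℕ-eq : ∀ {a b a′ b′} → a ≡ a′ → b ≡ b′ →
        toℕ (wrap (if a ≡ᵇ b then 1 else 0)) ≡ toℕ (wrap (if a′ ≡ᵇ b′ then 1 else 0))
      toℕ-eq refl refl = refl

      compared : Vector Word 3 → Vector Word 3
      compared R = R [ suc (suc zero) ]≔ ⟦ eq ⟧ (R zero) (R (suc zero))

      followed : Vector Word 3 → Vector Word 3
      followed R = R₅ [ zero ]≔ M (R₅ zero)
        where
        R₁ = compared R
        R₂ = R₁ [ suc (suc zero) ]≔ M (R₁ zero)
        R₃ = R₂ [ suc (suc zero) ]≔ M (R₂ (suc (suc zero)))
        R₄ = R₃ [ zero ]≔ ⟦ add ⟧ (R₃ zero) (R₃ (suc zero))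
        R₅ = R₄ [ zero ]≔ ⟦ add ⟧ (R₄ zero) (R₄ (suc (suc zero)))

      rejects : Answers 0 false 2
      rejects R p≡0 _ (suc (suc t)) (s≤s (s≤s _)) = jumps R zero 12 p≡0

      accepts : Answers 1 true 4
      accepts R p≡1 r≡1 (suc (suc (suc (suc t)))) (s≤s (s≤s (s≤s (s≤s _)))) = trans (stays R zero 12 p≡1)
        (stays {1 + t} {4} (compared R) (suc (suc zero)) 6 (trans (toℕ-eq p≡1 r≡1) (toℕ-wrap 1<W)))

      -- A pointer of at least 2 survives the tests against 0 and 1. The query bit then serves as an
      -- offset into the two successor cells, without a further jump.
      follows : ∀ {p a q b t} x → 2 ≤ p → suc p + bit x < 2 ^ w →
        mem p ≡ a → mem a ≡ bit x → mem (suc p + bit x) ≡ q →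
        Answers q b t → Answers p b (9 + t)
      follows {suc (suc p)} {t = t} x (s≤s (s≤s z≤n)) p< mem-p mem-a mem-q ans R p≡ r≡
              (suc (suc (suc (suc (suc (suc (suc (suc (suc t′)))))))))
              (s≤s (s≤s (s≤s (s≤s (s≤s (s≤s (s≤s (s≤s (s≤s t≤t′)))))))))
        = trans (stays R zero 12 p≡)
            (trans (jumps {6 + t′} {4} (compared R) (suc (suc zero)) 6 (trans (toℕ-eq p≡ r≡) wrap0))
              (ans (followed R) (trans (cong mem eq₂) mem-q) r≡ t′ t≤t′))
        where
        eq₁ : toℕ (wrap (toℕ (R zero) + toℕ (R (suc zero)))) ≡ suc (suc (suc p))
        eq₁ = trans (cong (λ z → toℕ (wrap z)) (trans (cong₂ _+_ p≡ r≡) (+-comm (suc (suc p)) 1)))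
          (toℕ-wrap (≤-<-trans (m≤m+n _ (bit x)) p<))
        eq₂ : toℕ (wrap (toℕ (wrap (toℕ (R zero) + toℕ (R (suc zero)))) + mem (mem (toℕ (R zero)))))
              ≡ suc (suc (suc p)) + bit x
        eq₂ = trans (cong (λ z → toℕ (wrap z)) (cong₂ _+_ eq₁
            (trans (cong mem (trans (cong mem p≡) mem-p)) mem-a)))
          (toℕ-wrap p<)

      module _ {d : ℕ} (off : ℕ) (v : Vec Bool d) (mem-v : ∀ i → mem (off + toℕ i) ≡ bit (lookup v i)) where

        -- The failure pointer acts as a continuation with answer `r` and cost `tf`; the disjunction
        -- case composes two of these. An accepting leaf bypasses the continuation but takes four
        -- steps itself, whence `4 ≤ tf`.
        run-fragment : ∀ t f b {r tf} → Holds mem b (nodes off t f b) → 2 ≤ b →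
          b + 3 * size t ≤ 2 ^ w → 4 ≤ tf → Answers f r tf →
          Answers (entry t f b) (eval t v ∨ r) (9 * depth t + tf)
        run-fragment accept f b h 2≤b b≤W 4≤tf ans R p r t′ t≤ = accepts R p r t′ (≤-trans 4≤tf t≤)
        run-fragment reject f b h 2≤b b≤W 4≤tf ans = ans
        run-fragment (test i t₀ t₁) f b {r} {tf} h 2≤b b≤W 4≤tf ans
          with h₀ , h₁₂ ← Holds-++ mem b (nodes off t₀ f b) h
          with h₁ , h₂ ← Holds-++ mem (b + length (nodes off t₀ f b))
                           (nodes off t₁ f (b + 3 * size t₀)) h₁₂
          = branch
          where
          b₁ = b + 3 * size t₀
          p = b + 3 * (size t₀ + size t₁)
          b₁≡ : b + length (nodes off t₀ f b) ≡ b₁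
          b₁≡ = cong (b +_) (length-nodes off t₀ f b)
          regroup : ∀ b x y → b + 3 * x + 3 * y ≡ b + 3 * (x + y)
          regroup = solve-∀
          p≡ : b + length (nodes off t₀ f b) + length (nodes off t₁ f b₁) ≡ p
          p≡ = trans (cong₂ _+_ b₁≡ (length-nodes off t₁ f b₁)) (regroup b (size t₀) (size t₁))
          b≤₁ : b₁ + 3 * size t₁ ≤ 2 ^ w
          b≤₁ = ≤-trans (split-test b (size t₀) (size t₁)) b≤W
          b≤₀ : b₁ ≤ 2 ^ w
          b≤₀ = ≤-trans (m≤m+n b₁ _) b≤₁
          node : Holds mem p (off + toℕ i ∷ entry t₀ f b ∷ entry t₁ f b₁ ∷ [])
          node = subst (λ z → Holds mem z (off + toℕ i ∷ entry t₀ f b ∷ entry t₁ f b₁ ∷ [])) p≡ h₂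
          2+p< : 2 + p < 2 ^ w
          2+p< = <-≤-trans (≤-reflexive (shift b (size t₀ + size t₁))) b≤W
            where
            shift : ∀ b x → 3 + (b + 3 * x) ≡ b + 3 * suc x
            shift = solve-∀
          ans₀ = run-fragment t₀ f b h₀ 2≤b b≤₀ 4≤tf ans
          ans₁ = run-fragment t₁ f b₁ (subst (λ z → Holds mem z (nodes off t₁ f b₁)) b₁≡ h₁)
                   (≤-trans 2≤b (m≤m+n b _)) b≤₁ 4≤tf ans
          slower : ∀ {q b t} → t ≤ depth t₀ ⊔ depth t₁ → Answers q b (9 * t + tf) →
                   Answers q b (9 * (depth t₀ ⊔ depth t₁) + tf)
          slower t≤ ans R p r t′ t≤t′ = ans R p r t′ (≤-trans (+-monoˡ-≤ tf (*-monoʳ-≤ 9 t≤)) t≤t′)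
          2≤p : 2 ≤ p
          2≤p = ≤-trans 2≤b (m≤m+n b _)
          time≡ : 9 + (9 * (depth t₀ ⊔ depth t₁) + tf) ≡ 9 * suc (depth t₀ ⊔ depth t₁) + tf
          time≡ = regroup′ (depth t₀ ⊔ depth t₁) tf
            where
            regroup′ : ∀ x y → 9 + (9 * x + y) ≡ 9 * suc x + y
            regroup′ = solve-∀
          branch : Answers p ((if lookup v i then eval t₁ v else eval t₀ v) ∨ r)
                     (9 * suc (depth t₀ ⊔ depth t₁) + tf)
          branch with lookup v i | mem-v i | node
          ... | false | mem-i | n₀ , n₁ , _ = subst (Answers p _) time≡ (follows false 2≤p
            (≤-<-trans (≤-reflexive (cong suc (+-identityʳ p))) (<⇒≤ 2+p<)) n₀ mem-i
            (trans (cong mem (cong suc (+-identityʳ p))) n₁)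
            (slower (m≤m⊔n (depth t₀) (depth t₁)) ans₀))
          ... | true  | mem-i | n₀ , _ , n₂ , _ = subst (Answers p _) time≡ (follows true 2≤p
            (≤-<-trans (≤-reflexive (cong suc (+-comm p 1))) 2+p<) n₀ mem-i
            (trans (cong mem (cong suc (+-comm p 1))) n₂)
            (slower (m≤n⊔m (depth t₀) (depth t₁)) ans₁))
        run-fragment (t orElse u) f b {r} {tf} h 2≤b b≤W 4≤tf ans
          with hᵤ , hₜ ← Holds-++ mem b (nodes off u f b) h =
          subst₂ (Answers _) (sym (∨-assoc (eval t v) (eval u v) r)) time≡
            (run-fragment t (entry u f b) bₜ
              (subst (λ z → Holds mem z (nodes off t (entry u f b) bₜ)) (cong (b +_) (length-nodes off u f b)) hₜ)
              (≤-trans 2≤b (m≤m+n b _)) b≤t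
              (≤-trans 4≤tf (m≤n+m tf _))
              (run-fragment u f b hᵤ 2≤b (≤-trans (m≤m+n bₜ (3 * size t)) b≤t) 4≤tf ans))
          where
          bₜ = b + 3 * size u
          b≤t : bₜ + 3 * size t ≤ 2 ^ w
          b≤t = ≤-trans (≤-reflexive (split-orElse b (size t) (size u))) b≤W
          time≡ : 9 * depth t + (9 * depth u + tf) ≡ 9 * (depth t + depth u) + tf
          time≡ = regroup (depth t) (depth u) tf
            where
            regroup : ∀ x y z → 9 * x + (9 * y + z) ≡ 9 * (x + y) + z
            regroup = solve-∀

      start : ∀ {b t} → Answers (mem 0) b t → run program (2 + t) (initial xs) ≡ just b
      start {t = t} ans = ans _ (cong mem wrap0) (toℕ-wrap 1<W) t ≤-refl

    -- Cell 0 is the root pointer and cell 1 is padding: nodes start at address 2, so none is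
    -- mistaken for the pointers 0 and 1. The query follows directly behind the nodes, which fixes
    -- the offset.
    cells : Frag d → List ℕ
    cells t = entry t 0 2 ∷ 0 ∷ nodes (2 + 3 * size t) t 0 2

    words : Frag d → List Word
    words t = map wrap (cells t)

    length-words : (t : Frag d) → length (words t) ≡ 2 + 3 * size t
    length-words t = trans (length-map wrap (cells t)) (cong (2 +_) (length-nodes _ t 0 2))

    words-answer : 1 < 2 ^ w → (t : Frag d) → length (words t) + d ≤ 2 ^ w → (v : Vec Bool d) →
      answer w program (words t) v (2 + (9 * depth t + 4)) ≡ just (eval t v)
    words-answer {d} 1<W t fits v = start
      (subst₂ (λ p b → Answers p b (9 * depth t + 4)) (sym (proj₁ held)) (∨-identityʳ (eval t v))
        (run-fragment off v mem-v t 0 2 (proj₂ (proj₂ held)) ≤-refl off≤W ≤-refl rejects′))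
      where
      open Execution (words t ++ encode w v) 1<W
      off = 2 + 3 * size t
      off+d≤W : off + d ≤ 2 ^ w
      off+d≤W = subst (λ z → z + d ≤ 2 ^ w) (length-words t) fits
      off≤W : off ≤ 2 ^ w
      off≤W = ≤-trans (m≤m+n off d) off+d≤W
      0<W : 0 < 2 ^ w
      0<W = <⇒≤ 1<W
      held : Holds mem 0 (cells t)
      held = Holds-contents (cells t)
        (entry< t 0 2 0<W 1<W off≤W ∷ 0<W ∷ nodes< t 0 2 off+d≤W 0<W 1<W off≤W)
      rejects′ : Answers 0 false 4
      rejects′ R p r t′ t≤ = rejects R p r t′ (<⇒≤ (<⇒≤ t≤))
      bit< : ∀ b → bit b < 2 ^ w
      bit< false = 0<W
      bit< true  = 1<W
      mem-v : ∀ i → mem (off + toℕ i) ≡ bit (lookup v i)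
      mem-v i = trans
        (cong toℕ (trans (cong (λ z → contents (words t ++ encode w v) (z + toℕ i)) (sym (length-words t)))
          (trans (contents-++ (words t) (encode w v) (toℕ i)) (contents-toList (λ b → wrap (bit b)) v i))))
        (toℕ-wrap (bit< (lookup v i)))

-- Powers, logarithms and the unit of measurement

module Powers where
  open import Data.Nat.Base
  open import Data.Nat.DivMod using (m≡m%n+[m/n]*n; m%n<n; m/n*n≤m)
  open import Data.Nat.Induction using (<-rec)
  open import Data.Nat.Logarithm using (⌊log₂_⌋; ⌊log₂⌋-mono-≤; ⌊log₂⌊n/2⌋⌋≡⌊log₂n⌋∸1; ⌊log₂[2^n]⌋≡n)
  open import Data.Nat.Properties
  open import Relation.Binary.PropositionalEquality
  open ≤-Reasoning

  ^-cancelˡ-≤ : ∀ x y g .{{_ : NonZero g}} → x ^ g ≤ y ^ g → x ≤ y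
  ^-cancelˡ-≤ x y g x^g≤y^g = ≮⇒≥ λ y<x → <⇒≱ (^-monoˡ-< g y<x) x^g≤y^g

  ^-cancelˡ-< : ∀ x y g → x ^ g < y ^ g → x < y
  ^-cancelˡ-< x y g x^g<y^g = ≰⇒> λ y≤x → ≤⇒≯ (^-monoˡ-≤ g y≤x) x^g<y^g

  ^-cancelʳ-< : ∀ b x y .{{_ : NonZero b}} → b ^ x < b ^ y → x < y
  ^-cancelʳ-< b x y b^x<b^y = ≰⇒> λ y≤x → ≤⇒≯ (^-monoʳ-≤ b y≤x) b^x<b^y

  ^-distribʳ-* : ∀ x y g → (x * y) ^ g ≡ x ^ g * y ^ g
  ^-distribʳ-* x y zero    = refl
  ^-distribʳ-* x y (suc g) = trans (cong (x * y *_) (^-distribʳ-* x y g)) ([m*n]*[o*p]≡[m*o]*[n*p] x y (x ^ g) (y ^ g))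

  2*⌊n/2⌋≤n : ∀ n → 2 * ⌊ n /2⌋ ≤ n
  2*⌊n/2⌋≤n n = begin
    2 * ⌊ n /2⌋            ≡⟨ cong (⌊ n /2⌋ +_) (+-identityʳ _) ⟩
    ⌊ n /2⌋ + ⌊ n /2⌋      ≤⟨ +-monoʳ-≤ ⌊ n /2⌋ (⌊n/2⌋≤⌈n/2⌉ n) ⟩
    ⌊ n /2⌋ + ⌈ n /2⌉      ≡⟨ ⌊n/2⌋+⌈n/2⌉≡n n ⟩
    n                      ∎

  2^⌊log₂n⌋≤n : ∀ n → 1 ≤ n → 2 ^ ⌊log₂ n ⌋ ≤ n
  2^⌊log₂n⌋≤n = <-rec _ step
    where
    step : ∀ n → (∀ {m} → m < n → 1 ≤ m → 2 ^ ⌊log₂ m ⌋ ≤ m) → 1 ≤ n → 2 ^ ⌊log₂ n ⌋ ≤ n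
    step (suc zero)        rec _ = ≤-refl
    step n@(suc (suc n-2)) rec _ = begin
      2 ^ ⌊log₂ n ⌋               ≡⟨ cong (2 ^_) (m+[n∸m]≡n (⌊log₂⌋-mono-≤ {2} {n} (s≤s (s≤s z≤n)))) ⟨
      2 * 2 ^ (⌊log₂ n ⌋ ∸ 1)     ≡⟨ cong (λ z → 2 * 2 ^ z) (⌊log₂⌊n/2⌋⌋≡⌊log₂n⌋∸1 n) ⟨
      2 * 2 ^ ⌊log₂ ⌊ n /2⌋ ⌋     ≤⟨ *-monoʳ-≤ 2 (rec {⌊ n /2⌋} (⌊n/2⌋<n (suc n-2)) (s≤s z≤n)) ⟩
      2 * ⌊ n /2⌋                 ≤⟨ 2*⌊n/2⌋≤n n ⟩
      n                           ∎

  n<2^[1+⌊log₂n⌋] : ∀ n → n < 2 ^ suc ⌊log₂ n ⌋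
  n<2^[1+⌊log₂n⌋] n = ≰⇒> λ 2^≤n →
    n≮n ⌊log₂ n ⌋ (≤-trans (≤-reflexive (sym (⌊log₂[2^n]⌋≡n (suc ⌊log₂ n ⌋)))) (⌊log₂⌋-mono-≤ 2^≤n))

  n<2^n : ∀ n → n < 2 ^ n
  n<2^n zero    = ≤-refl
  n<2^n (suc n) = begin-strict
    suc n            ≡⟨ +-comm 1 n ⟩
    n + 1            <⟨ +-mono-<-≤ (n<2^n n) (m^n>0 2 n) ⟩
    2 ^ n + 2 ^ n    ≡⟨ cong (2 ^ n +_) (+-identityʳ _) ⟨
    2 ^ suc n        ∎

  module Scale (D : ℕ) .{{_ : NonZero D}} where

    -- For n ≥ 1, `2 ^ unit n` is at most n^(1/D) and more than half of it. Costs become powers of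
    -- this number, so that exponents are integers.
    unit : ℕ → ℕ
    unit n = ⌊log₂ n ⌋ / D

    unit-lower : ∀ n → 1 ≤ n → 2 ^ (D * unit n) ≤ n
    unit-lower n 1≤n = ≤-trans (^-monoʳ-≤ 2 (≤-trans (≤-reflexive (*-comm D (unit n))) (m/n*n≤m ⌊log₂ n ⌋ D))) (2^⌊log₂n⌋≤n n 1≤n)

    unit-upper : ∀ n → n < 2 ^ (D * suc (unit n))
    unit-upper n = <-≤-trans (n<2^[1+⌊log₂n⌋] n) (^-monoʳ-≤ 2 (begin
      suc ⌊log₂ n ⌋                        ≡⟨ cong suc (m≡m%n+[m/n]*n ⌊log₂ n ⌋ D) ⟩
      suc (⌊log₂ n ⌋ % D) + unit n * D     ≤⟨ +-monoˡ-≤ (unit n * D) (m%n<n ⌊log₂ n ⌋ D) ⟩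
      suc (unit n) * D                     ≡⟨ *-comm (suc (unit n)) D ⟩
      D * suc (unit n)                     ∎))

    unit-large : ∀ U n → 2 ^ (D * U) ≤ n → U ≤ unit n
    unit-large U n 2^≤n = ≤-pred (*-cancelˡ-< D U (suc (unit n))
      (^-cancelʳ-< 2 (D * U) (D * suc (unit n)) (≤-<-trans 2^≤n (unit-upper n))))

-- Approximating reals by fractions with a fixed denominator

module Approximation where
  open import Defs hiding (eq)
  open import Data.Integer.Base as ℤ using (+_; -[1+_])
  import Data.Integer.Properties as ℤₚ
  open import Data.Nat.Base as ℕ using (ℕ; zero; suc; NonZero)
  open import Data.Nat.Coprimality as Coprimality using (Coprime; 1-coprimeTo)
  open import Data.Nat.DivMod using (_/_; _%_; m≡m%n+[m/n]*n; m%n<n; m/n*n≤m)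
  import Data.Nat.Properties as ℕₚ
  open import Data.Product.Base using (∃-syntax; _×_; _,_)
  open import Data.Rational.Base as ℚ using (ℚ; mkℚ; 0ℚ; 1ℚ; *≤*; *<*)
  import Data.Rational.Properties as ℚₚ
  open import Data.Rational.Solver using (module +-*-Solver)
  open import Data.Rational.Unnormalised.Base using (*≡*)
  import Data.Rational.Unnormalised.Properties as ℚᵘₚ
  open import Data.Sum.Base using (inj₁; inj₂)
  open import Relation.Binary.PropositionalEquality
  open import Relation.Nullary.Negation using (contradiction)
  open Powers

  ι : ℕ → ℚ
  ι n = mkℚ (+ n) 0 (Coprimality.sym (1-coprimeTo n))

  ι-mono : ∀ {m n} → m ℕ.≤ n → ι m ℚ.≤ ι n
  ι-mono {m} {n} m≤n = *≤* (subst₂ ℤ._≤_ (sym (ℤₚ.*-identityʳ (+ m))) (sym (ℤₚ.*-identityʳ (+ n))) (ℤ.+≤+ m≤n))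

  ι-cancel : ∀ {m n} → ι m ℚ.≤ ι n → m ℕ.≤ n
  ι-cancel {m} {n} (*≤* p) =
    ℤₚ.drop‿+≤+ (subst₂ ℤ._≤_ (ℤₚ.*-identityʳ (+ m)) (ℤₚ.*-identityʳ (+ n)) p)

  ι-+ : ∀ m n → ι (m ℕ.+ n) ≡ ι m ℚ.+ ι n
  ι-+ m n = ℚₚ.toℚᵘ-injective (ℚᵘₚ.≃-trans
    (*≡* (cong (ℤ._* + 1) (cong₂ ℤ._+_ (sym (ℤₚ.*-identityʳ (+ m))) (sym (ℤₚ.*-identityʳ (+ n))))))
    (ℚᵘₚ.≃-sym (ℚₚ.toℚᵘ-homo-+ (ι m) (ι n))))

  ι-* : ∀ m n → ι (m ℕ.* n) ≡ ι m ℚ.* ι n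
  ι-* m n = ℚₚ.toℚᵘ-injective (ℚᵘₚ.≃-trans
    (*≡* (cong (ℤ._* + 1) (ℤₚ.pos-* m n)))
    (ℚᵘₚ.≃-sym (ℚₚ.toℚᵘ-homo-* (ι m) (ι n))))

  ι-pos : ∀ n .{{_ : NonZero n}} → ℚ.Positive (ι n)
  ι-pos (suc n) = _

  ι↧-* : ∀ n k .(c : Coprime ℤ.∣ n ∣ (suc k)) → ι (suc k) ℚ.* mkℚ n k c ≡ mkℚ n 0 (Coprimality.sym (1-coprimeTo ℤ.∣ n ∣))
  ι↧-* n k c = ℚₚ.toℚᵘ-injective (ℚᵘₚ.≃-trans (ℚₚ.toℚᵘ-homo-* (ι (suc k)) (mkℚ n k c))
    (*≡* (trans (ℤₚ.*-identityʳ (+ suc k ℤ.* n)) (trans (ℤₚ.*-comm (+ suc k) n)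
      (cong (λ z → n ℤ.* + z) (sym (ℕₚ.+-identityʳ (suc k))))))))

  -- Every linear inequality between rationals follows from a sum of known
  -- ones and a ring identity.
  rearrange : ∀ {x y p q} → x ℚ.≤ y → p ℚ.+ y ≡ q ℚ.+ x → p ℚ.≤ q
  rearrange {x} {y} {p} {q} x≤y eq = begin
    p                        ≡⟨ cancel p y ⟨
    (p ℚ.+ y) ℚ.- y          ≡⟨ cong (ℚ._- y) eq ⟩
    (q ℚ.+ x) ℚ.- y          ≤⟨ ℚₚ.+-monoˡ-≤ (ℚ.- y) (ℚₚ.+-monoʳ-≤ q x≤y) ⟩
    (q ℚ.+ y) ℚ.- y          ≡⟨ cancel q y ⟩
    q                        ∎
    where
    open ℚₚ.≤-Reasoning
    open +-*-Solver
    cancel : ∀ a b → (a ℚ.+ b) ℚ.- b ≡ a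
    cancel = solve 2 (λ a b → (a :+ b) :- b := a) refl

  p≤∣p∣ : ∀ p → p ℚ.≤ ℚ.∣ p ∣
  p≤∣p∣ p with ℚₚ.≤-total 0ℚ p
  ... | inj₁ 0≤p = ℚₚ.≤-reflexive (sym (ℚₚ.0≤p⇒∣p∣≡p 0≤p))
  ... | inj₂ p≤0 = ℚₚ.≤-trans p≤0 (ℚₚ.0≤∣p∣ p)

  frac : ∀ X D .{{_ : NonZero D}} → ∃[ q ] ι D ℚ.* q ≡ ι X
  frac X (suc D) = (ℚ.1/ ι (suc D)) ℚ.* ι X ,
    trans (sym (ℚₚ.*-assoc (ι (suc D)) (ℚ.1/ ι (suc D)) (ι X)))
      (trans (cong (ℚ._* ι X) (ℚₚ.*-inverseʳ (ι (suc D)))) (ℚₚ.*-identityˡ (ι X)))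

  *-mono-ι : ∀ D {p q} → p ℚ.≤ q → ι D ℚ.* p ℚ.≤ ι D ℚ.* q
  *-mono-ι D = ℚₚ.*-monoˡ-≤-nonNeg (ι D)

  *-cancel-ι : ∀ D .{{_ : NonZero D}} {p q} → ι D ℚ.* p ℚ.≤ ι D ℚ.* q → p ℚ.≤ q
  *-cancel-ι (suc D) = ℚₚ.*-cancelˡ-≤-pos (ι (suc D))

  frac-pos : ∀ {X D q} .{{_ : NonZero D}} → 1 ℕ.≤ X → ι D ℚ.* q ≡ ι X → 0ℚ ℚ.< q
  frac-pos {X} {D} {q} 1≤X eq = ℚₚ.≰⇒> λ q≤0 → ℕₚ.<⇒≱ 1≤X (ι-cancel (begin
    ι X             ≡⟨ eq ⟨
    ι D ℚ.* q       ≤⟨ *-mono-ι D q≤0 ⟩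
    ι D ℚ.* 0ℚ      ≡⟨ ℚₚ.*-zeroʳ (ι D) ⟩
    0ℚ              ∎))
    where open ℚₚ.≤-Reasoning

  -- Bounds by X / D on the terms of the Cauchy sequence from some index on, rather than on the
  -- limit, so that they can be combined by arithmetic on single terms.
  LowerBound UpperBound : ℕ → ℕ → ℝ → Set
  LowerBound D X x = ∃[ N ] ∀ n → N ℕ.≤ n → ι X ℚ.≤ ι D ℚ.* seq x n
  UpperBound D X x = ∃[ N ] ∀ n → N ℕ.≤ n → ι D ℚ.* seq x n ℚ.≤ ι X

  Eventually : (ℕ → Set) → Set
  Eventually P = ∃[ N ] ∀ n → N ℕ.≤ n → P n

  infixr 4 _⊗_
  _⊗_ : ∀ {P Q : ℕ → Set} → Eventually P → Eventually Q → Eventually (λ n → P n × Q n)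
  (M , p) ⊗ (N , q) = M ℕ.⊔ N , λ n M⊔N≤n →
    p n (ℕₚ.≤-trans (ℕₚ.m≤m⊔n M N) M⊔N≤n) , q n (ℕₚ.≤-trans (ℕₚ.m≤n⊔m M N) M⊔N≤n)

  eventually : ∀ {P : ℕ → Set} → Eventually P → ∃[ n ] P n
  eventually (N , p) = N , p N ℕₚ.≤-refl

  mapᴱ : ∀ {P Q : ℕ → Set} → (∀ {n} → P n → Q n) → Eventually P → Eventually Q
  mapᴱ f (N , p) = N , λ n N≤n → f (p n N≤n)

  positive-lower : ∀ {q} → 0ℚ ℚ.< q → ∃[ z ] NonZero z × 1ℚ ℚ.≤ ι z ℚ.* q
  positive-lower {mkℚ n k c} (*<* 0<) with n
  ... | + zero     = contradiction (ℤₚ.drop‿+<+ 0<) λ ()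
  ... | + suc m    = suc k , _ , ℚₚ.≤-trans (ι-mono (ℕ.s≤s ℕ.z≤n))
                       (ℚₚ.≤-reflexive (sym (ι↧-* (+ suc m) k c)))
  ... | -[1+ m ]   = contradiction 0< λ ()

  positive⇒lower : ∀ x → 0ℝ < x → ∃[ z ] NonZero z × LowerBound z 1 x
  positive⇒lower x (q , q>0 , N , h) with positive-lower q>0
  ... | z , z≢0 , 1≤zq = z , z≢0 , N , λ n N≤n → ℚₚ.≤-trans 1≤zq
    (*-mono-ι z (ℚₚ.≤-trans (ℚₚ.≤-reflexive (sym (ℚₚ.+-identityˡ q))) (h n N≤n)))

  floor : ∀ q → 0ℚ ℚ.≤ q → ∃[ f ] ι f ℚ.≤ q × q ℚ.≤ ι (suc f)
  floor q@(mkℚ (+ m) k c) _ = m / suc k ,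
    *-cancel-ι (suc k) (ℚₚ.≤-trans (ℚₚ.≤-reflexive (sym (ι-* (suc k) (m / suc k))))
      (ℚₚ.≤-trans (ι-mono lower) (ℚₚ.≤-reflexive (sym (ι↧-* (+ m) k c))))) ,
    *-cancel-ι (suc k) (ℚₚ.≤-trans (ℚₚ.≤-reflexive (ι↧-* (+ m) k c))
      (ℚₚ.≤-trans (ι-mono upper) (ℚₚ.≤-reflexive (ι-* (suc k) (suc (m / suc k))))))
    where
    lower : suc k ℕ.* (m / suc k) ℕ.≤ m
    lower = ℕₚ.≤-trans (ℕₚ.≤-reflexive (ℕₚ.*-comm (suc k) (m / suc k))) (m/n*n≤m m (suc k))
    upper : m ℕ.≤ suc k ℕ.* suc (m / suc k)
    upper = begin
      m                                      ≡⟨ m≡m%n+[m/n]*n m (suc k) ⟩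
      m % suc k ℕ.+ m / suc k ℕ.* suc k      ≤⟨ ℕₚ.+-monoˡ-≤ _ (ℕₚ.<⇒≤ (m%n<n m (suc k))) ⟩
      suc (m / suc k) ℕ.* suc k              ≡⟨ ℕₚ.*-comm (suc (m / suc k)) (suc k) ⟩
      suc k ℕ.* suc (m / suc k)              ∎
      where open ℕₚ.≤-Reasoning
  floor (mkℚ -[1+ m ] k c) (*≤* ())

  -- A real has no computable integer part, but one term of the sequence has a floor f. Later terms,
  -- scaled by `D`, differ from it by at most 1, so they lie between f - 1 and f + 2: an interval of
  -- length three.
  approximate : ∀ D .{{_ : NonZero D}} x → 0ℝ < x → ∃[ X ] LowerBound D X x × UpperBound D (3 ℕ.+ X) x
  approximate D x (q , q>0 , N₁ , h₁) with frac 1 D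
  ... | δ , Dδ≡1 with cauchy x δ (frac-pos {D = D} (ℕ.s≤s ℕ.z≤n) Dδ≡1)
  ... | N₂ , h₂ = bound (floor y 0≤y)
    where
    open ℚₚ.≤-Reasoning
    open +-*-Solver
    N = N₁ ℕ.⊔ N₂
    y = ι D ℚ.* seq x N
    0≤x : ∀ n → N ℕ.≤ n → 0ℚ ℚ.≤ seq x n
    0≤x n N≤n = ℚₚ.≤-trans (ℚₚ.<⇒≤ q>0) (ℚₚ.≤-trans (ℚₚ.≤-reflexive (sym (ℚₚ.+-identityˡ q)))
      (h₁ n (ℕₚ.≤-trans (ℕₚ.m≤m⊔n N₁ N₂) N≤n)))
    0≤Dx : ∀ n → N ℕ.≤ n → 0ℚ ℚ.≤ ι D ℚ.* seq x n
    0≤Dx n N≤n = ℚₚ.≤-trans (ℚₚ.≤-reflexive (sym (ℚₚ.*-zeroʳ (ι D)))) (*-mono-ι D (0≤x n N≤n))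
    0≤y : 0ℚ ℚ.≤ y
    0≤y = 0≤Dx N ℕₚ.≤-refl
    close : ∀ m n → N ℕ.≤ m → N ℕ.≤ n → ι D ℚ.* seq x m ℚ.≤ ι D ℚ.* seq x n ℚ.+ 1ℚ
    close m n N≤m N≤n = begin
      ι D ℚ.* seq x m
        ≤⟨ *-mono-ι D {seq x m} {seq x n ℚ.+ δ} (rearrange (ℚₚ.≤-trans (p≤∣p∣ (seq x m ℚ.- seq x n))
             (h₂ m n (ℕₚ.≤-trans (ℕₚ.m≤n⊔m N₁ N₂) N≤m) (ℕₚ.≤-trans (ℕₚ.m≤n⊔m N₁ N₂) N≤n)))
             (solve 3 (λ a b e → a :+ e := (b :+ e) :+ (a :- b)) refl (seq x m) (seq x n) δ)) ⟩
      ι D ℚ.* (seq x n ℚ.+ δ)            ≡⟨ ℚₚ.*-distribˡ-+ (ι D) (seq x n) δ ⟩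
      ι D ℚ.* seq x n ℚ.+ ι D ℚ.* δ      ≡⟨ cong (ι D ℚ.* seq x n ℚ.+_) Dδ≡1 ⟩
      ι D ℚ.* seq x n ℚ.+ 1ℚ             ∎
    above : ∀ f → y ℚ.≤ ι (suc f) → ∀ n → N ℕ.≤ n → ι D ℚ.* seq x n ℚ.≤ ι (2 ℕ.+ f)
    above f y≤ n N≤n = begin
      ι D ℚ.* seq x n      ≤⟨ close n N N≤n ℕₚ.≤-refl ⟩
      y ℚ.+ 1ℚ             ≤⟨ ℚₚ.+-monoˡ-≤ 1ℚ y≤ ⟩
      ι (suc f) ℚ.+ 1ℚ     ≡⟨ ι-+ (suc f) 1 ⟨
      ι (suc f ℕ.+ 1)      ≡⟨ cong ι (ℕₚ.+-comm (suc f) 1) ⟩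
      ι (2 ℕ.+ f)          ∎
    bound : ∃[ f ] ι f ℚ.≤ y × y ℚ.≤ ι (suc f) → ∃[ X ] LowerBound D X x × UpperBound D (3 ℕ.+ X) x
    -- Here f - 1 would be negative; positivity of `x` supplies the lower bound 0.
    bound (zero  , _ , y≤) = 0 , (N , 0≤Dx) , (N , λ n N≤n →
      ℚₚ.≤-trans (above 0 y≤ n N≤n) (ι-mono (ℕ.s≤s (ℕ.s≤s ℕ.z≤n))))
    bound (suc X , ≤y , y≤) = X ,
      (N , λ n N≤n → rearrange (ℚₚ.≤-trans (ℚₚ.≤-trans (ℚₚ.≤-reflexive (sym (ι-+ 1 X))) ≤y) (close N n ℕₚ.≤-refl N≤n))
        (solve 2 (λ a b → a :+ (b :+ con 1ℚ) := b :+ (con 1ℚ :+ a)) refl (ι X) (ι D ℚ.* seq x n))) ,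
      (N , above (suc X) y≤)

-- Real exponents of n, roundings and the O-notation

module Exponents where
  open import Defs hiding (eq)
  open import Data.Integer.Base using (+_; -[1+_])
  open import Data.Nat.Base as ℕ using (ℕ; zero; suc; NonZero; z≤n; s≤s; _^_)
  open import Data.Nat.DivMod using (_/_; m≡m%n+[m/n]*n; m%n<n; m/n*n≤m)
  open import Data.Nat.Logarithm using (⌊log₂_⌋)
  import Data.Nat.Properties as ℕₚ
  open import Data.Nat.Tactic.RingSolver using (solve-∀)
  open import Data.Product.Base using (∃-syntax; _×_; _,_)
  open import Data.Rational.Base as ℚ using (ℚ; mkℚ; 0ℚ; ↧ₙ_; *≤*)
  import Data.Rational.Properties as ℚₚ
  open import Data.Rational.Solver using (module +-*-Solver)
  open import Relation.Binary.PropositionalEquality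
  open import Relation.Nullary.Negation using (contradiction)
  open Powers
  open Approximation

  exponent-≤ : ∀ D q Y → ι D ℚ.* q ℚ.≤ ι Y → q⁺ q ℕ.* D ℕ.≤ Y ℕ.* ↧ₙ q
  exponent-≤ D (mkℚ -[1+ m ] k c)   Y Dq≤Y = z≤n
  exponent-≤ D q@(mkℚ (+ m) k c) Y Dq≤Y = ι-cancel (begin
    ι (m ℕ.* D)                   ≡⟨ ι-* m D ⟩
    ι m ℚ.* ι D                   ≡⟨ cong (ℚ._* ι D) (ι↧-* (+ m) k c) ⟨
    (ι (suc k) ℚ.* q) ℚ.* ι D     ≡⟨ solve 3 (λ a b e → (a :* b) :* e := a :* (e :* b)) refl (ι (suc k)) q (ι D) ⟩
    ι (suc k) ℚ.* (ι D ℚ.* q)     ≤⟨ *-mono-ι (suc k) Dq≤Y ⟩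
    ι (suc k) ℚ.* ι Y             ≡⟨ ℚₚ.*-comm (ι (suc k)) (ι Y) ⟩
    ι Y ℚ.* ι (suc k)             ≡⟨ ι-* Y (suc k) ⟨
    ι (Y ℕ.* suc k)               ∎)
    where
    open ℚₚ.≤-Reasoning
    open +-*-Solver

  exponent-≥ : ∀ D .{{_ : NonZero D}} q Y → ι Y ℚ.≤ ι D ℚ.* q →
               q⁻ q ≡ 0 × Y ℕ.* ↧ₙ q ℕ.≤ q⁺ q ℕ.* D
  exponent-≥ D q@(mkℚ -[1+ m ] k c) Y Y≤Dq = contradiction
    (*-cancel-ι D {0ℚ} {q} (ℚₚ.≤-trans (ℚₚ.≤-reflexive (ℚₚ.*-zeroʳ (ι D)))
      (ℚₚ.≤-trans (ι-mono (z≤n {Y})) Y≤Dq)))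
    λ where (*≤* ())
  exponent-≥ D q@(mkℚ (+ m) k c) Y Y≤Dq = refl , ι-cancel (begin
    ι (Y ℕ.* suc k)               ≡⟨ ι-* Y (suc k) ⟩
    ι Y ℚ.* ι (suc k)             ≡⟨ ℚₚ.*-comm (ι Y) (ι (suc k)) ⟩
    ι (suc k) ℚ.* ι Y             ≤⟨ *-mono-ι (suc k) Y≤Dq ⟩
    ι (suc k) ℚ.* (ι D ℚ.* q)     ≡⟨ solve 3 (λ a b e → (a :* b) :* e := a :* (e :* b)) refl (ι (suc k)) q (ι D) ⟨
    (ι (suc k) ℚ.* q) ℚ.* ι D     ≡⟨ cong (ℚ._* ι D) (ι↧-* (+ m) k c) ⟩
    ι m ℚ.* ι D                   ≡⟨ ι-* m D ⟨
    ι (m ℕ.* D)                   ∎)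
    where
    open ℚₚ.≤-Reasoning
    open +-*-Solver

  p≤p+q : ∀ p {q} → 0ℚ ℚ.< q → p ℚ.≤ p ℚ.+ q
  p≤p+q p q>0 = ℚₚ.≤-trans (ℚₚ.≤-reflexive (sym (ℚₚ.+-identityʳ p))) (ℚₚ.+-monoʳ-≤ p (ℚₚ.<⇒≤ q>0))

  below-exponent : ∀ D q x Y → fromℚ q < x → UpperBound D Y x → q⁺ q ℕ.* D ℕ.≤ Y ℕ.* ↧ₙ q
  below-exponent D q x Y (r , r>0 , q<x) Dx≤Y with eventually (q<x ⊗ Dx≤Y)
  ... | n , q+r≤x , Dx≤Y = exponent-≤ D q Y
    (ℚₚ.≤-trans (*-mono-ι D (ℚₚ.≤-trans (p≤p+q q r>0) q+r≤x)) Dx≤Y)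

  above-exponent : ∀ D .{{_ : NonZero D}} q x Y → x < fromℚ q → LowerBound D Y x →
                   q⁻ q ≡ 0 × Y ℕ.* ↧ₙ q ℕ.≤ q⁺ q ℕ.* D
  above-exponent D q x Y (r , r>0 , x<q) Y≤Dx with eventually (x<q ⊗ Y≤Dx)
  ... | n , x+r≤q , Y≤Dx = exponent-≥ D q Y
    (ℚₚ.≤-trans Y≤Dx (*-mono-ι D (ℚₚ.≤-trans (p≤p+q (seq x n) r>0) x+r≤q)))

  -- The strict order asks for a positive rational gap; one grid step 1 / D provides it.
  frac< : ∀ D .{{_ : NonZero D}} q x X → ι D ℚ.* q ≡ ι X → LowerBound D (suc X) x → fromℚ q < x
  frac< D q x X Dq≡X (N , X<Dx) with frac 1 D
  ... | δ , Dδ≡1 = δ , frac-pos {D = D} (s≤s z≤n) Dδ≡1 , N , λ n N≤n →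
    *-cancel-ι D (begin
      ι D ℚ.* (q ℚ.+ δ)          ≡⟨ ℚₚ.*-distribˡ-+ (ι D) q δ ⟩
      ι D ℚ.* q ℚ.+ ι D ℚ.* δ    ≡⟨ cong₂ ℚ._+_ Dq≡X Dδ≡1 ⟩
      ι X ℚ.+ ι 1                ≡⟨ trans (ℚₚ.+-comm (ι X) (ι 1)) (sym (ι-+ 1 X)) ⟩
      ι (suc X)                  ≤⟨ X<Dx n N≤n ⟩
      ι D ℚ.* seq x n            ∎)
    where open ℚₚ.≤-Reasoning

  <frac : ∀ D .{{_ : NonZero D}} q x X → ι D ℚ.* q ≡ ι (suc X) → UpperBound D X x → x < fromℚ q
  <frac D q x X Dq≡X (N , Dx≤X) with frac 1 D
  ... | δ , Dδ≡1 = δ , frac-pos {D = D} (s≤s z≤n) Dδ≡1 , N , λ n N≤n →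
    *-cancel-ι D (begin
      ι D ℚ.* (seq x n ℚ.+ δ)          ≡⟨ ℚₚ.*-distribˡ-+ (ι D) (seq x n) δ ⟩
      ι D ℚ.* seq x n ℚ.+ ι D ℚ.* δ    ≤⟨ ℚₚ.+-mono-≤ (Dx≤X n N≤n) (ℚₚ.≤-reflexive Dδ≡1) ⟩
      ι X ℚ.+ ι 1                      ≡⟨ trans (ℚₚ.+-comm (ι X) (ι 1)) (sym (ι-+ 1 X)) ⟩
      ι (suc X)                        ≡⟨ Dq≡X ⟨
      ι D ℚ.* q                        ∎)
    where open ℚₚ.≤-Reasoning

  exponent-≡ : ∀ g .{{_ : NonZero g}} q X → ι g ℚ.* q ≡ ι X →
               q⁻ q ≡ 0 × q⁺ q ℕ.* g ≡ X ℕ.* ↧ₙ q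
  exponent-≡ g q X gq≡X with exponent-≥ g q X (ℚₚ.≤-reflexive (sym gq≡X))
  ... | q⁻≡0 , ≥ = q⁻≡0 , ℕₚ.≤-antisym (exponent-≤ g q X (ℚₚ.≤-reflexive gq≡X)) ≥

  ^-swap : ∀ n a b → (n ^ a) ^ b ≡ (n ^ b) ^ a
  ^-swap n a b = trans (ℕₚ.^-*-assoc n a b) (trans (cong (n ^_) (ℕₚ.*-comm a b)) (sym (ℕₚ.^-*-assoc n b a)))

  -- Since `q` is stored in lowest terms, its denominator need not be `g`. Raising to both
  -- denominators makes the two comparisons meet.
  ^ℚ-below : ∀ g .{{_ : NonZero g}} q X a b n → ι g ℚ.* q ≡ ι X →
             a ^ g ℕ.< b ^ g ℕ.* n ^ X → a < b · n ^ℚ q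
  ^ℚ-below g q X a b n gq≡X a<b with exponent-≡ g q X gq≡X
  ... | q⁻≡0 , eq rewrite q⁻≡0 = ^-cancelˡ-< (a ^ G ℕ.* 1) (b ^ G ℕ.* n ^ q⁺ q) g (begin-strict
    (a ^ G ℕ.* 1) ^ g                 ≡⟨ cong (_^ g) (ℕₚ.*-identityʳ (a ^ G)) ⟩
    (a ^ G) ^ g                       ≡⟨ ^-swap a G g ⟩
    (a ^ g) ^ G                       <⟨ ℕₚ.^-monoˡ-< G a<b ⟩
    (b ^ g ℕ.* n ^ X) ^ G             ≡⟨ ^-distribʳ-* (b ^ g) (n ^ X) G ⟩
    (b ^ g) ^ G ℕ.* (n ^ X) ^ G       ≡⟨ cong₂ ℕ._*_ (^-swap b g G) (ℕₚ.^-*-assoc n X G) ⟩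
    (b ^ G) ^ g ℕ.* n ^ (X ℕ.* G)     ≡⟨ cong (λ z → (b ^ G) ^ g ℕ.* n ^ z) eq ⟨
    (b ^ G) ^ g ℕ.* n ^ (q⁺ q ℕ.* g)  ≡⟨ cong ((b ^ G) ^ g ℕ.*_) (ℕₚ.^-*-assoc n (q⁺ q) g) ⟨
    (b ^ G) ^ g ℕ.* (n ^ q⁺ q) ^ g    ≡⟨ ^-distribʳ-* (b ^ G) (n ^ q⁺ q) g ⟨
    (b ^ G ℕ.* n ^ q⁺ q) ^ g          ∎)
    where
    open ℕₚ.≤-Reasoning
    G = ↧ₙ q

  ^ℚ-above : ∀ g .{{_ : NonZero g}} q X a n → ι g ℚ.* q ≡ ι X →
             n ^ X ℕ.< a ^ g → 1 · n ^ℚ q < a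
  ^ℚ-above g q X a n gq≡X n<a with exponent-≡ g q X gq≡X
  ... | q⁻≡0 , eq rewrite q⁻≡0 = ^-cancelˡ-< (1 ^ G ℕ.* n ^ q⁺ q) (a ^ G ℕ.* 1) g (begin-strict
    (1 ^ G ℕ.* n ^ q⁺ q) ^ g     ≡⟨ cong (λ z → (z ℕ.* n ^ q⁺ q) ^ g) (ℕₚ.^-zeroˡ G) ⟩
    (1 ℕ.* n ^ q⁺ q) ^ g         ≡⟨ cong (_^ g) (ℕₚ.*-identityˡ (n ^ q⁺ q)) ⟩
    (n ^ q⁺ q) ^ g               ≡⟨ ℕₚ.^-*-assoc n (q⁺ q) g ⟩
    n ^ (q⁺ q ℕ.* g)             ≡⟨ cong (n ^_) eq ⟩
    n ^ (X ℕ.* G)                ≡⟨ ℕₚ.^-*-assoc n X G ⟨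
    (n ^ X) ^ G                  <⟨ ℕₚ.^-monoˡ-< G n<a ⟩
    (a ^ g) ^ G                  ≡⟨ ^-swap a g G ⟩
    (a ^ G) ^ g                  ≡⟨ cong (_^ g) (ℕₚ.*-identityʳ (a ^ G)) ⟨
    (a ^ G ℕ.* 1) ^ g            ∎)
    where
    open ℕₚ.≤-Reasoning
    G = ↧ₙ q

  -- A rounding only satisfies x log n < d + 1, but X u is an integer not above x log n, so the 1
  -- disappears. The upper bound below works in the same way.
  rounding-lower : ∀ D .{{_ : NonZero D}} {x d n} X u → LowerBound D X x → 2 ^ (D ℕ.* u) ℕ.≤ n →
                   d Rounds x ·log n → X ℕ.* u ℕ.≤ d
  rounding-lower D {x} {d} {n} X u X≤Dx 2^≤n (_ , q , x<q , n^q<) with above-exponent D q x X x<q X≤Dx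
  ... | q⁻≡0 , XG≤ rewrite q⁻≡0 = ℕₚ.≤-pred (ℕₚ.*-cancelʳ-< G (X ℕ.* u) (suc d)
    (^-cancelʳ-< 2 _ _ (begin-strict
      2 ^ (X ℕ.* u ℕ.* G)           ≡⟨ cong (2 ^_) (swap X u G) ⟩
      2 ^ (X ℕ.* G ℕ.* u)           ≤⟨ ℕₚ.^-monoʳ-≤ 2 (ℕₚ.*-monoˡ-≤ u XG≤) ⟩
      2 ^ (q⁺ q ℕ.* D ℕ.* u)        ≡⟨ cong (2 ^_) (rotate (q⁺ q) D u) ⟩
      2 ^ (D ℕ.* u ℕ.* q⁺ q)        ≡⟨ ℕₚ.^-*-assoc 2 (D ℕ.* u) (q⁺ q) ⟨
      (2 ^ (D ℕ.* u)) ^ q⁺ q        ≤⟨ ℕₚ.^-monoˡ-≤ (q⁺ q) 2^≤n ⟩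
      n ^ q⁺ q                      ≡⟨ ℕₚ.*-identityˡ (n ^ q⁺ q) ⟨
      1 ℕ.* n ^ q⁺ q                ≡⟨ cong (ℕ._* n ^ q⁺ q) (ℕₚ.^-zeroˡ G) ⟨
      1 ^ G ℕ.* n ^ q⁺ q            <⟨ n^q< ⟩
      (2 ^ suc d) ^ G ℕ.* 1         ≡⟨ ℕₚ.*-identityʳ _ ⟩
      (2 ^ suc d) ^ G               ≡⟨ ℕₚ.^-*-assoc 2 (suc d) G ⟩
      2 ^ (suc d ℕ.* G)             ∎)))
    where
    open ℕₚ.≤-Reasoning
    G = ↧ₙ q
    swap : ∀ a b c → a ℕ.* b ℕ.* c ≡ a ℕ.* c ℕ.* b
    swap = solve-∀
    rotate : ∀ a b c → a ℕ.* b ℕ.* c ≡ b ℕ.* c ℕ.* a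
    rotate = solve-∀

  rounding-upper : ∀ D {x d n} Y u → UpperBound D Y x → 1 ℕ.≤ n → n ℕ.≤ 2 ^ (D ℕ.* u) →
                   d Rounds x ·log n → d ℕ.≤ Y ℕ.* u
  rounding-upper D {x} {d} {n} Y u Dx≤Y 1≤n n≤2^ ((q , q<x , <n^q) , _) =
    ℕₚ.≤-pred (ℕₚ.*-cancelʳ-< G d (suc (Y ℕ.* u)) (^-cancelʳ-< 2 _ _ (begin-strict
      2 ^ (d ℕ.* G)                         ≡⟨ ℕₚ.^-*-assoc 2 d G ⟨
      (2 ^ d) ^ G                           ≤⟨ ℕₚ.m≤m*n ((2 ^ d) ^ G) (n ^ q⁻ q) {{ℕₚ.m^n≢0 n (q⁻ q) {{ℕ.>-nonZero 1≤n}}}} ⟩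
      (2 ^ d) ^ G ℕ.* n ^ q⁻ q              <⟨ <n^q ⟩
      2 ^ G ℕ.* n ^ q⁺ q                    ≤⟨ ℕₚ.*-monoʳ-≤ (2 ^ G) (ℕₚ.^-monoˡ-≤ (q⁺ q) n≤2^) ⟩
      2 ^ G ℕ.* (2 ^ (D ℕ.* u)) ^ q⁺ q      ≡⟨ cong (2 ^ G ℕ.*_) (ℕₚ.^-*-assoc 2 (D ℕ.* u) (q⁺ q)) ⟩
      2 ^ G ℕ.* 2 ^ (D ℕ.* u ℕ.* q⁺ q)      ≡⟨ cong (λ z → 2 ^ G ℕ.* 2 ^ z) (rotate D u (q⁺ q)) ⟩
      2 ^ G ℕ.* 2 ^ (q⁺ q ℕ.* D ℕ.* u)      ≤⟨ ℕₚ.*-monoʳ-≤ (2 ^ G) (ℕₚ.^-monoʳ-≤ 2 (ℕₚ.*-monoˡ-≤ u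
                                                 (below-exponent D q x Y q<x Dx≤Y))) ⟩
      2 ^ G ℕ.* 2 ^ (Y ℕ.* G ℕ.* u)         ≡⟨ ℕₚ.^-distribˡ-+-* 2 G (Y ℕ.* G ℕ.* u) ⟨
      2 ^ (G ℕ.+ Y ℕ.* G ℕ.* u)             ≡⟨ cong (λ z → 2 ^ (G ℕ.+ z)) (swap Y G u) ⟩
      2 ^ (suc (Y ℕ.* u) ℕ.* G)             ∎)))
    where
    open ℕₚ.≤-Reasoning
    G = ↧ₙ q
    swap : ∀ a b c → a ℕ.* b ℕ.* c ≡ a ℕ.* c ℕ.* b
    swap = solve-∀
    rotate : ∀ a b c → a ℕ.* b ℕ.* c ≡ c ℕ.* a ℕ.* b
    rotate = solve-∀

  -- Every rational `q` above `x` is at least R / D, and `2 ^ unit n` is at most n^(1/D), so n^q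
  -- dominates `2 ^ (R * unit n)`.
  is-O : ∀ D .{{_ : NonZero D}} {I : ℕ → Set} (f : ∀ n → I n → ℕ) x R C N →
    LowerBound D R x → let open Scale D in
    (∀ n → N ℕ.≤ n → ∀ i → f n i ℕ.≤ C ℕ.* 2 ^ (R ℕ.* unit n)) → f is-O[n^ x ]
  is-O D f x R C N R≤Dx f≤ = C , N ℕ.⊔ 1 , λ n N≤n i q x<q → bound n N≤n i q x<q
    where
    open Scale D
    open ℕₚ.≤-Reasoning
    bound : ∀ n → N ℕ.⊔ 1 ℕ.≤ n → ∀ i q → x < fromℚ q → f n i ≤ C · n ^ℚ q
    bound n N≤n i q x<q with above-exponent D q x R x<q R≤Dx
    ... | q⁻≡0 , RG≤ rewrite q⁻≡0 = ^-cancelˡ-≤ (f n i ^ G ℕ.* 1) (C ^ G ℕ.* n ^ q⁺ q) D (begin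
      (f n i ^ G ℕ.* 1) ^ D                ≡⟨ cong (_^ D) (ℕₚ.*-identityʳ (f n i ^ G)) ⟩
      (f n i ^ G) ^ D                      ≤⟨ ℕₚ.^-monoˡ-≤ D (ℕₚ.^-monoˡ-≤ G (f≤ n (ℕₚ.≤-trans (ℕₚ.m≤m⊔n N 1) N≤n) i)) ⟩
      ((C ℕ.* 2 ^ (R ℕ.* u)) ^ G) ^ D      ≡⟨ cong (_^ D) (^-distribʳ-* C (2 ^ (R ℕ.* u)) G) ⟩
      (C ^ G ℕ.* (2 ^ (R ℕ.* u)) ^ G) ^ D  ≡⟨ ^-distribʳ-* (C ^ G) ((2 ^ (R ℕ.* u)) ^ G) D ⟩
      (C ^ G) ^ D ℕ.* ((2 ^ (R ℕ.* u)) ^ G) ^ D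
        ≤⟨ ℕₚ.*-monoʳ-≤ ((C ^ G) ^ D) power ⟩
      (C ^ G) ^ D ℕ.* (n ^ q⁺ q) ^ D       ≡⟨ ^-distribʳ-* (C ^ G) (n ^ q⁺ q) D ⟨
      (C ^ G ℕ.* n ^ q⁺ q) ^ D             ∎)
      where
      G = ↧ₙ q
      u = unit n
      1≤n : 1 ℕ.≤ n
      1≤n = ℕₚ.≤-trans (ℕₚ.m≤n⊔m N 1) N≤n
      regroup₁ : ∀ R u G D → R ℕ.* u ℕ.* (G ℕ.* D) ≡ D ℕ.* u ℕ.* (R ℕ.* G)
      regroup₁ = solve-∀
      power : ((2 ^ (R ℕ.* u)) ^ G) ^ D ℕ.≤ (n ^ q⁺ q) ^ D
      power = begin
        ((2 ^ (R ℕ.* u)) ^ G) ^ D          ≡⟨ ℕₚ.^-*-assoc (2 ^ (R ℕ.* u)) G D ⟩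
        (2 ^ (R ℕ.* u)) ^ (G ℕ.* D)        ≡⟨ ℕₚ.^-*-assoc 2 (R ℕ.* u) (G ℕ.* D) ⟩
        2 ^ (R ℕ.* u ℕ.* (G ℕ.* D))        ≡⟨ cong (2 ^_) (regroup₁ R u G D) ⟩
        2 ^ (D ℕ.* u ℕ.* (R ℕ.* G))        ≡⟨ ℕₚ.^-*-assoc 2 (D ℕ.* u) (R ℕ.* G) ⟨
        (2 ^ (D ℕ.* u)) ^ (R ℕ.* G)        ≤⟨ ℕₚ.^-monoˡ-≤ (R ℕ.* G) (unit-lower n 1≤n) ⟩
        n ^ (R ℕ.* G)                      ≤⟨ ℕₚ.^-monoʳ-≤ n {{ℕ.>-nonZero 1≤n}} RG≤ ⟩
        n ^ (q⁺ q ℕ.* D)                   ≡⟨ ℕₚ.^-*-assoc n (q⁺ q) D ⟨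
        (n ^ q⁺ q) ^ D                     ∎


  -- Division truncates the denominator at `q` from below; beyond the index `N` this truncation is
  -- inert and the quotient is exact term by term.
  quotient-cancel : ∀ x y (y>0 : 0ℝ < y) →
    Eventually (λ n → seq (_/_[_] x y y>0) n ℚ.* seq y n ≡ seq x n)
  quotient-cancel x y (q , q>0 , N , q≤y) = N , λ n N≤n → cancel n
    (subst (ℚ._≤ seq y n) (ℚₚ.+-identityˡ q) (q≤y n N≤n))
    where
    cancel : ∀ n → q ℚ.≤ seq y n → seq (_/_[_] x y (q , q>0 , N , q≤y)) n ℚ.* seq y n ≡ seq x n
    cancel n q≤yₙ = trans (ℚₚ.*-assoc (seq x n) r (seq y n)) (trans
      (cong (seq x n ℚ.*_) (trans (cong (r ℚ.*_) (sym (ℚₚ.p≤q⇒p⊔q≡q q≤yₙ))) (ℚₚ.*-inverseˡ (q ℚ.⊔ seq y n))))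
      (ℚₚ.*-identityʳ (seq x n)))
      where
      instance
        nonZero = ℚₚ.pos⇒nonZero (q ℚ.⊔ seq y n) {{ℚ.positive (ℚₚ.<-≤-trans q>0 (ℚₚ.p≤p⊔q q (seq y n)))}}
      r = ℚ.1/ (q ℚ.⊔ seq y n)

  scale-lower : ∀ w {D X x} → LowerBound D X x → LowerBound (w ℕ.* D) (w ℕ.* X) x
  scale-lower w {D} {X} {x} (N , X≤Dx) = N , λ n N≤n → begin
    ι (w ℕ.* X)                  ≡⟨ ι-* w X ⟩
    ι w ℚ.* ι X                  ≤⟨ *-mono-ι w (X≤Dx n N≤n) ⟩
    ι w ℚ.* (ι D ℚ.* seq x n)    ≡⟨ ℚₚ.*-assoc (ι w) (ι D) (seq x n) ⟨
    ι w ℚ.* ι D ℚ.* seq x n      ≡⟨ cong (ℚ._* seq x n) (ι-* w D) ⟨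
    ι (w ℕ.* D) ℚ.* seq x n      ∎
    where open ℚₚ.≤-Reasoning

  lower≤upper : ∀ D {X Y} x → LowerBound D X x → UpperBound D Y x → X ℕ.≤ Y
  lower≤upper D x X≤Dx Dx≤Y with eventually (X≤Dx ⊗ Dx≤Y)
  ... | n , X≤ , ≤Y = ι-cancel (ℚₚ.≤-trans X≤ ≤Y)

  -- The grid 1 / g is so fine that `s` steps multiply the power of n by less than 2. Hence one `k`,
  -- about (X / g) log n rounded up, fits all exponents in that range, wherever the unknown real
  -- lies in it.
  power-between : ∀ n g .{{_ : NonZero g}} s .{{_ : NonZero s}} X → 2 ℕ.≤ n → s ℕ.* suc ⌊log₂ n ⌋ ℕ.≤ g →
    ∃[ k ] ((2 ^ k) ^ g ℕ.< 2 ^ g ℕ.* n ^ suc X) × (n ^ (s ℕ.+ X) ℕ.< (2 ^ suc k) ^ g)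
  power-between n g s X 2≤n ≤g = k , below , above
    where
    open ℕₚ.≤-Reasoning
    ℓ = ⌊log₂ n ⌋
    Y = n ^ X
    j = ⌊log₂ Y ⌋
    k = suc (j / g)
    1≤Y : 1 ℕ.≤ Y
    1≤Y = ℕₚ.m^n>0 n {{ℕ.>-nonZero (ℕₚ.<⇒≤ 2≤n)}} X
    below : (2 ^ k) ^ g ℕ.< 2 ^ g ℕ.* n ^ suc X
    below = begin-strict
      (2 ^ k) ^ g                 ≡⟨ ℕₚ.^-*-assoc 2 k g ⟩
      2 ^ (g ℕ.+ j / g ℕ.* g)     ≤⟨ ℕₚ.^-monoʳ-≤ 2 (ℕₚ.+-monoʳ-≤ g (m/n*n≤m j g)) ⟩
      2 ^ (g ℕ.+ j)               ≡⟨ ℕₚ.^-distribˡ-+-* 2 g j ⟩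
      2 ^ g ℕ.* 2 ^ j             ≤⟨ ℕₚ.*-monoʳ-≤ (2 ^ g) (2^⌊log₂n⌋≤n Y 1≤Y) ⟩
      2 ^ g ℕ.* Y                 <⟨ ℕₚ.*-monoʳ-< (2 ^ g) {{ℕₚ.m^n≢0 2 g}}
                                       (subst (Y ℕ.<_) (ℕₚ.*-comm Y n) (ℕₚ.m<m*n Y n {{ℕ.>-nonZero 1≤Y}} 2≤n)) ⟩
      2 ^ g ℕ.* n ^ suc X         ∎
    above : n ^ (s ℕ.+ X) ℕ.< (2 ^ suc k) ^ g
    above = begin-strict
      n ^ (s ℕ.+ X)                                  ≡⟨ ℕₚ.^-distribˡ-+-* n s X ⟩
      n ^ s ℕ.* Y                                    <⟨ ℕₚ.*-mono-< (ℕₚ.^-monoˡ-< s (n<2^[1+⌊log₂n⌋] n)) (n<2^[1+⌊log₂n⌋] Y) ⟩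
      (2 ^ suc ℓ) ^ s ℕ.* 2 ^ suc j                  ≡⟨ cong (ℕ._* 2 ^ suc j) (ℕₚ.^-*-assoc 2 (suc ℓ) s) ⟩
      2 ^ (suc ℓ ℕ.* s) ℕ.* 2 ^ suc j                ≡⟨ ℕₚ.^-distribˡ-+-* 2 (suc ℓ ℕ.* s) (suc j) ⟨
      2 ^ (suc ℓ ℕ.* s ℕ.+ suc j)                    ≤⟨ ℕₚ.^-monoʳ-≤ 2 (ℕₚ.+-mono-≤ ℓ≤g j<) ⟩
      2 ^ (g ℕ.+ (g ℕ.+ j / g ℕ.* g))                ≡⟨ ℕₚ.^-*-assoc 2 (suc k) g ⟨
      (2 ^ suc k) ^ g                                ∎
      where
      ℓ≤g : suc ℓ ℕ.* s ℕ.≤ g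
      ℓ≤g = ℕₚ.≤-trans (ℕₚ.≤-reflexive (ℕₚ.*-comm (suc ℓ) s)) ≤g
      j< : suc j ℕ.≤ g ℕ.+ j / g ℕ.* g
      j< = ℕₚ.≤-trans (ℕₚ.≤-reflexive (cong suc (m≡m%n+[m/n]*n j g)))
             (ℕₚ.+-monoˡ-≤ _ (m%n<n j g))

  -- The exponents used, (X + 1) / g and (X + 6) / g, lie one step outside the interval known to
  -- contain `x`, which makes the inequalities strict.
  round-at : ∀ x n g .{{_ : NonZero g}} X → 2 ℕ.≤ n → 6 ℕ.* suc ⌊log₂ n ⌋ ℕ.≤ g →
    LowerBound g (2 ℕ.+ X) x → UpperBound g (5 ℕ.+ X) x → ∃[ k ] k Rounds x ·log n
  round-at x n g X 2≤n ≤g X≤gx gx≤X =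
    combine (frac (suc X) g) (frac (6 ℕ.+ X) g) (power-between n g 6 X 2≤n ≤g)
    where
    combine : ∃[ q ] ι g ℚ.* q ≡ ι (suc X) → ∃[ q ] ι g ℚ.* q ≡ ι (6 ℕ.+ X) →
      ∃[ k ] ((2 ^ k) ^ g ℕ.< 2 ^ g ℕ.* n ^ suc X) × (n ^ (6 ℕ.+ X) ℕ.< (2 ^ suc k) ^ g) →
      ∃[ k ] k Rounds x ·log n
    combine (q₁ , gq₁≡X) (q₂ , gq₂≡X) (k , below , above) = k ,
      (q₁ , frac< g q₁ x (suc X) gq₁≡X X≤gx , ^ℚ-below g q₁ (suc X) (2 ^ k) 2 n gq₁≡X below) ,
      (q₂ , <frac g q₂ x (5 ℕ.+ X) gq₂≡X gx≤X , ^ℚ-above g q₂ (6 ℕ.+ X) (2 ^ suc k) n gq₂≡X above)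

  lower-mono : ∀ D {X Y} x → X ℕ.≤ Y → LowerBound D Y x → LowerBound D X x
  lower-mono D x X≤Y = mapᴱ (ℚₚ.≤-trans (ι-mono X≤Y))

  -- An approximation of x with error O(1 / log n) determines the rounding:
  -- k is read off the logarithm of a power of n whose exponent lies below x.
  roundable : ∀ x → 0ℝ < x → ∀ n → 2 ℕ.≤ n → ∃[ k ] k Rounds x ·log n
  roundable x x>0 n 2≤n = with-lower (positive⇒lower x x>0)
    where
    with-grid : ∀ g .{{_ : NonZero g}} → 6 ℕ.* suc ⌊log₂ n ⌋ ℕ.≤ g → LowerBound g 6 x →
      ∃[ X ] LowerBound g X x × UpperBound g (3 ℕ.+ X) x → ∃[ k ] k Rounds x ·log n
    with-grid g ≤g 6≤gx (X , X≤gx , gx≤X) with lower≤upper g x 6≤gx gx≤X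
    with-grid g ≤g 6≤gx (suc (suc X) , X≤gx , gx≤X) | _ = round-at x n g X 2≤n ≤g X≤gx gx≤X
    -- The grid was refined until g x ≥ 6, so an upper bound of 3 or 4 is impossible and there is
    -- room to step below `X`.
    with-grid g ≤g 6≤gx (suc zero    , _    , _)    | s≤s (s≤s (s≤s (s≤s ())))
    with-grid g ≤g 6≤gx (zero        , _    , _)    | s≤s (s≤s (s≤s ()))
    with-lower : ∃[ z ] NonZero z × LowerBound z 1 x → ∃[ k ] k Rounds x ·log n
    with-lower (z , z≢0 , 1≤zx) = with-grid g (ℕₚ.m≤m*n (6 ℕ.* suc ℓ) z) 6≤gx (approximate g x x>0)
      where
      ℓ = ⌊log₂ n ⌋
      g = 6 ℕ.* suc ℓ ℕ.* z
      instance
        _ = z≢0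
        g≢0 : NonZero g
        g≢0 = ℕₚ.m*n≢0 (6 ℕ.* suc ℓ) z
      6≤gx : LowerBound g 6 x
      6≤gx = lower-mono g x (ℕₚ.≤-trans (ℕₚ.m≤m*n 6 (suc ℓ)) (ℕₚ.m≤m*n (6 ℕ.* suc ℓ) 1))
        (scale-lower (6 ℕ.* suc ℓ) {z} {1} {x} 1≤zx)

-- Consequences of admissibility, and the space exponent on the grid

module Parameters where
  open import Defs hiding (eq)
  open import Data.Integer.Base as ℤ using (+_; -[1+_])
  import Data.Integer.Properties as ℤₚ
  open import Data.Nat.Base as ℕ using (ℕ; suc; NonZero; z≤n; s≤s; _^_)
  import Data.Nat.Properties as ℕₚ
  open import Data.Product.Base using (∃-syntax; _,_)
  open import Data.Rational.Base as ℚ using (ℚ; mkℚ; 0ℚ; 1ℚ; ½; ↧ₙ_; *<*)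
  import Data.Rational.Properties as ℚₚ
  open import Data.Rational.Solver using (module +-*-Solver)
  open import Relation.Binary.PropositionalEquality
  open Powers
  open Approximation
  open Exponents

  compare : ∀ D {X Y} x y → Eventually (λ n → seq x n ℚ.≤ seq y n) →
            LowerBound D X x → UpperBound D Y y → X ℕ.≤ Y
  compare D x y x≤y X≤Dx Dy≤Y with eventually (x≤y ⊗ X≤Dx ⊗ Dy≤Y)
  ... | n , x≤y , X≤Dx , Dy≤Y = ι-cancel (ℚₚ.≤-trans X≤Dx (ℚₚ.≤-trans (*-mono-ι D x≤y) Dy≤Y))

  lower-+ : ∀ D {X Y} x y → LowerBound D X x → LowerBound D Y y → LowerBound D (X ℕ.+ Y) (x + y)
  lower-+ D {X} {Y} x y X≤Dx Y≤Dy = mapᴱ (λ {n} (X≤ , Y≤) → begin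
    ι (X ℕ.+ Y)                               ≡⟨ ι-+ X Y ⟩
    ι X ℚ.+ ι Y                               ≤⟨ ℚₚ.+-mono-≤ X≤ Y≤ ⟩
    ι D ℚ.* seq x n ℚ.+ ι D ℚ.* seq y n       ≡⟨ ℚₚ.*-distribˡ-+ (ι D) (seq x n) (seq y n) ⟨
    ι D ℚ.* seq (x + y) n                     ∎) (X≤Dx ⊗ Y≤Dy)
    where open ℚₚ.≤-Reasoning

  upper-+ : ∀ D {X Y} x y → UpperBound D X x → UpperBound D Y y → UpperBound D (X ℕ.+ Y) (x + y)
  upper-+ D {X} {Y} x y Dx≤X Dy≤Y = mapᴱ (λ {n} (≤X , ≤Y) → begin
    ι D ℚ.* seq (x + y) n                     ≡⟨ ℚₚ.*-distribˡ-+ (ι D) (seq x n) (seq y n) ⟩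
    ι D ℚ.* seq x n ℚ.+ ι D ℚ.* seq y n       ≤⟨ ℚₚ.+-mono-≤ ≤X ≤Y ⟩
    ι X ℚ.+ ι Y                               ≡⟨ ι-+ X Y ⟨
    ι (X ℕ.+ Y)                               ∎) (Dx≤X ⊗ Dy≤Y)
    where open ℚₚ.≤-Reasoning

  lower-1 : ∀ D → LowerBound D D 1ℝ
  lower-1 D = 0 , λ _ _ → ℚₚ.≤-reflexive (sym (ℚₚ.*-identityʳ (ι D)))

  upper-scale : ∀ w {D Y} x → UpperBound D Y x → UpperBound (w ℕ.* D) (w ℕ.* Y) x
  upper-scale w {D} {Y} x = mapᴱ λ {n} Dx≤Y → begin
    ι (w ℕ.* D) ℚ.* seq x n      ≡⟨ cong (ℚ._* seq x n) (ι-* w D) ⟩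
    ι w ℚ.* ι D ℚ.* seq x n      ≡⟨ ℚₚ.*-assoc (ι w) (ι D) (seq x n) ⟩
    ι w ℚ.* (ι D ℚ.* seq x n)    ≤⟨ *-mono-ι w Dx≤Y ⟩
    ι w ℚ.* ι Y                  ≡⟨ ι-* w Y ⟨
    ι (w ℕ.* Y)                  ∎
    where open ℚₚ.≤-Reasoning

  lower-half : ∀ D {X} x → LowerBound D X x → LowerBound (2 ℕ.* D) X (x * ½ℝ)
  lower-half D {X} x = mapᴱ λ {n} X≤Dx → ℚₚ.≤-trans X≤Dx (ℚₚ.≤-reflexive (begin
    ι D ℚ.* seq x n                      ≡⟨ solve 2 (λ a b → a :* b := con (ι 2) :* a :* (b :* con ½)) refl (ι D) (seq x n) ⟩
    ι 2 ℚ.* ι D ℚ.* (seq x n ℚ.* ½)      ≡⟨ cong (ℚ._* (seq x n ℚ.* ½)) (ι-* 2 D) ⟨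
    ι (2 ℕ.* D) ℚ.* (seq x n ℚ.* ½)      ∎))
    where
    open ≡-Reasoning
    open +-*-Solver

  half-mono : ∀ {p q} → p ℚ.≤ q → p ℚ.* ½ ℚ.≤ q ℚ.* ½
  half-mono = ℚₚ.*-monoʳ-≤-nonNeg ½

  half-pos : ∀ {p} → 0ℚ ℚ.< p → 0ℚ ℚ.< p ℚ.* ½
  half-pos p>0 = ℚₚ.*-monoˡ-<-pos ½ p>0

  q⁺<↧ : ∀ q → q ℚ.< 1ℚ → q⁺ q ℕ.< ↧ₙ q
  q⁺<↧ (mkℚ -[1+ m ] k c) _        = s≤s z≤n
  q⁺<↧ (mkℚ (+ m) k c)    (*<* q<) = ℤₚ.drop‿+<+
    (subst₂ ℤ._<_ (ℤₚ.*-identityʳ (+ m)) (ℤₚ.*-identityˡ (+ suc k)) q<)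

  -- Taking η = δ / 2 leaves the exponent 1 - δ / 2. With a rational 0 < r ≤ δ, the number q = 1 - r
  -- / 4 lies strictly between this and 1. Its denominator is `suc g`, so its numerator is at most
  -- `g`.
  binomial-bound : ∀ c a → Admissible c a → ∃[ g ] ∃[ C₀ ] ∃[ N₀ ] ∀ n → N₀ ℕ.≤ n → 1 ℕ.≤ n →
    ∀ i → binomial c a n i ^ suc g ℕ.≤ C₀ ^ suc g ℕ.* n ^ g
  binomial-bound c a (_ , _ , δ , (r , r>0 , N , r≤δ) , Õ) = combine (Õ (δ * ½ℝ) η>0)
    where
    open +-*-Solver
    r½≤δ½ : ∀ n → N ℕ.≤ n → r ℚ.* ½ ℚ.≤ seq δ n ℚ.* ½
    r½≤δ½ n N≤n = half-mono (ℚₚ.≤-trans (ℚₚ.≤-reflexive (sym (ℚₚ.+-identityˡ r))) (r≤δ n N≤n))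
    η>0 : 0ℝ < δ * ½ℝ
    η>0 = r ℚ.* ½ , half-pos r>0 , N , λ n N≤n →
      ℚₚ.≤-trans (ℚₚ.≤-reflexive (ℚₚ.+-identityˡ _)) (r½≤δ½ n N≤n)
    q = 1ℚ ℚ.- r ℚ.* ½ ℚ.* ½
    below-q : 1ℝ - δ + δ * ½ℝ < fromℚ q
    below-q = r ℚ.* ½ ℚ.* ½ , half-pos (half-pos r>0) , N , λ n N≤n → rearrange (r½≤δ½ n N≤n)
      (solve 2 (λ δ r → con 1ℚ :- δ :+ δ :* con ½ :+ r :* con ½ :* con ½ :+ δ :* con ½ :=
                        con 1ℚ :- r :* con ½ :* con ½ :+ r :* con ½) refl (seq δ n) r)
    q<1 : q ℚ.< 1ℚ
    q<1 = subst (q ℚ.<_) (ℚₚ.+-identityʳ 1ℚ) (ℚₚ.+-monoʳ-< 1ℚ (ℚₚ.neg-antimono-< (half-pos (half-pos r>0))))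
    combine : binomial c a is-O[n^ 1ℝ - δ + δ * ½ℝ ] →
      ∃[ g ] ∃[ C₀ ] ∃[ N₀ ] ∀ n → N₀ ℕ.≤ n → 1 ℕ.≤ n →
      ∀ i → binomial c a n i ^ suc g ℕ.≤ C₀ ^ suc g ℕ.* n ^ g
    combine (C₀ , N₀ , bound) = g , C₀ , N₀ , λ n N₀≤n 1≤n i → begin
      binomial c a n i ^ suc g
        ≤⟨ ℕₚ.m≤m*n _ (n ^ q⁻ q) {{ℕₚ.m^n≢0 n (q⁻ q) {{ℕ.>-nonZero 1≤n}}}} ⟩
      binomial c a n i ^ suc g ℕ.* n ^ q⁻ q
        ≤⟨ bound n N₀≤n i q below-q ⟩
      C₀ ^ suc g ℕ.* n ^ q⁺ q
        ≤⟨ ℕₚ.*-monoʳ-≤ (C₀ ^ suc g) (ℕₚ.^-monoʳ-≤ n {{ℕ.>-nonZero 1≤n}} (ℕₚ.≤-pred (q⁺<↧ q q<1))) ⟩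
      C₀ ^ suc g ℕ.* n ^ g ∎
      where
      open ℕₚ.≤-Reasoning
      g = ℚ.denominator-1 q

  -- Write t for D (α / c) β. Multiplying by D c cancels the quotient: t (D c) = (D α)(D β) ≤ A B ≤
  -- V C ≤ V (D c). So t ≤ V, and D c - t ≥ C - V = R.
  lower-exponent : ∀ D c (c>0 : 0ℝ < c) α β {A B C R V} .{{_ : NonZero C}} →
    LowerBound D C c → UpperBound D A α → LowerBound D 0 β → UpperBound D B β →
    R ℕ.+ V ≡ C → A ℕ.* B ℕ.≤ V ℕ.* C → LowerBound D R (c - _/_[_] α c c>0 * β)
  lower-exponent D c c>0 α β {A} {B} {C} {R} {V} C≤Dc Dα≤A 0≤Dβ Dβ≤B R+V≡C AB≤VC =
    mapᴱ (λ {n} (cancels , C≤ , α≤ , 0≤β , β≤) → bound n cancels C≤ α≤ 0≤β β≤)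
      (quotient-cancel α c c>0 ⊗ C≤Dc ⊗ Dα≤A ⊗ 0≤Dβ ⊗ Dβ≤B)
    where
    open ℚₚ.≤-Reasoning
    open +-*-Solver
    bound : ∀ n → seq (_/_[_] α c c>0) n ℚ.* seq c n ≡ seq α n → ι C ℚ.≤ ι D ℚ.* seq c n →
      ι D ℚ.* seq α n ℚ.≤ ι A → ι 0 ℚ.≤ ι D ℚ.* seq β n → ι D ℚ.* seq β n ℚ.≤ ι B →
      ι R ℚ.≤ ι D ℚ.* seq (c - _/_[_] α c c>0 * β) n
    bound n cancels C≤κ a≤A 0≤b b≤B = rearrange (ℚₚ.+-mono-≤ C≤κ t≤V) (begin-equality
      ι R ℚ.+ (κ ℚ.+ ι V)
        ≡⟨ solve 5 (λ d c s r v → r :+ (d :* c :+ v) := d :* (c :- s) :+ (r :+ v :+ d :* s)) refl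
             (ι D) (seq c n) (x ℚ.* b) (ι R) (ι V) ⟩
      ι D ℚ.* (seq c n ℚ.- x ℚ.* b) ℚ.+ (ι R ℚ.+ ι V ℚ.+ t)
        ≡⟨ cong (λ z → ι D ℚ.* (seq c n ℚ.- x ℚ.* b) ℚ.+ (z ℚ.+ t)) (trans (sym (ι-+ R V)) (cong ι R+V≡C)) ⟩
      ι D ℚ.* (seq c n ℚ.- x ℚ.* b) ℚ.+ (ι C ℚ.+ t) ∎)
      where
      b = seq β n
      x = seq (_/_[_] α c c>0) n
      κ = ι D ℚ.* seq c n
      t = ι D ℚ.* (x ℚ.* b)
      κ>0 : ℚ.Positive κ
      κ>0 = ℚ.positive (ℚₚ.<-≤-trans (ℚₚ.positive⁻¹ (ι C) {{ι-pos C}}) C≤κ)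
      t≤V : t ℚ.≤ ι V
      t≤V = ℚₚ.*-cancelʳ-≤-pos κ {{κ>0}} (begin
        t ℚ.* κ
          ≡⟨ solve 4 (λ d x b c → d :* (x :* b) :* (d :* c) := d :* (x :* c) :* (d :* b)) refl
               (ι D) x b (seq c n) ⟩
        ι D ℚ.* (x ℚ.* seq c n) ℚ.* (ι D ℚ.* b)
          ≡⟨ cong (λ z → ι D ℚ.* z ℚ.* (ι D ℚ.* b)) cancels ⟩
        ι D ℚ.* seq α n ℚ.* (ι D ℚ.* b)
          ≤⟨ ℚₚ.*-monoʳ-≤-nonNeg (ι D ℚ.* b) {{ℚ.nonNegative 0≤b}} a≤A ⟩
        ι A ℚ.* (ι D ℚ.* b)      ≤⟨ *-mono-ι A b≤B ⟩
        ι A ℚ.* ι B              ≡⟨ ι-* A B ⟨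
        ι (A ℕ.* B)              ≤⟨ ι-mono AB≤VC ⟩
        ι (V ℕ.* C)              ≡⟨ ι-* V C ⟩
        ι V ℚ.* ι C              ≤⟨ *-mono-ι V C≤κ ⟩
        ι V ℚ.* κ                ∎)

-- Choice of the integer parameters

module Choosing where
  open import Defs hiding (eq)
  open import Data.Nat.Base as ℕ using (ℕ; suc; NonZero; z≤n; s≤s; _^_)
  open import Data.Nat.DivMod using (_/_; _%_; m≡m%n+[m/n]*n; m%n<n; m/n*n≤m)
  import Data.Nat.Properties as ℕₚ
  open import Data.Nat.Tactic.RingSolver using (solve-∀)
  open import Data.Product.Base using (∃-syntax; _×_; _,_; proj₂)
  open import Data.Rational.Base as ℚ using (ℚ; 0ℚ; 1ℚ; ½)
  import Data.Rational.Properties as ℚₚ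
  open import Data.Rational.Solver using (module +-*-Solver)
  open import Relation.Binary.PropositionalEquality
  open Approximation
  open Exponents
  open Parameters

  -- Certificate for a linear inequality of natural numbers: once the slack `s` is named, a ring
  -- identity remains.
  cancel-slack : ∀ {x y p q} s → x ℕ.≤ y → p ℕ.+ s ℕ.+ y ≡ q ℕ.+ x → p ℕ.≤ q
  cancel-slack {x} {y} {p} {q} s x≤y eq = ℕₚ.≤-trans (ℕₚ.m≤m+n p s)
    (ℕₚ.+-cancelʳ-≤ y (p ℕ.+ s) q (ℕₚ.≤-trans (ℕₚ.≤-reflexive eq) (ℕₚ.+-monoʳ-≤ q x≤y)))

  -- In units of 1 / D, the integers A, B, C, P stand for c₁ - ε, c - 1 - ε, c and a. The hypotheses
  -- render a > c₁ - ε / 2, the identity (c - 1 - ε) + 1 + ε = c, the bound a ≤ c / 2, and the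
  -- fineness of the grid.
  module Integers (A B C P D l : ℕ)
    (A≤P : A ℕ.+ 2 ℕ.* (14 ℕ.+ l) ℕ.≤ 3 ℕ.+ P)
    (B≤C : B ℕ.+ D ℕ.+ 4 ℕ.* (14 ℕ.+ l) ℕ.≤ 3 ℕ.+ C)
    (P≤C : P ℕ.+ P ℕ.≤ 4 ℕ.+ C)
    (C≤Λ² : 15 ℕ.* C ℕ.+ 13 ℕ.≤ (14 ℕ.+ l) ℕ.* (14 ℕ.+ l)) where

    Λ = 14 ℕ.+ l
    K = A ℕ.+ Λ
    M = B ℕ.+ Λ
    -- Ideally M K / C. The 5 absorbs the rounding of the dimension, which is at most (3 + C)(u +
    -- 1), hence below (5 + C) u for large u.
    H = M ℕ.* K / (5 ℕ.+ C)

    K≤P : K ℕ.≤ P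
    K≤P = cancel-slack (11 ℕ.+ l) A≤P (identity A P l)
      where
      identity : ∀ A P l → A ℕ.+ (14 ℕ.+ l) ℕ.+ (11 ℕ.+ l) ℕ.+ (3 ℕ.+ P) ≡ P ℕ.+ (A ℕ.+ 2 ℕ.* (14 ℕ.+ l))
      identity = solve-∀

    K+P+4≤C : K ℕ.+ P ℕ.+ 4 ℕ.≤ C
    K+P+4≤C = cancel-slack (3 ℕ.+ l) (ℕₚ.+-mono-≤ A≤P P≤C) (identity A P C l)
      where
      identity : ∀ A P C l → A ℕ.+ (14 ℕ.+ l) ℕ.+ P ℕ.+ 4 ℕ.+ (3 ℕ.+ l) ℕ.+ (3 ℕ.+ P ℕ.+ (4 ℕ.+ C)) ≡
        C ℕ.+ (A ℕ.+ 2 ℕ.* (14 ℕ.+ l) ℕ.+ (P ℕ.+ P))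
      identity = solve-∀

    D+M≤C : D ℕ.+ M ℕ.≤ C
    D+M≤C = cancel-slack (39 ℕ.+ 3 ℕ.* l) B≤C (identity B C D l)
      where
      identity : ∀ B C D l → D ℕ.+ (B ℕ.+ (14 ℕ.+ l)) ℕ.+ (39 ℕ.+ 3 ℕ.* l) ℕ.+ (3 ℕ.+ C) ≡
        C ℕ.+ (B ℕ.+ D ℕ.+ 4 ℕ.* (14 ℕ.+ l))
      identity = solve-∀

    1≤M : 1 ℕ.≤ M
    1≤M = ℕₚ.≤-trans (s≤s z≤n) (ℕₚ.m≤n+m Λ B)

    H-window : H ℕ.* (5 ℕ.+ C) ℕ.≤ M ℕ.* K
    H-window = m/n*n≤m (M ℕ.* K) (5 ℕ.+ C)

    H≤M : H ℕ.≤ M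
    H≤M = ℕₚ.*-cancelʳ-≤ H M (5 ℕ.+ C) (ℕₚ.≤-trans H-window (ℕₚ.*-monoʳ-≤ M
      (ℕₚ.≤-trans (ℕₚ.m≤m+n K (P ℕ.+ 4)) (ℕₚ.≤-trans (ℕₚ.≤-reflexive (sym (ℕₚ.+-assoc K P 4)))
        (ℕₚ.≤-trans K+P+4≤C (ℕₚ.m≤n+m C 5))))))

    M≤C : M ℕ.≤ C
    M≤C = ℕₚ.≤-trans (ℕₚ.m≤n+m M D) D+M≤C

    MK≤ : M ℕ.* K ℕ.≤ H ℕ.* C ℕ.+ (6 ℕ.* C ℕ.+ 4)
    MK≤ = begin
      M ℕ.* K                                             ≡⟨ m≡m%n+[m/n]*n (M ℕ.* K) (5 ℕ.+ C) ⟩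
      M ℕ.* K % (5 ℕ.+ C) ℕ.+ H ℕ.* (5 ℕ.+ C)             ≤⟨ ℕₚ.+-monoˡ-≤ _ (ℕₚ.≤-pred (m%n<n (M ℕ.* K) (5 ℕ.+ C))) ⟩
      4 ℕ.+ C ℕ.+ H ℕ.* (5 ℕ.+ C)                         ≡⟨ identity₁ H C ⟩
      H ℕ.* C ℕ.+ (5 ℕ.* H ℕ.+ C ℕ.+ 4)                   ≤⟨ ℕₚ.+-monoʳ-≤ (H ℕ.* C) (ℕₚ.+-monoˡ-≤ 4 (ℕₚ.+-monoˡ-≤ C
                                                               (ℕₚ.*-monoʳ-≤ 5 (ℕₚ.≤-trans H≤M M≤C)))) ⟩
      H ℕ.* C ℕ.+ (5 ℕ.* C ℕ.+ C ℕ.+ 4)                   ≡⟨ identity₂ H C ⟩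
      H ℕ.* C ℕ.+ (6 ℕ.* C ℕ.+ 4)                         ∎
      where
      open ℕₚ.≤-Reasoning
      identity₁ : ∀ H C → 4 ℕ.+ C ℕ.+ H ℕ.* (5 ℕ.+ C) ≡ H ℕ.* C ℕ.+ (5 ℕ.* H ℕ.+ C ℕ.+ 4)
      identity₁ = solve-∀
      identity₂ : ∀ H C → H ℕ.* C ℕ.+ (5 ℕ.* C ℕ.+ C ℕ.+ 4) ≡ H ℕ.* C ℕ.+ (6 ℕ.* C ℕ.+ 4)
      identity₂ = solve-∀

    -- In (A + Λ)(B + Λ) the square Λ² pays for 15 C: 6 C for the division by 5 + C with its
    -- rounding, 9 C for the nine units that `V` gives up. The mixed terms pay for the 3 by which A
    -- and B underestimate.
    gain : (3 ℕ.+ A) ℕ.* (3 ℕ.+ B) ℕ.+ 9 ℕ.* C ℕ.≤ H ℕ.* C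
    gain = ℕₚ.+-cancelʳ-≤ (6 ℕ.* C ℕ.+ 4) _ _ (ℕₚ.≤-trans
      (cancel-slack ((11 ℕ.+ l) ℕ.* (A ℕ.+ B)) C≤Λ² (identity A B C l)) MK≤)
      where
      identity : ∀ A B C l →
        (3 ℕ.+ A) ℕ.* (3 ℕ.+ B) ℕ.+ 9 ℕ.* C ℕ.+ (6 ℕ.* C ℕ.+ 4) ℕ.+ (11 ℕ.+ l) ℕ.* (A ℕ.+ B) ℕ.+
          (14 ℕ.+ l) ℕ.* (14 ℕ.+ l) ≡
        (B ℕ.+ (14 ℕ.+ l)) ℕ.* (A ℕ.+ (14 ℕ.+ l)) ℕ.+ (15 ℕ.* C ℕ.+ 13)
      identity = solve-∀

    9≤H : 9 ℕ.≤ H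
    9≤H = ℕₚ.<⇒≤ (ℕₚ.*-cancelʳ-< C 9 H (ℕₚ.<-≤-trans
      (ℕₚ.m<n+m (9 ℕ.* C) {(3 ℕ.+ A) ℕ.* (3 ℕ.+ B)} (s≤s z≤n)) gain))

    -- Nine units are lost in the space: 3 from the upper approximation of c, 2 from two factors
    -- linear in d, and 4 because τ is v^(D-4) instead of v^D.
    V = H ℕ.∸ 9
    R = C ℕ.∸ V

    V≤C : V ℕ.≤ C
    V≤C = ℕₚ.≤-trans (ℕₚ.m∸n≤m H 9) (ℕₚ.≤-trans H≤M M≤C)

    R+V≡C : R ℕ.+ V ≡ C
    R+V≡C = ℕₚ.m∸n+n≡m V≤C

    R+H≡9+C : R ℕ.+ H ≡ C ℕ.+ 9
    R+H≡9+C = begin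
      R ℕ.+ H                ≡⟨ cong (R ℕ.+_) (ℕₚ.m∸n+n≡m 9≤H) ⟨
      R ℕ.+ (V ℕ.+ 9)        ≡⟨ ℕₚ.+-assoc R V 9 ⟨
      R ℕ.+ V ℕ.+ 9          ≡⟨ cong (ℕ._+ 9) R+V≡C ⟩
      C ℕ.+ 9                ∎
      where open ≡-Reasoning

    AB≤VC : (3 ℕ.+ A) ℕ.* (3 ℕ.+ B) ℕ.≤ V ℕ.* C
    AB≤VC = begin
      (3 ℕ.+ A) ℕ.* (3 ℕ.+ B)                                  ≡⟨ ℕₚ.m+n∸n≡m _ (9 ℕ.* C) ⟨
      (3 ℕ.+ A) ℕ.* (3 ℕ.+ B) ℕ.+ 9 ℕ.* C ℕ.∸ 9 ℕ.* C          ≤⟨ ℕₚ.∸-monoˡ-≤ (9 ℕ.* C) gain ⟩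
      H ℕ.* C ℕ.∸ 9 ℕ.* C                                      ≡⟨ ℕₚ.*-distribʳ-∸ C H 9 ⟨
      V ℕ.* C                                                  ∎
      where open ℕₚ.≤-Reasoning

  -- All exponents are multiples of 1 / D: a light vector has at most (K / D) log n ones,
  -- a window has (M / D) log n coordinates and contains at least (H / D) log n
  -- ones of each of its heavy vectors, and the space is n ^ (R / D).
  record Choice (c e : ℝ) : Set where
    field
      a               : ℝ
      a>0             : 0ℝ < a
      g D₁ C₀ N₀      : ℕ
      binomial≤       : ∀ n → N₀ ℕ.≤ n → 1 ℕ.≤ n → ∀ i → binomial c a n i ^ suc g ℕ.≤ C₀ ^ suc g ℕ.* n ^ g
      4≤D₁            : 4 ℕ.≤ D₁
      K M H C P R y   : ℕ
    D : ℕ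
    D = suc g ℕ.* D₁
    field
      c≥C             : LowerBound D C c
      c≤C             : UpperBound D (3 ℕ.+ C) c
      c≤y             : UpperBound 1 y c
      a≥P             : LowerBound D P a
      a≤P             : UpperBound D (3 ℕ.+ P) a
      e≥R             : LowerBound D R e
      K≤P             : K ℕ.≤ P
      K+P+4≤C         : K ℕ.+ P ℕ.+ 4 ℕ.≤ C
      D+M≤C           : D ℕ.+ M ℕ.≤ C
      1≤M             : 1 ℕ.≤ M
      H-window        : H ℕ.* (5 ℕ.+ C) ℕ.≤ M ℕ.* K
      H≤M             : H ℕ.≤ M
      R+H≡9+C         : R ℕ.+ H ≡ C ℕ.+ 9

  module _ (c c₁ ε : ℝ) (1<c : 1ℝ < c) (sup : IsSupremum (Admissible c) c₁)
           (ε>0 : 0ℝ < ε) (ε<c₁ : ε < c₁) (ε<c-1 : ε < c - 1ℝ) where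

    open +-*-Solver

    α β e : ℝ
    α = c₁ - ε
    β = c - 1ℝ - ε
    e = c - _/_[_] α c (1<⇒0< c 1<c) * β

    difference-pos : ∀ x y → x < y → 0ℝ < y - x
    difference-pos x y (q , q>0 , N , x<y) = q , q>0 , N , λ n N≤n → rearrange (x<y n N≤n)
      (solve 3 (λ q x y → con 0ℚ :+ q :+ y := y :- x :+ (x :+ q)) refl q (seq x n) (seq y n))

    shy : c₁ - ε * ½ℝ < c₁
    shy = shy′ ε>0
      where
      shy′ : 0ℝ < ε → c₁ - ε * ½ℝ < c₁
      shy′ (q , q>0 , N , q≤ε) = q ℚ.* ½ , half-pos q>0 , N , λ n N≤n → rearrange (half-mono (q≤ε n N≤n))
        (solve 3 (λ q x y → x :- y :* con ½ :+ q :* con ½ :+ y :* con ½ := x :+ (con 0ℚ :+ q) :* con ½)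
          refl q (seq c₁ n) (seq ε n))

    choice : Choice c e
    -- A single admissible `a` beyond c₁ - ε / 2 is enough. The bound K / D on the ones of light
    -- vectors then fits between c₁ - ε and `a`, with room for roundings on both sides.
    choice = with-admissible (proj₂ sup (c₁ - ε * ½ℝ) shy)
      where
      with-admissible : ∃[ a ] Admissible c a × c₁ - ε * ½ℝ < a → Choice c e
      with-admissible (a , admissible@(a>0 , a≤c/2 , _) , a-large) =
        with-constants (binomial-bound c a admissible) (positive⇒lower ε ε>0) (approximate 1 c (1<⇒0< c 1<c))
        where
        with-constants :
          ∃[ g ] ∃[ C₀ ] ∃[ N₀ ] (∀ n → N₀ ℕ.≤ n → 1 ℕ.≤ n →
            ∀ i → binomial c a n i ^ suc g ℕ.≤ C₀ ^ suc g ℕ.* n ^ g) →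
          ∃[ z ] NonZero z × LowerBound z 1 ε →
          ∃[ y ] LowerBound 1 y c × UpperBound 1 (3 ℕ.+ y) c → Choice c e
        with-constants (g , C₀ , N₀ , binomial≤) (z , z≢0 , ε≥z) (y , _ , c≤y) =
          with-approximations (approximate D α (difference-pos ε c₁ ε<c₁))
            (approximate D β (difference-pos ε (c - 1ℝ) ε<c-1))
            (approximate D c (1<⇒0< c 1<c)) (approximate D a a>0)
          where
          G = suc g
          -- As z ε ≥ 1, the choice D = 4 Λ z G gives D ε ≥ 4 Λ. Then C ≤ D (3 + y) yields 15 C ≤ l
          -- Λ, and Λ = 14 + l makes Λ² larger than 15 C + 13.
          l = 60 ℕ.* z ℕ.* G ℕ.* (3 ℕ.+ y)
          Λ = 14 ℕ.+ l
          D₁ = 4 ℕ.* Λ ℕ.* z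
          D = G ℕ.* D₁
          instance
            _ = z≢0
            D₁≢0 : NonZero D₁
            D₁≢0 = ℕₚ.m*n≢0 (4 ℕ.* Λ) z
            D≢0 : NonZero D
            D≢0 = ℕₚ.m*n≢0 G D₁
          D′ = 2 ℕ.* Λ ℕ.* G ℕ.* z
          D≡2D′ : 2 ℕ.* D′ ≡ D
          D≡2D′ = identity Λ G z
            where
            identity : ∀ L G z → 2 ℕ.* (2 ℕ.* L ℕ.* G ℕ.* z) ≡ G ℕ.* (4 ℕ.* L ℕ.* z)
            identity = solve-∀
          ε≥2Λ : LowerBound D′ (2 ℕ.* Λ) ε
          ε≥2Λ = lower-mono D′ ε (ℕₚ.≤-trans (ℕₚ.m≤m*n (2 ℕ.* Λ) G) (ℕₚ.m≤m*n (2 ℕ.* Λ ℕ.* G) 1))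
            (scale-lower (2 ℕ.* Λ ℕ.* G) {z} {1} {ε} ε≥z)
          ε/2≥2Λ : LowerBound D (2 ℕ.* Λ) (ε * ½ℝ)
          ε/2≥2Λ = subst (λ d → LowerBound d (2 ℕ.* Λ) (ε * ½ℝ)) D≡2D′ (lower-half D′ ε ε≥2Λ)
          ε≥4Λ : LowerBound D (4 ℕ.* Λ) ε
          ε≥4Λ = subst₂ (λ d k → LowerBound d k ε) D≡2D′ (sym (ℕₚ.*-assoc 2 2 Λ))
            (scale-lower 2 {D′} {2 ℕ.* Λ} {ε} ε≥2Λ)
          with-approximations : ∃[ A ] LowerBound D A α × UpperBound D (3 ℕ.+ A) α →
            ∃[ B ] LowerBound D B β × UpperBound D (3 ℕ.+ B) β →
            ∃[ C ] LowerBound D C c × UpperBound D (3 ℕ.+ C) c →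
            ∃[ P ] LowerBound D P a × UpperBound D (3 ℕ.+ P) a → Choice c e
          with-approximations (A , α≥A , α≤A) (B , β≥B , β≤B) (C , c≥C , c≤C) (P , a≥P , a≤P) = record
            { a = a ; a>0 = a>0
            ; g = g ; D₁ = D₁ ; C₀ = C₀ ; N₀ = N₀ ; binomial≤ = binomial≤
            ; 4≤D₁ = ℕₚ.≤-trans (ℕₚ.m≤m*n 4 Λ) (ℕₚ.m≤m*n (4 ℕ.* Λ) z)
            ; K = K ; M = M ; H = H ; C = C ; P = P ; R = R ; y = 3 ℕ.+ y
            ; c≥C = c≥C ; c≤C = c≤C ; c≤y = c≤y ; a≥P = a≥P ; a≤P = a≤P
            ; e≥R = lower-exponent D c (1<⇒0< c 1<c) α β {{C≢0}} c≥C α≤A (lower-mono D β z≤n β≥B) β≤B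
                      R+V≡C AB≤VC
            ; K≤P = K≤P ; K+P+4≤C = K+P+4≤C ; D+M≤C = D+M≤C ; 1≤M = 1≤M
            ; H-window = H-window ; H≤M = H≤M ; R+H≡9+C = R+H≡9+C
            }
            where
            A+2Λ≤3+P : A ℕ.+ 2 ℕ.* Λ ℕ.≤ 3 ℕ.+ P
            A+2Λ≤3+P = compare D (α + ε * ½ℝ) a (below a-large)
              (lower-+ D α (ε * ½ℝ) α≥A ε/2≥2Λ) a≤P
              where
              below : c₁ - ε * ½ℝ < a → Eventually (λ n → seq (α + ε * ½ℝ) n ℚ.≤ seq a n)
              below (q , q>0 , N , h) = N , λ n N≤n →
                ℚₚ.≤-trans (ℚₚ.≤-reflexive (solve 2 (λ c ε → c :- ε :+ ε :* con ½ := c :- ε :* con ½)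
                  refl (seq c₁ n) (seq ε n)))
                  (ℚₚ.≤-trans (p≤p+q _ q>0) (h n N≤n))
            B+D+4Λ≤3+C : B ℕ.+ D ℕ.+ 4 ℕ.* Λ ℕ.≤ 3 ℕ.+ C
            B+D+4Λ≤3+C = compare D (β + 1ℝ + ε) c (0 , λ n _ → ℚₚ.≤-reflexive
                (solve 2 (λ c ε → c :- con 1ℚ :- ε :+ con 1ℚ :+ ε := c) refl (seq c n) (seq ε n)))
              (lower-+ D (β + 1ℝ) ε (lower-+ D β 1ℝ β≥B (lower-1 D)) ε≥4Λ) c≤C
            -- The order a ≤ c / 2 of reals holds only up to a positive rational. Taking 1 / (2 D)
            -- for it turns 3 + C into 4 + C.
            P+P≤4+C : P ℕ.+ P ℕ.≤ 4 ℕ.+ C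
            P+P≤4+C = with-δ (frac 1 D)
              where
              with-δ : ∃[ δ ] ι D ℚ.* δ ≡ ι 1 → P ℕ.+ P ℕ.≤ 4 ℕ.+ C
              with-δ (δ , Dδ≡1) = compare D (a + a) (fromℚ δ + c)
                (mapᴱ (λ {n} a≤ → rearrange (ℚₚ.+-mono-≤ a≤ a≤)
                    (solve 3 (λ a c δ → a :+ a :+ (c :* con ½ :+ δ :* con ½ :+ (c :* con ½ :+ δ :* con ½)) :=
                      δ :+ c :+ (a :+ a)) refl (seq a n) (seq c n) δ))
                  (a≤c/2 (δ ℚ.* ½) (half-pos {δ} (frac-pos {D = D} {δ} (s≤s z≤n) Dδ≡1))))
                (lower-+ D a a a≥P a≥P)
                (upper-+ D (fromℚ δ) c (0 , λ _ _ → ℚₚ.≤-reflexive Dδ≡1) c≤C)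
            C≤Dy : C ℕ.≤ D ℕ.* (3 ℕ.+ y)
            C≤Dy = lower≤upper D c c≥C
              (subst (λ d → UpperBound d (D ℕ.* (3 ℕ.+ y)) c) (ℕₚ.*-identityʳ D) (upper-scale D c c≤y))
            C≤Λ² : 15 ℕ.* C ℕ.+ 13 ℕ.≤ Λ ℕ.* Λ
            C≤Λ² = begin
              15 ℕ.* C ℕ.+ 13                                    ≤⟨ ℕₚ.+-mono-≤ (ℕₚ.*-monoʳ-≤ 15 C≤Dy) (ℕₚ.m≤m+n 13 _) ⟩
              15 ℕ.* (D ℕ.* (3 ℕ.+ y)) ℕ.+ (14 ℕ.* Λ)            ≡⟨ identity Λ G z (3 ℕ.+ y) ⟩
              (14 ℕ.+ l) ℕ.* Λ                                   ∎
              where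
              open ℕₚ.≤-Reasoning
              identity : ∀ L G z y → 15 ℕ.* (G ℕ.* (4 ℕ.* L ℕ.* z) ℕ.* y) ℕ.+ 14 ℕ.* L ≡
                (14 ℕ.+ 60 ℕ.* z ℕ.* G ℕ.* y) ℕ.* L
              identity = solve-∀
            open Integers A B C P D l A+2Λ≤3+P B+D+4Λ≤3+C P+P≤4+C C≤Λ² using
              (K; M; H; R; K≤P; K+P+4≤C; D+M≤C; 1≤M; H-window; H≤M; R+H≡9+C; R+V≡C; AB≤VC; M≤C)
            C≢0 : NonZero C
            C≢0 = ℕ.>-nonZero (ℕₚ.≤-trans 1≤M M≤C)

-- Integer estimates for size and depth

module Estimates where
  open import Data.Nat.Base
  open import Data.Nat.Properties
  open import Data.Nat.Tactic.RingSolver using (solve-∀)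
  open import Relation.Binary.PropositionalEquality
  open Powers
  open ≤-Reasoning

  windowCost : ℕ → ℕ → ℕ → ℕ
  windowCost τ d m = 2 ^ m * (τ * (d + d) + 2 ^ (d ∸ m))

  2^m*2^[d∸m] : ∀ {m d} → m ≤ d → 2 ^ m * 2 ^ (d ∸ m) ≡ 2 ^ d
  2^m*2^[d∸m] {m} {d} m≤d = trans (sym (^-distribˡ-+-* 2 m (d ∸ m))) (cong (2 ^_) (m+[n∸m]≡n m≤d))

  -- Serves addressability, which is required from n = 2 on. `windowCost-fine` saves the factor `τ`
  -- by comparing it with `2 ^ (d ∸ m)`, and is applied beyond a threshold.
  windowCost-crude : ∀ {τ d m} → m ≤ d → 1 ≤ τ → windowCost τ d m ≤ 2 ^ d * (d + d + 1) * τ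
  windowCost-crude {τ} {d} {m} m≤d 1≤τ = begin
    2 ^ m * (τ * (d + d) + x)
      ≤⟨ *-monoʳ-≤ (2 ^ m) (+-mono-≤ (*-monoʳ-≤ τ (m≤n*m (d + d) x {{m^n≢0 2 (d ∸ m)}}))
                                      (m≤n*m x τ {{>-nonZero 1≤τ}})) ⟩
    2 ^ m * (τ * (x * (d + d)) + τ * x)    ≡⟨ regroup (2 ^ m) τ x (d + d) ⟩
    2 ^ m * x * (d + d + 1) * τ            ≡⟨ cong (λ z → z * (d + d + 1) * τ) (2^m*2^[d∸m] m≤d) ⟩
    2 ^ d * (d + d + 1) * τ                ∎
    where
    x = 2 ^ (d ∸ m)
    regroup : ∀ p t x e → p * (t * (x * e) + t * x) ≡ p * x * (e + 1) * t
    regroup = solve-∀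

  windowCost-fine : ∀ {τ d m} → m ≤ d → τ ≤ 2 ^ (d ∸ m) → windowCost τ d m ≤ 2 ^ d * (d + d + 1)
  windowCost-fine {τ} {d} {m} m≤d τ≤ = begin
    2 ^ m * (τ * (d + d) + x)              ≤⟨ *-monoʳ-≤ (2 ^ m) (+-monoˡ-≤ x (*-monoˡ-≤ (d + d) τ≤)) ⟩
    2 ^ m * (x * (d + d) + x)              ≡⟨ regroup (2 ^ m) x (d + d) ⟩
    2 ^ m * x * (d + d + 1)                ≡⟨ cong (_* (d + d + 1)) (2^m*2^[d∸m] m≤d) ⟩
    2 ^ d * (d + d + 1)                    ∎
    where
    x = 2 ^ (d ∸ m)
    regroup : ∀ p x e → p * (x * e + x) ≡ p * x * (e + 1)
    regroup = solve-∀

  size-crude : ∀ {s n d τ h m} → m ≤ d → 1 ≤ τ →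
    s * (τ * 2 ^ h) ≤ n * (d * windowCost τ d m + d * (τ * 2 ^ h)) →
    s ≤ n * (d * (2 ^ d * (d + d + 1)) + d)
  size-crude {s} {n} {d} {τ} {h} {m} m≤d 1≤τ bound =
    *-cancelʳ-≤ s _ E {{m*n≢0 τ (2 ^ h) {{>-nonZero 1≤τ}} {{m^n≢0 2 h}}}} (begin
    s * E                                       ≤⟨ bound ⟩
    n * (d * windowCost τ d m + d * E)          ≤⟨ *-monoʳ-≤ n (+-monoˡ-≤ (d * E) (*-monoʳ-≤ d
                                                     (≤-trans (windowCost-crude {τ} {d} {m} m≤d 1≤τ)
                                                       (*-monoʳ-≤ x (m≤m*n τ (2 ^ h) {{m^n≢0 2 h}}))))) ⟩
    n * (d * (x * E) + d * E)                   ≡⟨ regroup n d x E ⟩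
    n * (d * x + d) * E                         ∎)
    where
    E = τ * 2 ^ h
    x = 2 ^ d * (d + d + 1)
    regroup : ∀ n d x e → n * (d * (x * e) + d * e) ≡ n * (d * x + d) * e
    regroup = solve-∀

  total-crude : ∀ {s n d} → 1 ≤ n → s ≤ n * (d * (2 ^ d * (d + d + 1)) + d) →
    2 + 3 * s + d ≤ 2 ^ 4 * n * 2 ^ (3 * d)
  total-crude {s} {n} {d} 1≤n s≤ = begin
    2 + 3 * s + d                    ≤⟨ +-mono-≤ (+-monoʳ-≤ 2 (*-monoʳ-≤ 3 s≤4t)) d≤t ⟩
    2 + 3 * (4 * t) + t              ≤⟨ +-monoˡ-≤ t (+-monoˡ-≤ (3 * (4 * t)) (*-monoʳ-≤ 2 1≤t)) ⟩
    2 * t + 3 * (4 * t) + t          ≤⟨ m≤m+n _ t ⟩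
    2 * t + 3 * (4 * t) + t + t      ≡⟨ regroup n x ⟩
    16 * n * (x * (x * x))           ≡⟨ cong (16 * n *_) cube ⟩
    2 ^ 4 * n * 2 ^ (3 * d)          ∎
    where
    x = 2 ^ d
    t = n * (x * (x * x))
    instance
      _ = >-nonZero 1≤n
      x≢0 : NonZero x
      x≢0 = m^n≢0 2 d
      xx≢0 : NonZero (x * x)
      xx≢0 = m*n≢0 x x
    1≤x : 1 ≤ x
    1≤x = m^n>0 2 d
    1≤t : 1 ≤ t
    1≤t = >-nonZero⁻¹ t {{m*n≢0 n (x * (x * x)) {{>-nonZero 1≤n}} {{m*n≢0 x (x * x)}}}}
    d≤x : d ≤ x
    d≤x = <⇒≤ (n<2^n d)
    x≤xxx : x ≤ x * (x * x)
    x≤xxx = m≤m*n x (x * x)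
    d≤t : d ≤ t
    d≤t = ≤-trans d≤x (≤-trans x≤xxx (m≤n*m (x * (x * x)) n))
    s≤4t : s ≤ 4 * t
    s≤4t = begin
      s                                          ≤⟨ s≤ ⟩
      n * (d * (x * (d + d + 1)) + d)
        ≤⟨ *-monoʳ-≤ n (+-mono-≤ (*-mono-≤ d≤x (*-monoʳ-≤ x (+-mono-≤ (+-mono-≤ d≤x d≤x) 1≤x)))
                                  (≤-trans d≤x x≤xxx)) ⟩
      n * (x * (x * (x + x + x)) + x * (x * x))  ≡⟨ regroup′ n x ⟩
      4 * t                                      ∎
      where
      regroup′ : ∀ n x → n * (x * (x * (x + x + x)) + x * (x * x)) ≡ 4 * (n * (x * (x * x)))
      regroup′ = solve-∀
    regroup : ∀ n x → 2 * (n * (x * (x * x))) + 3 * (4 * (n * (x * (x * x)))) + n * (x * (x * x)) +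
      n * (x * (x * x)) ≡ 16 * n * (x * (x * x))
    regroup = solve-∀
    cube : x * (x * x) ≡ 2 ^ (3 * d)
    cube = trans (cong (x *_) (sym (^-distribˡ-+-* 2 d d))) (trans (sym (^-distribˡ-+-* 2 d (d + d)))
      (cong (2 ^_) (cong (d +_) (cong (d +_) (sym (+-identityʳ d))))))

  -- Origin of the word size: as ℓ ≥ 1, additive constants and ℓ + 1 are multiples of ℓ up to
  -- rounding up.
  words-fit : ∀ {n d ℓ y} → 1 ≤ ℓ → n ≤ 2 ^ suc ℓ → d ≤ y * suc ℓ →
    2 ^ 4 * n * 2 ^ (3 * d) ≤ 2 ^ ((6 + 6 * y) * ℓ)
  words-fit {n} {d} {ℓ} {y} 1≤ℓ n≤ d≤ = begin
    2 ^ 4 * n * 2 ^ (3 * d)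
      ≤⟨ *-mono-≤ (*-monoʳ-≤ (2 ^ 4) n≤) (^-monoʳ-≤ 2 (*-monoʳ-≤ 3 d≤)) ⟩
    2 ^ 4 * 2 ^ suc ℓ * 2 ^ (3 * (y * suc ℓ))
      ≡⟨ cong (_* 2 ^ (3 * (y * suc ℓ))) (^-distribˡ-+-* 2 4 (suc ℓ)) ⟨
    2 ^ (4 + suc ℓ) * 2 ^ (3 * (y * suc ℓ))
      ≡⟨ ^-distribˡ-+-* 2 (4 + suc ℓ) (3 * (y * suc ℓ)) ⟨
    2 ^ (4 + suc ℓ + 3 * (y * suc ℓ))
      ≤⟨ ^-monoʳ-≤ 2 (+-mono-≤ (+-mono-≤ (*-monoʳ-≤ 4 1≤ℓ) 1+ℓ≤) (*-monoʳ-≤ 3 (*-monoʳ-≤ y 1+ℓ≤))) ⟩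
    2 ^ (4 * ℓ + (ℓ + ℓ) + 3 * (y * (ℓ + ℓ)))
      ≡⟨ cong (2 ^_) (regroup y ℓ) ⟩
    2 ^ ((6 + 6 * y) * ℓ) ∎
    where
    1+ℓ≤ : suc ℓ ≤ ℓ + ℓ
    1+ℓ≤ = +-monoˡ-≤ ℓ 1≤ℓ
    regroup : ∀ y l → 4 * l + (l + l) + 3 * (y * (l + l)) ≡ (6 + 6 * y) * l
    regroup = solve-∀

  -- Divides the averaging inequality by the window length; d ≤ (5 + C) u meets the 5 + C in the
  -- definition of H.
  light≤ : ∀ {m W d h K M H C u} → m ≡ M * u → h ≡ H * u → 1 ≤ M → 1 ≤ u →
    m * W ≤ d * h → d ≤ (3 + C) * suc u → 3 + C ≤ u → H * (5 + C) ≤ M * K → W ≤ K * u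
  light≤ {W = W} {d} {K = K} {M} {H} {C} {u} refl refl 1≤M 1≤u mW≤dh d≤ 3+C≤u window =
    *-cancelˡ-≤ (M * u) {{m*n≢0 M u {{>-nonZero 1≤M}} {{>-nonZero 1≤u}}}} (begin
      M * u * W                            ≤⟨ mW≤dh ⟩
      d * (H * u)                          ≤⟨ *-monoˡ-≤ (H * u) d≤ ⟩
      (3 + C) * suc u * (H * u)            ≤⟨ *-monoˡ-≤ (H * u) (≤-reflexive (*-suc (3 + C) u)) ⟩
      (3 + C + (3 + C) * u) * (H * u)      ≤⟨ *-monoˡ-≤ (H * u) (+-monoˡ-≤ _ 3+C≤u) ⟩
      (u + (3 + C) * u) * (H * u)          ≤⟨ *-monoˡ-≤ (H * u) (m≤n+m _ u) ⟩
      (u + (u + (3 + C) * u)) * (H * u)    ≡⟨ regroup u C H ⟩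
      H * (5 + C) * (u * u)                ≤⟨ *-monoˡ-≤ (u * u) window ⟩
      M * K * (u * u)                      ≡⟨ [m*n]*[o*p]≡[m*o]*[n*p] M K u u ⟩
      M * u * (K * u)                      ∎)
    where
    regroup : ∀ u C H → (u + (u + (3 + C) * u)) * (H * u) ≡ H * (5 + C) * (u * u)
    regroup = solve-∀

  k+k′≤d : ∀ {k′ d K P C u} → k′ ≤ (3 + P) * suc u → 3 + P ≤ u → K + P + 4 ≤ C → C * u ≤ d →
    K * u + k′ ≤ d
  k+k′≤d {k′} {d} {K} {P} {C} {u} k′≤ 3+P≤u K+P+4≤C Cu≤d = begin
    K * u + k′                             ≤⟨ +-monoʳ-≤ (K * u) k′≤ ⟩
    K * u + (3 + P) * suc u                ≡⟨ cong (K * u +_) (*-suc (3 + P) u) ⟩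
    K * u + (3 + P + (3 + P) * u)          ≤⟨ +-monoʳ-≤ (K * u) (+-monoˡ-≤ _ 3+P≤u) ⟩
    K * u + (u + (3 + P) * u)              ≡⟨ regroup K P u ⟩
    (K + P + 4) * u                        ≤⟨ *-monoˡ-≤ u K+P+4≤C ⟩
    C * u                                  ≤⟨ Cu≤d ⟩
    d                                      ∎
    where
    regroup : ∀ K P u → K * u + (u + (3 + P) * u) ≡ (K + P + 4) * u
    regroup = solve-∀

  binomial-power : ∀ {x g C₀ n D₁ u} → x ^ suc g ≤ C₀ ^ suc g * n ^ g → n ≤ 2 ^ (suc g * D₁ * suc u) →
    x ≤ C₀ * 2 ^ (g * D₁ * suc u)
  binomial-power {x} {g} {C₀} {n} {D₁} {u} x^G≤ n≤ = ^-cancelˡ-≤ x _ (suc g) (begin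
    x ^ suc g                                        ≤⟨ x^G≤ ⟩
    C₀ ^ suc g * n ^ g                               ≤⟨ *-monoʳ-≤ (C₀ ^ suc g) (^-monoˡ-≤ g n≤) ⟩
    C₀ ^ suc g * (2 ^ (suc g * D₁ * suc u)) ^ g      ≡⟨ cong (C₀ ^ suc g *_) power ⟩
    C₀ ^ suc g * (2 ^ (g * D₁ * suc u)) ^ suc g      ≡⟨ ^-distribʳ-* C₀ _ (suc g) ⟨
    (C₀ * 2 ^ (g * D₁ * suc u)) ^ suc g              ∎)
    where
    regroup : ∀ g D u → suc g * D * suc u * g ≡ g * D * suc u * suc g
    regroup = solve-∀
    power : (2 ^ (suc g * D₁ * suc u)) ^ g ≡ (2 ^ (g * D₁ * suc u)) ^ suc g
    power = trans (^-*-assoc 2 (suc g * D₁ * suc u) g)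
      (trans (cong (2 ^_) (regroup g D₁ u)) (sym (^-*-assoc 2 (g * D₁ * suc u) (suc g))))

  2^[a*suc-u] : ∀ a u → 2 ^ (a * suc u) ≡ 2 ^ a * (2 ^ u) ^ a
  2^[a*suc-u] a u = trans (cong (2 ^_) (*-suc a u)) (trans (^-distribˡ-+-* 2 a (a * u))
    (cong (2 ^ a *_) (trans (cong (2 ^_) (*-comm a u)) (sym (^-*-assoc 2 u a)))))

  -- Factors linear in log n are bounded by multiples of v. The trees cost d² τ, of order v^(D-2),
  -- where D = D₁ + E; the light vectors cost v^(E+2). Both are within v^(D-1) because D₁ is at
  -- least 4.
  time-bound : ∀ {depth d r τ c₃ K C₀ D₁ E v} → 1 ≤ v → 4 ≤ D₁ →
    depth ≤ d * (suc τ * d) + r * d → τ ≡ v ^ (D₁ + E ∸ 4) → d ≤ c₃ * v →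
    r ≤ (suc K * v) * (C₀ * (2 ^ E * v ^ E)) →
    2 + (9 * depth + 4) ≤ (6 + 9 * (2 * c₃ * c₃ + suc K * (C₀ * 2 ^ E) * c₃)) * v ^ (D₁ + E ∸ 1)
  time-bound {depth} {d} {r} {τ} {c₃} {K} {C₀} {D₁} {E} {v} 1≤v 4≤D₁ depth≤ τ≡ d≤ r≤ = begin
    2 + (9 * depth + 4)                  ≡⟨ regroup₀ depth ⟩
    6 + 9 * depth                        ≤⟨ +-mono-≤ (m≤m*n 6 Z {{Z≢0}}) (*-monoʳ-≤ 9 (≤-trans depth≤ (+-mono-≤ first second))) ⟩
    6 * Z + 9 * (c₁ * Z + c₂ * Z)        ≡⟨ regroup c₁ c₂ Z ⟩
    (6 + 9 * (c₁ + c₂)) * Z              ∎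
    where
    instance
      v≢0 : NonZero v
      v≢0 = >-nonZero 1≤v
    Z = v ^ (D₁ + E ∸ 1)
    Z≢0 : NonZero Z
    Z≢0 = m^n≢0 v (D₁ + E ∸ 1)
    c₁ = 2 * c₃ * c₃
    c₂ = suc K * (C₀ * 2 ^ E) * c₃
    regroup₀ : ∀ x → 2 + (9 * x + 4) ≡ 6 + 9 * x
    regroup₀ = solve-∀
    regroup : ∀ a b z → 6 * z + 9 * (a * z + b * z) ≡ (6 + 9 * (a + b)) * z
    regroup = solve-∀
    4≤D : 4 ≤ D₁ + E
    4≤D = ≤-trans 4≤D₁ (m≤m+n D₁ E)
    1≤τ : 1 ≤ τ
    1≤τ = subst (1 ≤_) (sym τ≡) (m^n>0 v (D₁ + E ∸ 4))
    first : d * (suc τ * d) ≤ c₁ * Z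
    first = begin
      d * (suc τ * d)                        ≤⟨ *-mono-≤ d≤ (*-mono-≤ (+-monoˡ-≤ τ 1≤τ) d≤) ⟩
      c₃ * v * ((τ + τ) * (c₃ * v))          ≡⟨ regroup₁ c₃ v τ ⟩
      c₁ * (v * (v * τ))                     ≡⟨ cong (λ z → c₁ * (v * (v * z))) τ≡ ⟩
      c₁ * v ^ (2 + (D₁ + E ∸ 4))            ≤⟨ *-monoʳ-≤ c₁ (^-monoʳ-≤ v exponent) ⟩
      c₁ * Z                                 ∎
      where
      regroup₁ : ∀ c v t → c * v * ((t + t) * (c * v)) ≡ 2 * c * c * (v * (v * t))
      regroup₁ = solve-∀
      exponent : 2 + (D₁ + E ∸ 4) ≤ D₁ + E ∸ 1
      exponent = ≤-trans (n≤1+n _) (≤-reflexive (sym (+-∸-assoc 3 4≤D)))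
    second : r * d ≤ c₂ * Z
    second = begin
      r * d                                                      ≤⟨ *-mono-≤ r≤ d≤ ⟩
      suc K * v * (C₀ * (2 ^ E * v ^ E)) * (c₃ * v)              ≡⟨ regroup₂ (suc K) v C₀ (2 ^ E) (v ^ E) c₃ ⟩
      c₂ * (v * (v * v ^ E))                                     ≤⟨ *-monoʳ-≤ c₂ (^-monoʳ-≤ v exponent) ⟩
      c₂ * Z                                                     ∎
      where
      regroup₂ : ∀ k v c p w c₃ → k * v * (c * (p * w)) * (c₃ * v) ≡ k * (c * p) * c₃ * (v * (v * w))
      regroup₂ = solve-∀
      exponent : 2 + E ≤ D₁ + E ∸ 1
      exponent = ∸-monoˡ-≤ 1 (+-monoˡ-≤ E (≤-trans (n≤1+n 3) 4≤D₁))

  space-bound : ∀ {s n d τ m h c₃ D C R H v u} → 1 ≤ v → 4 ≤ D → c₃ ≡ 3 + C → R + H ≡ C + 9 → D + H ≤ C →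
    s * (τ * 2 ^ h) ≤ n * (d * windowCost τ d m + d * (τ * 2 ^ h)) →
    m ≤ d → τ ≤ 2 ^ (d ∸ m) → τ ≡ v ^ (D ∸ 4) → 2 ^ h ≡ v ^ H → v ≡ 2 ^ u →
    n ≤ 2 ^ D * v ^ D → d ≤ c₃ * suc u → d ≤ c₃ * v →
    2 + 3 * s ≤ (2 + 3 * (2 ^ D * c₃ * 2 ^ c₃ * (c₃ + c₃ + 1) + 2 ^ D * c₃)) * v ^ R
  space-bound {s} {n} {d} {τ} {m} {h} {c₃} {D} {C} {R} {H} {v} {u}
    1≤v 4≤D c₃≡ R+H D+H≤C bound m≤d τ≤ τ≡ 2^h≡ v≡ n≤ d≤u d≤v = begin
    2 + 3 * s                      ≤⟨ +-mono-≤ (m≤m*n 2 (v ^ R) {{m^n≢0 v R}}) (*-monoʳ-≤ 3 s≤) ⟩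
    2 * v ^ R + 3 * ((c₁ + c₂) * v ^ R)  ≡⟨ regroup (c₁ + c₂) (v ^ R) ⟩
    (2 + 3 * (c₁ + c₂)) * v ^ R    ∎
    where
    instance
      v≢0 : NonZero v
      v≢0 = >-nonZero 1≤v
    c₁ = 2 ^ D * c₃ * 2 ^ c₃ * (c₃ + c₃ + 1)
    c₂ = 2 ^ D * c₃
    E = τ * 2 ^ h
    regroup : ∀ c z → 2 * z + 3 * (c * z) ≡ (2 + 3 * c) * z
    regroup = solve-∀
    E≡ : E ≡ v ^ (D ∸ 4 + H)
    E≡ = trans (cong₂ _*_ τ≡ 2^h≡) (sym (^-distribˡ-+-* v (D ∸ 4) H))
    E≢0 : NonZero E
    E≢0 = subst NonZero (sym E≡) (m^n≢0 v (D ∸ 4 + H))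
    2^d≤ : 2 ^ d ≤ 2 ^ c₃ * v ^ c₃
    2^d≤ = ≤-trans (^-monoʳ-≤ 2 d≤u) (≤-reflexive
      (trans (2^[a*suc-u] c₃ u) (cong (λ z → 2 ^ c₃ * z ^ c₃) (sym v≡))))
    1+d≤ : d + d + 1 ≤ (c₃ + c₃ + 1) * v
    1+d≤ = ≤-trans (+-mono-≤ (+-mono-≤ d≤v d≤v) 1≤v) (≤-reflexive (distribute c₃ v))
      where
      distribute : ∀ c v → c * v + c * v + v ≡ (c + c + 1) * v
      distribute = solve-∀
    -- On the left n, 2^d and two factors linear in d; on the right the claimed space times τ 2^h.
    -- This equation is what R + H = C + 9 encodes.
    exponents : D + c₃ + 2 ≡ R + (D ∸ 4 + H)
    exponents = trans (cong (λ z → D + z + 2) c₃≡) (trans (cong (λ z → z + (3 + C) + 2) (sym (m+[n∸m]≡n 4≤D)))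
      (trans (collect C (D ∸ 4)) (trans (cong (_+ (D ∸ 4)) (sym R+H)) (swap R H (D ∸ 4)))))
      where
      collect : ∀ C x → 4 + x + (3 + C) + 2 ≡ C + 9 + x
      collect = solve-∀
      swap : ∀ R H x → R + H + x ≡ R + (x + H)
      swap = solve-∀
    -- The scan of the light vectors takes about n d nodes, that is v^(D+1); it fits since H leaves
    -- at least D units of C.
    D+1≤R : D + 1 ≤ R
    D+1≤R = +-cancelʳ-≤ H (D + 1) R (begin
      D + 1 + H        ≡⟨ shift D H ⟩
      D + H + 1        ≤⟨ +-mono-≤ D+H≤C (s≤s z≤n) ⟩
      C + 9            ≡⟨ R+H ⟨
      R + H            ∎)
      where
      shift : ∀ D H → D + 1 + H ≡ D + H + 1
      shift = solve-∀
    first : n * (d * windowCost τ d m) ≤ c₁ * v ^ R * E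
    first = begin
      n * (d * windowCost τ d m)
        ≤⟨ *-mono-≤ n≤ (*-mono-≤ d≤v (≤-trans (windowCost-fine {τ} {d} {m} m≤d τ≤) (*-mono-≤ 2^d≤ 1+d≤))) ⟩
      2 ^ D * v ^ D * (c₃ * v * (2 ^ c₃ * v ^ c₃ * ((c₃ + c₃ + 1) * v)))
        ≡⟨ collect (2 ^ D) (v ^ D) c₃ v (2 ^ c₃) (v ^ c₃) (c₃ + c₃ + 1) ⟩
      c₁ * (v ^ D * v ^ c₃ * (v * (v * 1)))
        ≡⟨ cong (c₁ *_) (trans (cong (_* v ^ 2) (sym (^-distribˡ-+-* v D c₃))) (sym (^-distribˡ-+-* v (D + c₃) 2))) ⟩
      c₁ * v ^ (D + c₃ + 2)
        ≡⟨ cong (λ z → c₁ * v ^ z) exponents ⟩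
      c₁ * v ^ (R + (D ∸ 4 + H))
        ≡⟨ cong (c₁ *_) (^-distribˡ-+-* v R (D ∸ 4 + H)) ⟩
      c₁ * (v ^ R * v ^ (D ∸ 4 + H))
        ≡⟨ trans (sym (*-assoc c₁ (v ^ R) _)) (cong (c₁ * v ^ R *_) (sym E≡)) ⟩
      c₁ * v ^ R * E ∎
      where
      collect : ∀ p q c v r s e → p * q * (c * v * (r * s * (e * v))) ≡ p * c * r * e * (q * s * (v * (v * 1)))
      collect = solve-∀
    second : n * (d * E) ≤ c₂ * v ^ R * E
    second = begin
      n * (d * E)                        ≤⟨ *-mono-≤ n≤ (*-monoˡ-≤ E d≤v) ⟩
      2 ^ D * v ^ D * (c₃ * v * E)       ≡⟨ collect (2 ^ D) (v ^ D) c₃ v E ⟩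
      c₂ * (v ^ D * (v * 1)) * E         ≡⟨ cong (λ z → c₂ * z * E) (^-distribˡ-+-* v D 1) ⟨
      c₂ * v ^ (D + 1) * E               ≤⟨ *-monoˡ-≤ E (*-monoʳ-≤ c₂ (^-monoʳ-≤ v D+1≤R)) ⟩
      c₂ * v ^ R * E                     ∎
      where
      collect : ∀ p q c v e → p * q * (c * v * e) ≡ p * c * (q * (v * 1)) * e
      collect = solve-∀
    s≤ : s ≤ (c₁ + c₂) * v ^ R
    s≤ = *-cancelʳ-≤ s _ E {{E≢0}} (begin
      s * E                                              ≤⟨ bound ⟩
      n * (d * windowCost τ d m + d * E)                 ≡⟨ *-distribˡ-+ n _ (d * E) ⟩
      n * (d * windowCost τ d m) + n * (d * E)           ≤⟨ +-mono-≤ first second ⟩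
      c₁ * v ^ R * E + c₂ * v ^ R * E                    ≡⟨ distribute c₁ c₂ (v ^ R) E ⟩
      (c₁ + c₂) * v ^ R * E                              ∎)
      where
      distribute : ∀ a b z e → a * z * e + b * z * e ≡ (a + b) * z * e
      distribute = solve-∀

-- The data structure and its bounds

module Construction where
  open import Defs hiding (eq; _<_; _≤_; _+_; _*_)
  open import Data.Bool.Base using (Bool; true; false; T; not; _∧_)
  open import Data.Bool.ListAction using (any)
  open import Data.Fin.Base using (Fin)
  open import Data.List.Base using (List; []; _∷_; length; allFin; take)
  open import Data.List.Properties using (length-tabulate)
  open import Data.List.Relation.Unary.All as All using (All; []; _∷_)
  import Data.List.Relation.Unary.All.Properties as Allₚ
  open import Data.List.Relation.Unary.AllPairs using ([]; _∷_)
  open import Data.List.Relation.Unary.Any as Any using (Any)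
  import Data.List.Relation.Unary.Any.Properties as Anyₚ
  import Data.List.Relation.Unary.Unique.Propositional as List
  open import Data.Nat.Base
  open import Data.Nat.Logarithm using (⌊log₂_⌋; ⌊log₂⌋-mono-≤)
  open import Data.Nat.Properties
  open import Data.Product.Base using (∃-syntax; _×_; _,_)
  open import Data.Rational.Base as ℚ using (1ℚ)
  import Data.Rational.Properties as ℚₚ
  open import Data.Rational.Solver using (module +-*-Solver)
  open import Data.Vec.Base using (Vec; toList; lookup)
  open import Data.Vec.Properties using (length-toList)
  import Data.Vec.Relation.Unary.All.Properties as VecAllₚ
  import Data.Vec.Relation.Unary.AllPairs as VecAllPairs
  import Data.Vec.Relation.Unary.Any as VecAny
  import Data.Vec.Relation.Unary.Any.Properties as VecAnyₚ
  open import Data.Vec.Relation.Unary.Unique.Propositional using (Unique)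
  open import Function.Base using (id)
  open import Function.Bundles using (_⇔_; mk⇔)
  open import Relation.Binary.PropositionalEquality
  open Fragments
  open Windows
  open Machine
  open Powers
  open Approximation using (ι; LowerBound; frac; frac-pos; rearrange; ι-+)
  open Exponents
  open Estimates
  open Choosing using (Choice)

  toList-unique : ∀ {A : Set} {n} {xs : Vec A n} → Unique xs → List.Unique (toList xs)
  toList-unique VecAllPairs.[]       = []
  toList-unique (p VecAllPairs.∷ ps) = VecAllₚ.toList⁺ p ∷ toList-unique ps

  private variable
    d : ℕ

  orth-sound : (v s : Vec Bool d) → T (orth (allFin d) v s) → Orthogonal v s
  orth-sound v s t i (v≡ , s≡) =
    subst T (cong₂ (λ a b → not (a ∧ b)) s≡ v≡) (Allₚ.tabulate⁻ (Allₚ.all⁺ _ (allFin _) t) i)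

  orth-complete : (v s : Vec Bool d) → Orthogonal v s → T (orth (allFin d) v s)
  orth-complete v s o = Allₚ.all⁻ _ (Allₚ.tabulate⁺ λ i → disjoint (lookup s i) (lookup v i) (λ p q → o i (q , p)))
    where
    disjoint : ∀ a b → (a ≡ true → b ≡ true → T false) → T (not (a ∧ b))
    disjoint false b     _ = _
    disjoint true  false _ = _
    disjoint true  true  f = f refl refl

  any-orth : ∀ {n} (v : Vec Bool d) (S : Vec (Vec Bool d) n) →
             T (any (orth (allFin d) v) (toList S)) ⇔ VecAny.Any (Orthogonal v) S
  any-orth v S = mk⇔
    (λ t → VecAnyₚ.toList⁻ (Any.map (λ {s} → orth-sound v s) (Anyₚ.any⁻ _ (toList S) t)))
    (λ a → Anyₚ.any⁺ _ (Any.map (λ {s} → orth-complete v s) (VecAnyₚ.toList⁺ a)))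

  module _ {c e : ℝ} (choice : Choice c e) where
    open Choice choice hiding (e≥R)

    instance
      D≢0 : NonZero D
      D≢0 = m*n≢0 (suc g) D₁ {{_}} {{>-nonZero (≤-trans (s≤s z≤n) 4≤D₁)}}

    open Scale D

    4≤D : 4 ≤ D
    4≤D = ≤-trans 4≤D₁ (m≤m+n D₁ _)

    module _ {n : ℕ} (S : Instance c n) where

      u v τ h m : ℕ
      u = unit n
      v = 2 ^ u
      τ = v ^ (D ∸ 4)
      h = H * u
      -- The minimum makes m ≤ d hold by construction; for large n it is attained by `M * u`.
      m = (M * u) ⊓ dim S

      coordinates : List (Fin (dim S))
      coordinates = allFin (dim S)

      orders : List (List (Fin (dim S)))
      orders = rotations (dim S) coordinates

      fragment : Frag (dim S)
      fragment = build τ h m coordinates orders (toList (vectors S))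

      light : List (Vec Bool (dim S))
      light = remainder τ h m orders (toList (vectors S))

      1≤v : 1 ≤ v
      1≤v = m^n>0 2 u

      1≤τ : 1 ≤ τ
      1≤τ = m^n>0 v {{m^n≢0 2 u}} (D ∸ 4)

      m≤d : m ≤ dim S
      m≤d = m⊓n≤n (M * u) (dim S)

      length-coordinates : length coordinates ≡ dim S
      length-coordinates = length-tabulate id

      length-orders : All (λ y → length y ≡ dim S) orders
      length-orders = all-rotations (λ {xs} eq → trans (length-rotate xs) eq) (dim S) length-coordinates

      eval-fragment : ∀ q → eval fragment q ≡ any (orth coordinates q) (toList (vectors S))
      eval-fragment q = eval-build τ h m coordinates q
        (all-rotations (λ {xs} eq s → trans (all-rotate _ xs) (eq s)) (dim S) (λ _ → refl)) _

      size-fragment : size fragment * (τ * 2 ^ h) ≤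
        n * (dim S * windowCost τ (dim S) m + dim S * (τ * 2 ^ h))
      size-fragment = subst₂ (λ x y → size fragment * (τ * 2 ^ h) ≤
          x * (y * windowCost τ (dim S) m + dim S * (τ * 2 ^ h)))
        (length-toList (vectors S)) (length-rotations (dim S) coordinates)
        (size-build τ h m coordinates m≤d length-coordinates length-orders (toList (vectors S)))

      depth-fragment : depth fragment ≤ dim S * (suc τ * dim S) + length light * dim S
      depth-fragment = subst (λ x → depth fragment ≤ x * (suc τ * dim S) + length light * dim S)
        (length-rotations (dim S) coordinates)
        (depth-build τ h m coordinates m≤d length-coordinates length-orders (toList (vectors S)))

    wordSize : ℕ → ℕ
    wordSize n = (6 + 6 * y) * ⌊log₂ n ⌋

    1≤log : ∀ {n} → 2 ≤ n → 1 ≤ ⌊log₂ n ⌋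
    1≤log 2≤n = ⌊log₂⌋-mono-≤ 2≤n

    1<words : ∀ {n} → 2 ≤ n → 1 < 2 ^ wordSize n
    1<words {n} 2≤n = ^-monoʳ-≤ 2 {1} {wordSize n}
      (≤-trans (1≤log 2≤n) (m≤n*m ⌊log₂ n ⌋ (6 + 6 * y)))

    fits : ∀ {n} → 2 ≤ n → (S : Instance c n) →
           length (words (wordSize n) (fragment S)) + dim S ≤ 2 ^ wordSize n
    fits {n} 2≤n S = begin
      length (words (wordSize n) (fragment S)) + dim S
        ≡⟨ cong (_+ dim S) (length-words (wordSize n) (fragment S)) ⟩
      2 + 3 * size (fragment S) + dim S
        ≤⟨ total-crude {size (fragment S)} {n} {dim S} (<⇒≤ 2≤n)
             (size-crude {size (fragment S)} {n} {dim S} {τ S} {h S} {m S} (m≤d S) (1≤τ S) (size-fragment S)) ⟩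
      2 ^ 4 * n * 2 ^ (3 * dim S)
        ≤⟨ words-fit {n} {dim S} {⌊log₂ n ⌋} {y} (1≤log 2≤n) (<⇒≤ (n<2^[1+⌊log₂n⌋] n))
             (rounding-upper 1 {c} {dim S} {n} y (suc ⌊log₂ n ⌋) c≤y (<⇒≤ 2≤n)
               (subst (λ z → n ≤ 2 ^ z) (sym (*-identityˡ (suc ⌊log₂ n ⌋))) (<⇒≤ (n<2^[1+⌊log₂n⌋] n)))
               (rounds S)) ⟩
      2 ^ wordSize n ∎
      where open ≤-Reasoning

    structure : OVDataStructure c
    structure = record
      { wordSize    = wordSize
      ; wordSize-Θ  = 1 , 6 + 6 * y , λ n _ →
          ≤-trans (m≤n*m ⌊log₂ n ⌋ (6 + 6 * y)) (≤-reflexive (sym (*-identityˡ (wordSize n)))) , ≤-refl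
      ; registers   = 3
      ; program     = program
      ; preprocess  = λ {n} S → words (wordSize n) (fragment S)
      ; addressable = fits
      -- Two instructions of start-up, nine per node, and at most four at the final pointer.
      ; time        = λ n (S , q) → 2 + (9 * depth (fragment S) + 4)
      ; correct     = λ {n} 2≤n S q → eval (fragment S) q ,
          words-answer (wordSize n) (1<words 2≤n) (fragment S) (fits 2≤n S) q ,
          subst (λ b → T b ⇔ VecAny.Any (Orthogonal q) (vectors S)) (sym (eval-fragment S q)) (any-orth q (vectors S))
      }

    -- The power of two forces `unit n` to be at least 4 + C + P, so that the constants 3 + C and 3
    -- + P are absorbed by one more unit.
    threshold : ℕ
    threshold = 2 ⊔ (N₀ ⊔ 2 ^ (D * (4 + C + P)))

    c₃ = 3 + C

    module Large (n : ℕ) (n-large : threshold ≤ n) (S : Instance c n) where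
      open ≤-Reasoning

      2≤n : 2 ≤ n
      2≤n = ≤-trans (m≤m⊔n 2 (N₀ ⊔ 2 ^ (D * (4 + C + P)))) n-large

      N₀≤n : N₀ ≤ n
      N₀≤n = ≤-trans (≤-trans (m≤m⊔n N₀ (2 ^ (D * (4 + C + P)))) (m≤n⊔m 2 (N₀ ⊔ 2 ^ (D * (4 + C + P))))) n-large

      u-large : 4 + C + P ≤ u S
      u-large = unit-large (4 + C + P) n
        (≤-trans (≤-trans (m≤n⊔m N₀ (2 ^ (D * (4 + C + P)))) (m≤n⊔m 2 (N₀ ⊔ 2 ^ (D * (4 + C + P))))) n-large)

      1≤n : 1 ≤ n
      1≤n = <⇒≤ 2≤n

      n≤ : n ≤ 2 ^ (D * suc (u S))
      n≤ = <⇒≤ (unit-upper n)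

      Cu≤d : C * u S ≤ dim S
      Cu≤d = rounding-lower D {c} {dim S} {n} C (u S) c≥C (unit-lower n 1≤n) (rounds S)

      d≤u : dim S ≤ c₃ * suc (u S)
      d≤u = rounding-upper D {c} {dim S} {n} (3 + C) (suc (u S)) c≤C 1≤n n≤ (rounds S)

      d≤v : dim S ≤ c₃ * v S
      d≤v = ≤-trans d≤u (*-monoʳ-≤ c₃ (n<2^n (u S)))

      M≤C : M ≤ C
      M≤C = ≤-trans (m≤n+m M D) D+M≤C

      m≡Mu : m S ≡ M * u S
      m≡Mu = m≤n⇒m⊓n≡m (≤-trans (*-monoˡ-≤ (u S) M≤C) Cu≤d)

      light-ones : All (λ s → ones s ≤ K * u S) (light S)
      light-ones = All.map bound (remainder-light (τ S) (h S) (m S) (orders S) (toList (vectors S)))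
        where
        bound : ∀ {s} → All (λ y → weight (take (m S) y) s < h S) (orders S) → ones s ≤ K * u S
        bound {s} p = light≤ {m S} {ones s} {dim S} {h S} {K} {M} {H} {C} {u S} m≡Mu refl 1≤M (≤-trans (s≤s z≤n) u-large)
          (subst₂ (λ W d → m S * W ≤ d * h S) (weight-allFin s) (length-coordinates S)
            (light-weight s (m S) (h S) (coordinates S)
              (subst (m S ≤_) (sym (length-coordinates S)) (m≤d S))
              (subst (λ k → All (λ y → weight (take (m S) y) s < h S) (rotations k (coordinates S)))
                (sym (length-coordinates S)) p)))
          d≤u (≤-trans (≤-trans (n≤1+n (3 + C)) (m≤m+n (4 + C) P)) u-large) H-window

      E : ℕ
      E = g * D₁

      light-length : length (light S) ≤ (suc K * v S) * (C₀ * (2 ^ E * v S ^ E))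
      -- Admissibility bounds the binomial coefficient only at roundings of `a`, so one has to be
      -- exhibited. It is at least P u, hence at least the K u ones of a light vector.
      light-length = with-rounding (roundable a a>0 n 2≤n)
        where
        with-rounding : ∃[ k ] k Rounds a ·log n → length (light S) ≤ (suc K * v S) * (C₀ * (2 ^ E * v S ^ E))
        with-rounding (k , k-rounds) = begin
          length (light S)
            ≤⟨ length≤ball (K * u S) (remainder-unique (τ S) (h S) (m S) (orders S) (toList-unique (distinct S))) light-ones ⟩
          ball (dim S) (K * u S)
            ≤⟨ ball≤C (dim S) (K * u S) k
                 (≤-trans (*-monoˡ-≤ (u S) K≤P) (rounding-lower D {a} {k} {n} P (u S) a≥P (unit-lower n 1≤n) k-rounds))
                 (k+k′≤d {k} {dim S} {K} {P} {C} {u S}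
                   (rounding-upper D {a} {k} {n} (3 + P) (suc (u S)) a≤P 1≤n n≤ k-rounds)
                   (≤-trans (+-monoˡ-≤ P (≤-trans (n≤1+n 3) (m≤m+n 4 C))) u-large) K+P+4≤C Cu≤d) ⟩
          suc (K * u S) * binomial c a n ((dim S , k) , rounds S , k-rounds)
            ≤⟨ *-mono-≤ (s≤s (≤-trans (*-monoʳ-≤ K (n≤1+n (u S))) (m≤n+m (K * suc (u S)) (u S))))
                 (binomial-power {g = g} {C₀} {n} {D₁} {u S}
                   (binomial≤ n N₀≤n 1≤n ((dim S , k) , rounds S , k-rounds)) n≤) ⟩
          suc K * suc (u S) * (C₀ * 2 ^ (E * suc (u S)))
            ≤⟨ *-mono-≤ (*-monoʳ-≤ (suc K) (n<2^n (u S)))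
                 (≤-reflexive (cong (C₀ *_) (2^[a*suc-u] E (u S)))) ⟩
          (suc K * v S) * (C₀ * (2 ^ E * v S ^ E)) ∎

      v^ : ∀ k → v S ^ k ≡ 2 ^ (k * u S)
      v^ k = trans (^-*-assoc 2 (u S) k) (cong (2 ^_) (*-comm (u S) k))

      time≤ : 2 + (9 * depth (fragment S) + 4) ≤
        (6 + 9 * (2 * c₃ * c₃ + suc K * (C₀ * 2 ^ E) * c₃)) * 2 ^ ((D ∸ 1) * u S)
      time≤ = subst (λ z → 2 + (9 * depth (fragment S) + 4) ≤
          (6 + 9 * (2 * c₃ * c₃ + suc K * (C₀ * 2 ^ E) * c₃)) * z) (v^ (D ∸ 1))
        (time-bound {depth (fragment S)} {dim S} {length (light S)} {τ S} {c₃} {K} {C₀} {D₁} {E} {v S}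
          (1≤v S) 4≤D₁ (depth-fragment S) refl d≤v light-length)

      τ≤table : τ S ≤ 2 ^ (dim S ∸ m S)
      τ≤table = begin
        τ S                           ≡⟨ v^ (D ∸ 4) ⟩
        2 ^ ((D ∸ 4) * u S)           ≤⟨ ^-monoʳ-≤ 2 (m+n≤o⇒m≤o∸n ((D ∸ 4) * u S) room) ⟩
        2 ^ (dim S ∸ m S)             ∎
        where
        room : (D ∸ 4) * u S + m S ≤ dim S
        room = begin
          (D ∸ 4) * u S + m S         ≤⟨ +-mono-≤ (*-monoˡ-≤ (u S) (m∸n≤m D 4)) (≤-reflexive m≡Mu) ⟩
          D * u S + M * u S           ≡⟨ *-distribʳ-+ (u S) D M ⟨
          (D + M) * u S               ≤⟨ *-monoˡ-≤ (u S) D+M≤C ⟩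
          C * u S                     ≤⟨ Cu≤d ⟩
          dim S                       ∎

      space≤ : length (words (wordSize n) (fragment S)) ≤
        (2 + 3 * (2 ^ D * c₃ * 2 ^ c₃ * (c₃ + c₃ + 1) + 2 ^ D * c₃)) * 2 ^ (R * u S)
      space≤ = subst₂ (λ x z → x ≤ (2 + 3 * (2 ^ D * c₃ * 2 ^ c₃ * (c₃ + c₃ + 1) + 2 ^ D * c₃)) * z)
        (sym (length-words (wordSize n) (fragment S))) (v^ R)
        (space-bound {size (fragment S)} {n} {dim S} {τ S} {m S} {h S} {c₃} {D} {C} {R} {H} {v S} {u S}
          (1≤v S) 4≤D refl R+H≡9+C (≤-trans (+-monoʳ-≤ D H≤M) D+M≤C)
          (size-fragment S) (m≤d S) τ≤table refl (sym (v^ H)) refl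
          (≤-trans n≤ (≤-reflexive (2^[a*suc-u] D (u S)))) d≤u d≤v)

    sublinear : TrulySublinear (OVDataStructure.time structure)
    sublinear = from-frac (frac 1 D)
      where
      from-frac : ∃[ δ ] ι D ℚ.* δ ≡ ι 1 → TrulySublinear (OVDataStructure.time structure)
      from-frac (δ , Dδ≡1) = fromℚ δ ,
        (δ , frac-pos {D = D} {δ} (s≤s z≤n) Dδ≡1 , 0 , λ _ _ → ℚₚ.≤-reflexive (ℚₚ.+-identityˡ δ)) ,
        is-O D (OVDataStructure.time structure) (1ℝ - fromℚ δ) (D ∸ 1)
          (6 + 9 * (2 * c₃ * c₃ + suc K * (C₀ * 2 ^ (g * D₁)) * c₃)) threshold
          (0 , λ _ _ → D-1≤) (λ n n-large (S , q) → Large.time≤ n n-large S)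
        where
        D-1≤ : ι (D ∸ 1) ℚ.≤ ι D ℚ.* (1ℚ ℚ.- δ)
        D-1≤ = rearrange (ℚₚ.≤-reflexive Dδ≡1) (begin
          ι (D ∸ 1) ℚ.+ ι 1                          ≡⟨ ι-+ (D ∸ 1) 1 ⟨
          ι (D ∸ 1 + 1)                              ≡⟨ cong ι (m∸n+n≡m (≤-trans (s≤s z≤n) 4≤D)) ⟩
          ι D                                        ≡⟨ solve 2 (λ d x → d := d :* (con 1ℚ :- x) :+ d :* x) refl (ι D) δ ⟩
          ι D ℚ.* (1ℚ ℚ.- δ) ℚ.+ ι D ℚ.* δ           ∎)
          where
          open ≡-Reasoning
          open +-*-Solver

    small : OVDataStructure.space structure is-O[n^ e ]
    small = is-O D (OVDataStructure.space structure) e R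
      (2 + 3 * (2 ^ D * c₃ * 2 ^ c₃ * (c₃ + c₃ + 1) + 2 ^ D * c₃)) threshold
      (Choice.e≥R choice) (λ n n-large S → Large.space≤ n n-large S)


open import Defs
open import Data.Product.Base using (_×_; _,_; Σ-syntax)
open Construction
open Choosing using (choice)

theorem3 : (c c₁ ε : ℝ) (1<c : 1ℝ < c) → IsSupremum (Admissible c) c₁ →
    0ℝ < ε → ε < c₁ → ε < c - 1ℝ →
    Σ[ D ∈ OVDataStructure c ]
    TrulySublinear (OVDataStructure.time D) ×
    OVDataStructure.space D is-O[n^ c - ((c₁ - ε) / c [ 1<⇒0< c 1<c ]) * (c - 1ℝ - ε) ]
theorem3 c c₁ ε 1<c sup 0<ε ε<c₁ ε<c-1 = structure ch , sublinear ch , small ch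
  where ch = choice c c₁ ε 1<c sup 0<ε ε<c₁ ε<c-1
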